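{- Let $1<k\le n$ be integers. The poset $\mathrm{Poset}(\mathrm{PF}_{n,k})$ admits a symmetric chain decomposition.
   Context: A (graded) poset $P$ of height $N$ has a symmetric chain decomposition if its elements can be partitioned into saturated chains such that, for each chain, the ranks of its minimum and maximum elements sum to $N$. The poset $\mathrm{Poset}(\mathrm{PF}_{n,k})$ defined below has height $n$, the rank of a partition being $n+1$ minus its number of blocks. Write $[n]=\{1,\dots,n\}$. A parking function of length $n$ is an $n$-tuple $(a_1,\dots,a_n)$ of positive integers whose weakly increasing rearrangement $b_1\le\dots\le b_n$ satisfies $b_i\le i$ for all $i$; $\mathrm{PF}_n$ is the set of these. For $1<k\le n$, $\mathrm{PF}_{n,k}$ is the set of $a\in\mathrm{PF}_n$ such that $k$ is not an entry of $a$ but each of $k+1,\dots,n$ is an entry of $a$. $\mathrm{NC}_m$ is the lattice of noncrossing partitions of $[m]$ (partitions for which, placing $1,\dots,m$ in clockwise order on a circle, the convex hulls of the blocks are pairwise disjoint), ordered by refinement, with the finer partition being smaller. Each covering relation $\sigma<\tau$ in $\mathrm{NC}_{n+1}$ merges two blocks $B_1,B_2$ of $\sigma$ into one block $B=B_1\cup B_2$ of $\tau$; name them so that $\min B\in B_1$, and label the covering relation by the largest element of $B_1$ that is less than every element of $B_2$. Reading the labels of a maximal chain of $\mathrm{NC}_{n+1}$ from bottom to top gives a parking function of length $n$, and this is a (known) bijection from maximal chains of $\mathrm{NC}_{n+1}$ to $\mathrm{PF}_n$. $\mathrm{Poset}(\mathrm{PF}_{n,k})$ is the poset whose Hasse diagram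 is the union of the maximal chains of $\mathrm{NC}_{n+1}$ corresponding to elements of $\mathrm{PF}_{n,k}$: its elements are the noncrossing partitions lying on at least one of these chains, and its order is the reflexive-transitive closure of the covering relations occurring in these chains (it need not be an induced subposet of $\mathrm{NC}_{n+1}$). -}

module Defs where

open import Level using (Level; 0ℓ; _⊔_)
open import Data.Fin as Fin using (Fin; toℕ)
import Data.Fin.Properties as Fin
open import Data.Fin.Subset as Subset using (Subset; _∪_)
open import Data.List using (List; []; _∷_; _++_; map; filter; length; allFin; concatMap)
open import Data.List.NonEmpty using (List⁺; toList; head; last)
open import Data.List.Membership.Propositional using (_∈_)
import Data.List.Membership.Setoid as SetoidMembership
open import Data.List.Relation.Binary.Permutation.Propositional using (_↭_)
open import Data.List.Relation.Unary.All using (All)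
open import Data.List.Relation.Unary.Linked using (Linked; []; [-]; _∷_)
open import Data.List.Relation.Unary.Sorted.TotalOrder using (Sorted)
import Data.List.Relation.Unary.Unique.Setoid as SetoidUnique
open import Data.Nat using (ℕ; suc; _+_; _∸_; _≤_; _<_)
import Data.Nat.Properties as ℕ
open import Data.Product using (Σ-syntax; ∃; ∃-syntax; ∃₂; _×_; _,_; proj₁; proj₂)
open import Data.Sum using (_⊎_)
open import Data.Vec as Vec using (Vec; []; _∷_; lookup; tabulate)
import Data.Vec.Membership.Propositional as Vec
import Data.Vec.Properties as Vec
import Data.Vec.Relation.Unary.All as Vec
open import Function using (_∘_)
open import Relation.Binary.Bundles using (Poset)
open import Relation.Binary.Construct.Closure.ReflexiveTransitive using (Star; ε; _◅_; _◅◅_)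
import Relation.Binary.Properties.Poset as PosetProperties
open import Relation.Binary.PropositionalEquality
open import Relation.Nullary using (¬_; does; recompute)

module Chains {c ℓ₁ ℓ₂ : Level} (P : Poset c ℓ₁ ℓ₂) where
  open Poset P using (Carrier; module Eq) renaming (_≤_ to _⊑_)
  open PosetProperties P using () renaming (_<_ to _⊏_) public
  open SetoidMembership Eq.setoid using () renaming (_∈_ to _∈ₛ_)
  open SetoidUnique Eq.setoid using (Unique)

  infix 4 _⋖_

  _⋖_ : Carrier → Carrier → Set (c ⊔ ℓ₁ ⊔ ℓ₂)
  x ⋖ y = x ⊏ y × (∀ z → x ⊏ z → ¬ (z ⊏ y))

  -- Finite chains are listed from bottom to top; a maximal one contains
  -- every element comparable to all of its members.
  IsMaximalChain : List Carrier → Set (c ⊔ ℓ₁ ⊔ ℓ₂)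
  IsMaximalChain xs =
    Linked _⊏_ xs × (∀ y → All (λ x → x ⊑ y ⊎ y ⊑ x) xs → y ∈ₛ xs)

  IsSymmetricChain : (rank : Carrier → ℕ) (N : ℕ) → List⁺ Carrier → Set (c ⊔ ℓ₁ ⊔ ℓ₂)
  IsSymmetricChain rank N xs =
    Linked _⋖_ (toList xs) × rank (head xs) + rank (last xs) ≡ N

  -- The chains partition the poset: their concatenation contains every
  -- element exactly once.
  HasSymmetricChainDecomposition : (rank : Carrier → ℕ) (N : ℕ) → Set (c ⊔ ℓ₁ ⊔ ℓ₂)
  HasSymmetricChainDecomposition rank N =
    Σ[ chains ∈ List (List⁺ Carrier) ]
      All (IsSymmetricChain rank N) chains
      × Unique (concatMap toList chains)
      × (∀ x → x ∈ₛ concatMap toList chains)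

open Chains public using (HasSymmetricChainDecomposition)

------------------------------------------------------------------------
-- Parking functions

IsParkingFunction : ∀ {n} → Vec ℕ n → Set
IsParkingFunction {n} a =
  Vec.All (1 ≤_) a
  × Σ[ b ∈ Vec ℕ n ]
      Vec.toList b ↭ Vec.toList a
      × Sorted ℕ.≤-totalOrder (Vec.toList b)
      × (∀ i → lookup b i ≤ suc (toℕ i))

InPF : (n k : ℕ) → Vec ℕ n → Set
InPF n k a =
  IsParkingFunction a
  × ¬ (k Vec.∈ a)
  × (∀ j → k < j → j ≤ n → j Vec.∈ a)

------------------------------------------------------------------------
-- Noncrossing partitions

-- The number i + 1 of [m] = {1,…,m} is represented by i : Fin m.
-- A set partition of [m] is encoded by the vector sending each element to
-- the minimum of its block.  The laws are irrelevant, so that partitions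
-- with the same blocks are propositionally equal.  Noncrossing: the convex
-- hulls of two distinct blocks meet iff there are a < b < c < d with a, c in
-- one of them and b, d in the other.
record NC (m : ℕ) : Set where
  field
    rep : Vec (Fin m) m

  infix 4 _~_

  _~_ : Fin m → Fin m → Set
  i ~ j = lookup rep i ≡ lookup rep j

  field
    .rep-≤       : ∀ i → lookup rep i Fin.≤ i
    .rep-~       : ∀ i → lookup rep i ~ i
    .noncrossing : ∀ {a b c d} → a Fin.< b → b Fin.< c → c Fin.< d →
                   a ~ c → b ~ d → a ~ b

  block : Fin m → Subset m
  block i = tabulate λ j → does (lookup rep i Fin.≟ lookup rep j)

  -- One block for each element that is the minimum of its block.
  blocks : List (Subset m)
  blocks = map block (filter (λ i → lookup rep i Fin.≟ i) (allFin m))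

open NC public using (rep; blocks)

infix 4 _≼_

_≼_ : ∀ {m} → NC m → NC m → Set
σ ≼ τ = ∀ i j → NC._~_ σ i j → NC._~_ τ i j

NC-≡ : ∀ {m} {σ τ : NC m} → rep σ ≡ rep τ → σ ≡ τ
NC-≡ refl = refl

≼-reflexive : ∀ {m} {σ τ : NC m} → σ ≡ τ → σ ≼ τ
≼-reflexive refl i j p = p

≼-trans : ∀ {m} {σ τ υ : NC m} → σ ≼ τ → τ ≼ υ → σ ≼ υ
≼-trans p q i j = q i j ∘ p i j

module _ {m : ℕ} where
  rep-≤ : (σ : NC m) → ∀ i → lookup (rep σ) i Fin.≤ i
  rep-≤ record { rep-≤ = p } i = recompute (_ Fin.≤? _) (p i)

  rep-~ : (σ : NC m) → ∀ i → NC._~_ σ (lookup (rep σ) i) i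
  rep-~ record { rep-~ = p } i = recompute (_ Fin.≟ _) (p i)

  noncrossing : (σ : NC m) → ∀ {a b c d} → a Fin.< b → b Fin.< c → c Fin.< d →
                NC._~_ σ a c → NC._~_ σ b d → NC._~_ σ a b
  noncrossing record { noncrossing = p } a<b b<c c<d a~c b~d =
    recompute (_ Fin.≟ _) (p a<b b<c c<d a~c b~d)

rep-antimono : ∀ {m} (σ τ : NC m) → σ ≼ τ → ∀ i → lookup (rep τ) i Fin.≤ lookup (rep σ) i
rep-antimono σ τ σ≼τ i =
  subst (Fin._≤ r) (σ≼τ r i (rep-~ σ i)) (rep-≤ τ r)
  where r = lookup (rep σ) i

≼-antisym : ∀ {m} {σ τ : NC m} → σ ≼ τ → τ ≼ σ → σ ≡ τ
≼-antisym {σ = σ} {τ} p q = NC-≡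
  (trans (sym (Vec.tabulate∘lookup (rep σ)))
  (trans (Vec.tabulate-cong (λ i → Fin.≤-antisym (rep-antimono τ σ q i) (rep-antimono σ τ p i)))
         (Vec.tabulate∘lookup (rep τ))))

NCPoset : ℕ → Poset 0ℓ 0ℓ 0ℓ
NCPoset m = record
  { Carrier = NC m
  ; _≈_     = _≡_
  ; _≤_     = _≼_
  ; isPartialOrder = record
    { isPreorder = record
      { isEquivalence = isEquivalence
      ; reflexive     = ≼-reflexive
      ; trans         = λ {σ τ υ} → ≼-trans {σ = σ} {τ} {υ}
      }
    ; antisym = ≼-antisym
    }
  }

------------------------------------------------------------------------
-- Edge labels and the posets Poset(PF_{n,k})

-- The covering relation σ ⋖ τ, which merges B₁ and B₂, has label ℓ.
HasLabel : ∀ {m} → NC m → NC m → ℕ → Set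
HasLabel {m} σ τ ℓ =
  Σ[ B₁ ∈ Subset m ] Σ[ B₂ ∈ Subset m ] Σ[ x ∈ Fin m ]
    B₁ ∈ blocks σ × B₂ ∈ blocks σ × B₁ ≢ B₂ × B₁ ∪ B₂ ∈ blocks τ
    × (∃[ i ] i Subset.∈ B₁ × (∀ j → j Subset.∈ B₁ ∪ B₂ → i Fin.≤ j))
    × IsBelow B₁ B₂ x
    × (∀ y → IsBelow B₁ B₂ y → y Fin.≤ x)
    × ℓ ≡ suc (toℕ x)
  where
  IsBelow : Subset m → Subset m → Fin m → Set
  IsBelow B₁ B₂ x = x Subset.∈ B₁ × (∀ j → j Subset.∈ B₂ → x Fin.< j)

data HasLabels {m : ℕ} : ∀ {n} → List (NC m) → Vec ℕ n → Set where
  [-] : ∀ {σ} → HasLabels (σ ∷ []) []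
  _∷_ : ∀ {n σ τ c ℓ} {a : Vec ℕ n} →
        HasLabel σ τ ℓ → HasLabels (τ ∷ c) a → HasLabels (σ ∷ τ ∷ c) (ℓ ∷ a)

IsPFChain : (n k : ℕ) → List (NC (suc n)) → Set
IsPFChain n k c =
  Chains.IsMaximalChain (NCPoset (suc n)) c × ∃[ a ] HasLabels c a × InPF n k a

Edge : (n k : ℕ) → NC (suc n) → NC (suc n) → Set
Edge n k σ τ = ∃[ c ] IsPFChain n k c × ∃₂ λ xs ys → c ≡ xs ++ σ ∷ τ ∷ ys

Element : (n k : ℕ) → Set
Element n k = Σ[ σ ∈ NC (suc n) ] ∃[ c ] IsPFChain n k c × σ ∈ c

Edge⇒≼ : ∀ {n k σ τ} → Edge n k σ τ → σ ≼ τ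
Edge⇒≼ (c , ((linked , _) , _) , xs , ys , refl) = go xs linked
  where
  open Chains (NCPoset _) using (_⊏_)
  go : ∀ xs {σ τ ys} → Linked _⊏_ (xs ++ σ ∷ τ ∷ ys) → σ ≼ τ
  go []           (r ∷ _)  = proj₁ r
  go (_ ∷ [])     (_ ∷ rs) = go [] rs
  go (_ ∷ x ∷ xs) (_ ∷ rs) = go (x ∷ xs) rs

Star⇒≼ : ∀ {n k σ τ} → Star (Edge n k) σ τ → σ ≼ τ
Star⇒≼ ε _ _ p = p
Star⇒≼ (e ◅ es) i j p = Star⇒≼ es i j (Edge⇒≼ e i j p)

-- Elements are identified when they are the same partition, whatever chain
-- witnesses their membership.
PosetPF : (n k : ℕ) → Poset 0ℓ 0ℓ 0ℓ
PosetPF n k = record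
  { Carrier = Element n k
  ; _≈_     = λ x y → proj₁ x ≡ proj₁ y
  ; _≤_     = λ x y → Star (Edge n k) (proj₁ x) (proj₁ y)
  ; isPartialOrder = record
    { isPreorder = record
      { isEquivalence = record { refl = refl ; sym = sym ; trans = trans }
      ; reflexive     = λ { refl → ε }
      ; trans         = _◅◅_
      }
    ; antisym = λ p q → ≼-antisym (Star⇒≼ p) (Star⇒≼ q)
    }
  }

rank : ∀ {n k} → Element n k → ℕ
rank {n} (σ , _) = suc n ∸ length (blocks σ)

{-# OPTIONS --safe #-}

-- Along a maximal chain each x in {2, …, n + 1} stops being a block minimum
-- exactly once, in a merge with a label smaller than x.  If each of k + 1, …, n
-- is a label and k is not, counting forces every x > k + 1 to be merged with
-- label x − 1, and k + 1 to be merged into a block without k.  So the elements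
-- of the poset are the noncrossing partitions in which every x > k + 1 is a block
-- minimum or shares the block of x − 1, and k + 1 is a block minimum while k is
-- not in the block of 1, or shares its block with some i < k.  Conversely each of
-- them is joined to the bottom by splitting off the largest non-minima and to the
-- top by merging blocks into the block of 1, with permitted labels throughout.
--
-- For the decomposition, passing from n to n + 1 multiplies the poset by a
-- two-element chain (the new element is a singleton or joins the block of n + 1).
-- For n = k, and likewise for NC_m, the minimum of the block of the last element
-- splits the poset into products of smaller NC_a and chains, all of them centred
-- in the middle rank, and a product of two chains is peeled into hooks.

module Submission where

open import Defs
open import Data.Bool using (true; false; if_then_else_)
open import Data.Fin as Fin using (Fin; zero; suc; toℕ; fromℕ<)
import Data.Fin.Properties as Fin
open import Data.Fin.Subset as Subset using (Subset; _∪_)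
import Data.Fin.Subset.Properties as Subset
open import Data.List as List using (List; []; _∷_; _++_; applyUpTo; length; filter; allFin; map; concatMap; cartesianProduct)
open import Data.List.Properties using (length-applyUpTo; length-map; length-++; length-filter; length-tabulate; ++-assoc; map-++; concatMap-++; cartesianProductWith-zeroʳ; cartesianProductWith-distribʳ-++)
open import Data.List.Membership.Propositional using (_∈_; _∉_)
open import Data.List.Membership.Propositional.Properties using (∈-map⁻; ∈-map⁺; ∈-filter⁺; ∈-filter⁻; ∈-allFin; ∈-applyUpTo⁺; ∈-applyUpTo⁻; ∈-++⁺ʳ; ∈-++⁺ˡ; ∈-++⁻; ∈-∃++; ∈-cartesianProduct⁺; ∈-cartesianProduct⁻)
open import Data.List.Membership.Propositional.Properties.WithK using (unique∧set⇒bag)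
import Data.List.Membership.DecPropositional as DecMembership
open import Data.List.NonEmpty as List⁺ using (List⁺; _∷_; toList)
open import Data.List.Relation.Binary.BagAndSetEquality using (∼bag⇒↭)
open import Data.List.Relation.Binary.Permutation.Propositional using (_↭_; prep; ↭-refl; ↭-reflexive; ↭-trans; ↭-sym; ↭⇒↭ₛ; module PermutationReasoning)
open import Data.List.Relation.Binary.Permutation.Propositional.Properties using (↭-map-inv; map⁺; All-resp-↭; ∈-resp-↭; ↭-length; ++⁺; ++⁺ˡ; ++⁺ʳ; shifts; ++-comm)
import Data.List.Relation.Binary.Permutation.Setoid.Properties as Permutationₛ
open import Data.List.Relation.Binary.Pointwise using (Pointwise; []; _∷_; Pointwise-length)
open import Data.List.Relation.Unary.All as All using (All; []; _∷_)
import Data.List.Relation.Unary.All.Properties as All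
import Data.List.Relation.Unary.AllPairs.Properties as AllPairs
open import Data.List.Relation.Unary.Any using (here; there)
import Data.List.Relation.Unary.Any.Properties as Any
open import Data.List.Relation.Unary.Linked as Linked using (Linked; []; [-]; _∷_)
import Data.List.Relation.Unary.Linked.Properties as Linked
open import Data.List.Relation.Unary.Unique.Propositional using (Unique; []; _∷_)
import Data.List.Relation.Unary.Unique.Propositional.Properties as Unique
open import Data.Nat
open import Data.Nat.Properties
open import Algebra.Properties.CommutativeSemigroup +-commutativeSemigroup using (interchange)
open import Data.List.Sort.InsertionSort.Base ≤-decTotalOrder using (insert; sort)
open import Data.List.Sort.InsertionSort.Properties ≤-decTotalOrder using (sort-↭; sort-↗)
open import Data.Product hiding (map)
open import Data.Sum as Sum using (_⊎_; inj₁; inj₂; [_,_]′)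
open import Data.Unit using (⊤; tt)
open import Data.Vec as Vec using (Vec; []; _∷_; lookup; tabulate)
import Data.Vec.Membership.Propositional.Properties as Vec
import Data.Vec.Properties as Vec
import Data.Vec.Relation.Unary.All.Properties as VecAll
open import Function using (_∘_; id; flip; mk⇔)
open import Relation.Binary.Construct.Closure.ReflexiveTransitive using (Star; ε; _◅_; _◅◅_; gmap)
open import Relation.Binary.Definitions using (tri<; tri≈; tri>)
open import Relation.Binary.PropositionalEquality hiding ([_])
open import Relation.Nullary
open import Relation.Nullary.Decidable using (dec-true)
open import Relation.Unary using (Decidable)

-- Noncrossing partitions as functions to block minima

-- The obstacle is that the order is not induced: two elements of the poset may differ by a merge
-- with the forbidden label k. Counting elements from 1, a merge absorbing the block with minimum x
-- has a label at most x - 1, and exactly x - 1 if x > k + 1. So among merges between elements of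
-- the poset only the absorption of k + 1 can have label k, and it does precisely when k lies in the
-- absorbing block. This one local condition, `Avoids`, makes such a merge an edge, since paths to
-- the bottom and to the top start from every element. The decomposition therefore only has to
-- produce such merges and never sees a maximal chain again. On m points a chain is symmetric if the
-- block counts of its ends add up to m + 1. If the last point lies in a block with minimum strictly
-- between the first and the last point, it adds no block, and NC_a × NC_b with a + b = m - 1 gives
-- (a + 1) + (b + 1) = m + 1. The two extreme minima give copies of NC_{m-1} with sums m and m + 2,
-- one off on either side; that is why they are taken together as a product with a two-element
-- chain.

record IsNC (m : ℕ) (f : ℕ → ℕ) : Set where
  field
    below     : ∀ i → f i ≤ i
    idem      : ∀ i → f (f i) ≡ f i
    beyond    : ∀ {i} → m ≤ i → f i ≡ i
    uncrossed : ∀ {a b c d} → a < b → b < c → c < d → f a ≡ f c → f b ≡ f d → f a ≡ f b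

  f0≡0 : f 0 ≡ 0
  f0≡0 = n≤0⇒n≡0 (below 0)

open IsNC

data Position (m : ℕ) : ℕ → Set where
  inside  : (i : Fin m) → Position m (toℕ i)
  outside : ∀ {i} → m ≤ i → Position m i

position : ∀ m i → Position m i
position m i with i <? m
... | yes i<m = subst (Position m) (Fin.toℕ-fromℕ< i<m) (inside (fromℕ< i<m))
... | no  i≮m = outside (≮⇒≥ i≮m)

opaque
  -- Extending by the identity beyond m keeps all conditions free of bounds.
  minOf : ∀ {m} → NC m → ℕ → ℕ
  minOf {m} σ i with i <? m
  ... | yes i<m = toℕ (lookup (rep σ) (fromℕ< i<m))
  ... | no  _   = i

  minOf-toℕ : ∀ {m} (σ : NC m) i → minOf σ (toℕ i) ≡ toℕ (lookup (rep σ) i)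
  minOf-toℕ {m} σ i with toℕ i <? m
  ... | yes p = cong (λ j → toℕ (lookup (rep σ) j)) (Fin.fromℕ<-toℕ i p)
  ... | no ¬p = contradiction (Fin.toℕ<n i) ¬p

  minOf-beyond : ∀ {m} (σ : NC m) {i} → m ≤ i → minOf σ i ≡ i
  minOf-beyond {m} σ {i} m≤i with i <? m
  ... | yes p = contradiction m≤i (<⇒≱ p)
  ... | no  _ = refl

module _ {m : ℕ} (σ : NC m) where
  ~⇒minOf : ∀ {i j} → NC._~_ σ i j → minOf σ (toℕ i) ≡ minOf σ (toℕ j)
  ~⇒minOf {i} {j} p = trans (minOf-toℕ σ i) (trans (cong toℕ p) (sym (minOf-toℕ σ j)))

  minOf⇒~ : ∀ {i j} → minOf σ (toℕ i) ≡ minOf σ (toℕ j) → NC._~_ σ i j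
  minOf⇒~ {i} {j} p = Fin.toℕ-injective (trans (sym (minOf-toℕ σ i)) (trans p (minOf-toℕ σ j)))

  minOf-≤ : ∀ i → minOf σ i ≤ i
  minOf-≤ i with position m i
  ... | inside j = subst (_≤ toℕ j) (sym (minOf-toℕ σ j)) (rep-≤ σ j)
  ... | outside p = ≤-reflexive (minOf-beyond σ p)

  minOf-isNC : IsNC m (minOf σ)
  minOf-isNC .below = minOf-≤
  minOf-isNC .idem i with position m i
  ... | inside j = trans (cong (minOf σ) (minOf-toℕ σ j)) (~⇒minOf (rep-~ σ j))
  ... | outside p = cong (minOf σ) (minOf-beyond σ p)
  minOf-isNC .beyond = minOf-beyond σ
  minOf-isNC .uncrossed {a} {b} {c} {d} a<b b<c c<d a~c b~d
    with position m a | position m b | position m c | position m d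
  ... | inside a | inside b | inside c | inside d =
    ~⇒minOf (noncrossing σ a<b b<c c<d (minOf⇒~ a~c) (minOf⇒~ b~d))
  ... | _ | _ | _ | outside p = contradiction
    (subst (_≤ b) (trans b~d (minOf-beyond σ p)) (minOf-≤ b)) (<⇒≱ (<-trans b<c c<d))
  ... | _ | _ | outside p | inside d = contradiction (≤-trans p (<⇒≤ c<d)) (<⇒≱ (Fin.toℕ<n d))
  ... | _ | outside p | _ | inside d =
    contradiction (≤-trans p (<⇒≤ (<-trans b<c c<d))) (<⇒≱ (Fin.toℕ<n d))
  ... | outside p | _ | _ | inside d =
    contradiction (≤-trans p (<⇒≤ (<-trans a<b (<-trans b<c c<d)))) (<⇒≱ (Fin.toℕ<n d))

minOf-injective : ∀ {m} {σ τ : NC m} → (∀ i → minOf σ i ≡ minOf τ i) → σ ≡ τ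
minOf-injective {σ = σ} {τ} p = NC-≡ (trans (sym (Vec.tabulate∘lookup (rep σ)))
  (trans (Vec.tabulate-cong λ i → Fin.toℕ-injective
            (trans (sym (minOf-toℕ σ i)) (trans (p (toℕ i)) (minOf-toℕ τ i))))
         (Vec.tabulate∘lookup (rep τ))))

module _ {m : ℕ} {f : ℕ → ℕ} (nc : IsNC m f) where
  private
    v : Vec.Vec (Fin m) m
    v = tabulate λ i → fromℕ< (≤-<-trans (nc .below (toℕ i)) (Fin.toℕ<n i))

    v-f : ∀ i → toℕ (lookup v i) ≡ f (toℕ i)
    v-f i = trans (cong toℕ (Vec.lookup∘tabulate _ i)) (Fin.toℕ-fromℕ< _)

    from : ∀ {i j} → lookup v i ≡ lookup v j → f (toℕ i) ≡ f (toℕ j)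
    from {i} {j} p = trans (sym (v-f i)) (trans (cong toℕ p) (v-f j))

    to : ∀ {i j} → f (toℕ i) ≡ f (toℕ j) → lookup v i ≡ lookup v j
    to {i} {j} p = Fin.toℕ-injective (trans (v-f i) (trans p (sym (v-f j))))

  toNC : NC m
  toNC .rep = v
  toNC .NC.rep-≤ i = subst (_≤ toℕ i) (sym (v-f i)) (nc .below (toℕ i))
  toNC .NC.rep-~ i = to (trans (cong f (v-f i)) (nc .idem (toℕ i)))
  toNC .NC.noncrossing a<b b<c c<d a~c b~d = to (nc .uncrossed a<b b<c c<d (from a~c) (from b~d))

  minOf-toNC : ∀ i → minOf toNC i ≡ f i
  minOf-toNC i with position m i
  ... | inside j = trans (minOf-toℕ toNC j) (v-f j)
  ... | outside p = trans (minOf-beyond toNC p) (sym (nc .beyond p))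

≼⇒minOf : ∀ {m} {σ τ : NC m} → σ ≼ τ → ∀ i → minOf τ (minOf σ i) ≡ minOf τ i
≼⇒minOf {m} {σ} {τ} σ≼τ i with position m i
... | inside j = trans (cong (minOf τ) (minOf-toℕ σ j)) (~⇒minOf τ (σ≼τ _ _ (rep-~ σ j)))
... | outside p = cong (minOf τ) (minOf-beyond σ p)

minOf⇒≼ : ∀ {m} {σ τ : NC m} → (∀ i → minOf τ (minOf σ i) ≡ minOf τ i) → σ ≼ τ
minOf⇒≼ {σ = σ} {τ} p i j i~j = minOf⇒~ τ
  (trans (sym (p (toℕ i))) (trans (cong (minOf τ) (~⇒minOf σ i~j)) (p (toℕ j))))

-- Merging and splitting blocks

_[_↦_] : (ℕ → ℕ) → ℕ → ℕ → ℕ → ℕ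
(f [ x ↦ r ]) i with i ≟ x
... | yes _ = r
... | no  _ = f i

module _ (f : ℕ → ℕ) (x r : ℕ) where
  update-≡ : (f [ x ↦ r ]) x ≡ r
  update-≡ with x ≟ x
  ... | yes _ = refl
  ... | no ¬p = contradiction refl ¬p

  update-≢ : ∀ {i} → i ≢ x → (f [ x ↦ r ]) i ≡ f i
  update-≢ {i} i≢x with i ≟ x
  ... | yes p = contradiction p i≢x
  ... | no _  = refl

-- The block with minimum `x` is absorbed by the one with minimum `r`. Only `x` stops being a
-- minimum, so it identifies the merge.
record Merge (f g : ℕ → ℕ) (x r : ℕ) : Set where
  field
    r<x   : r < x
    fr≡r  : f r ≡ r
    fx≡x  : f x ≡ x
    moved : ∀ {i} → f i ≡ x → g i ≡ r
    kept  : ∀ {i} → f i ≢ x → g i ≡ f i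

  gx≡r : g x ≡ r
  gx≡r = moved fx≡x

  gr≡r : g r ≡ r
  gr≡r = trans (kept λ p → <-irrefl (trans (sym fr≡r) p) r<x) fr≡r

  gx≢x : g x ≢ x
  gx≢x p = <-irrefl (trans (sym gx≡r) p) r<x

  x<m : ∀ {m} → IsNC m g → x < m
  x<m nc = ≰⇒> λ m≤x → gx≢x (nc .beyond m≤x)

open Merge

Merge-cong : ∀ {f f′ g g′ x r} → (∀ i → f i ≡ f′ i) → (∀ i → g i ≡ g′ i) →
             Merge f g x r → Merge f′ g′ x r
Merge-cong p q mg .r<x = mg .r<x
Merge-cong p q mg .fr≡r = trans (sym (p _)) (mg .fr≡r)
Merge-cong p q mg .fx≡x = trans (sym (p _)) (mg .fx≡x)
Merge-cong p q mg .moved e = trans (sym (q _)) (mg .moved (trans (p _) e))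
Merge-cong p q mg .kept e = trans (sym (q _)) (trans (mg .kept λ e′ → e (trans (sym (p _)) e′)) (p _))

module _ {m : ℕ} {f : ℕ → ℕ} (nc : IsNC m f) {x : ℕ} (fx≡x : f x ≡ x) (0<x : 0 < x) where
  merge₀ : ℕ → ℕ
  merge₀ i = (id [ x ↦ 0 ]) (f i)

  private
    g : ℕ → ℕ
    g = merge₀

    gm : ∀ {i} → f i ≡ x → g i ≡ 0
    gm {i} p = trans (cong (id [ x ↦ 0 ]) p) (update-≡ id x 0)

    gk : ∀ {i} → f i ≢ x → g i ≡ f i
    gk p = update-≢ id x 0 p

    case-g : ∀ i → (f i ≡ x × g i ≡ 0) ⊎ (f i ≢ x × g i ≡ f i)
    case-g i with f i ≟ x
    ... | yes p = inj₁ (p , refl)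
    ... | no p  = inj₂ (p , refl)

    g0 : ∀ {i} → f i ≡ 0 → g i ≡ 0
    g0 p = trans (gk λ q → <-irrefl (trans (sym p) q) 0<x) p

  merge₀-Merge : Merge f merge₀ x 0
  merge₀-Merge = record
    { r<x = 0<x ; fr≡r = f0≡0 nc ; fx≡x = fx≡x ; moved = gm ; kept = gk }

  -- The block of x is not enclosed by a block other than that of 0.
  merge₀-isNC : x < m → (∀ {c d} → c < x → x ≤ d → f c ≡ f d → f c ≡ 0) → IsNC m merge₀
  merge₀-isNC x<m visible .below i with f i ≟ x
  ... | yes _ = z≤n
  ... | no  _ = nc .below i
  merge₀-isNC x<m visible .idem i with f i ≟ x
  ... | yes _ = g0 (f0≡0 nc)
  ... | no  p = trans (gk (λ q → p (trans (sym (nc .idem i)) q))) (nc .idem i)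
  merge₀-isNC x<m visible .beyond m≤i =
    trans (gk λ p → <⇒≱ x<m (≤-trans m≤i (≤-reflexive (trans (sym (nc .beyond m≤i)) p)))) (nc .beyond m≤i)
  merge₀-isNC x<m visible .uncrossed {a} {b} {c} {d} a<b b<c c<d ga≡gc gb≡gd = go (case-g a) (case-g b)
      (case-g c) (case-g d)
    where
    uc = nc .uncrossed
    z : ∀ {i} → 0 < i → ∀ {j k} → i < j → j < k → f j ≡ 0 → f i ≡ f k → f i ≡ 0
    z 0<i i<j j<k fj≡0 fi≡fk =
      trans (sym (uc 0<i i<j j<k (trans (f0≡0 nc) (sym fj≡0)) fi≡fk)) (f0≡0 nc)
    ≤of : ∀ {i} → f i ≡ x → x ≤ i
    ≤of p = subst (_≤ _) p (nc .below _)
    ne : ∀ {i} → f i ≢ x → i ≢ x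
    ne p refl = p fx≡x
    -- A block around an element of the block of `x` is the block of 0: starting before `x`, it also
    -- spans `x` and `visible` applies; starting after `x`, it would cross the block of `x`.
    vis : ∀ {i k} → i < k → f i ≢ x → f i ≡ f k → ∀ {j} → i < j → j < k → f j ≡ x → f i ≡ 0
    vis {i} {k} i<k i≢ i~k {j} i<j j<k fj with <-cmp i x
    ... | tri< i<x _ _ = visible i<x (≤-trans (≤of fj) (<⇒≤ j<k)) i~k
    ... | tri≈ _ i≡x _ = contradiction i≡x (ne i≢)
    ... | tri> _ _ x<i = contradiction (trans (sym (uc x<i i<j j<k (trans fx≡x (sym fj)) i~k)) fx≡x) i≢
    go : _ → _ → _ → _ → g a ≡ g b
    go (inj₁ (pa , ga)) (inj₁ (pb , gb)) _ _ = trans ga (sym gb)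
    go (inj₁ (pa , ga)) (inj₂ (pb , gb)) (inj₁ (pc , gc)) (inj₁ (pd , gd)) = trans ga
        (trans (sym gd) (sym gb≡gd))
    go (inj₁ (pa , ga)) (inj₂ (pb , gb)) (inj₁ (pc , gc)) (inj₂ (pd , gd)) =
      contradiction (trans (sym (uc a<b b<c c<d (trans pa (sym pc)) (trans (sym gb) (trans gb≡gd gd)))) pa) pb
    go (inj₁ (pa , ga)) (inj₂ (pb , gb)) (inj₂ (pc , gc)) (inj₁ (pd , gd)) = trans ga
        (trans (sym gd) (sym gb≡gd))
    go (inj₁ (pa , ga)) (inj₂ (pb , gb)) (inj₂ (pc , gc)) (inj₂ (pd , gd)) = trans ga (sym (trans gb
      (z (≤-<-trans z≤n a<b) b<c c<d (trans (sym gc) (trans (sym ga≡gc) ga))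
          (trans (sym gb) (trans gb≡gd gd)))))
    go (inj₂ (pa , ga)) (inj₁ (pb , gb)) (inj₁ (pc , gc)) _ = trans ga≡gc (trans gc (sym gb))
    go (inj₂ (pa , ga)) (inj₁ (pb , gb)) (inj₂ (pc , gc)) _ = trans ga (trans
      (vis (<-trans a<b b<c) pa (trans (sym ga) (trans ga≡gc gc)) a<b b<c pb) (sym gb))
    go (inj₂ (pa , ga)) (inj₂ (pb , gb)) (inj₁ (pc , gc)) (inj₁ (pd , gd)) = trans ga≡gc
        (trans gc (trans (sym gd) (sym gb≡gd)))
    go (inj₂ (pa , ga)) (inj₂ (pb , gb)) (inj₁ (pc , gc)) (inj₂ (pd , gd)) = trans ga≡gc
        (trans gc (sym (trans gb
      (vis (<-trans b<c c<d) pb (trans (sym gb) (trans gb≡gd gd)) b<c c<d pc))))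
    -- Here `b` lies in the block of 0, between `a` and `c`. The crossing that settles it has 0 as
    -- its left end and needs `a` to be positive.
    go (inj₂ (pa , ga)) (inj₂ (pb , gb)) (inj₂ (pc , gc)) (inj₁ (pd , gd)) = by-a a refl
      where
      fb≡0 : f b ≡ 0
      fb≡0 = trans (sym gb) (trans gb≡gd gd)
      by-a : ∀ a′ → a ≡ a′ → g a ≡ g b
      by-a zero    refl = trans (g0 (f0≡0 nc)) (sym (trans gb fb≡0))
      by-a (suc _) refl = trans ga (trans (z (s≤s z≤n) a<b b<c fb≡0 (trans (sym ga) (trans ga≡gc gc)))
                                   (sym (trans gb fb≡0)))
    go (inj₂ (pa , ga)) (inj₂ (pb , gb)) (inj₂ (pc , gc)) (inj₂ (pd , gd)) =
      trans ga (trans (uc a<b b<c c<d (trans (sym ga) (trans ga≡gc gc)) (trans (sym gb) (trans gb≡gd gd)))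
          (sym gb))

module _ {m : ℕ} {f : ℕ → ℕ} (nc : IsNC m f) {x : ℕ} (fx≢x : f x ≢ x) where
  -- As `x` is not a block minimum, no value of `f` equals `x`; changing one value thus splits `x`
  -- off as a singleton and leaves all other minima in force.
  isolate : ℕ → ℕ
  isolate = f [ x ↦ x ]

  private
    g : ℕ → ℕ
    g = isolate

    fi≢x : ∀ i → f i ≢ x
    fi≢x i p = fx≢x (trans (cong f (sym p)) (trans (nc .idem i) p))

    g≢x : ∀ {i} → i ≢ x → g i ≢ x
    g≢x i≢x p = fi≢x _ (trans (sym (update-≢ f x x i≢x)) p)

    ≢ˡ : ∀ {i j} → i ≢ j → g i ≡ g j → i ≢ x
    ≢ˡ {i} {j} i≢j p refl = g≢x (i≢j ∘ sym) (trans (sym p) (update-≡ f x x))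

    conv : ∀ {i j} → i ≢ j → g i ≡ g j → f i ≡ f j
    conv i≢j p = trans (sym (update-≢ f x x (≢ˡ i≢j p)))
      (trans p (update-≢ f x x (≢ˡ (i≢j ∘ sym) (sym p))))

  isolate-isNC : IsNC m isolate
  isolate-isNC .below i with i ≟ x
  ... | yes refl = ≤-refl
  ... | no  _ = nc .below i
  isolate-isNC .idem i with i ≟ x
  ... | yes refl = update-≡ f x x
  ... | no  _ = trans (update-≢ f x x (fi≢x i)) (nc .idem i)
  isolate-isNC .beyond {i} m≤i with i ≟ x
  ... | yes refl = refl
  ... | no  _ = nc .beyond m≤i
  isolate-isNC .uncrossed {a} {b} {c} {d} a<b b<c c<d p q =
    trans (update-≢ f x x (≢ˡ a≢c p))
      (trans (nc .uncrossed a<b b<c c<d (conv a≢c p) (conv b≢d q)) (sym (update-≢ f x x (≢ˡ b≢d q))))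
    where
    a≢c = <⇒≢ (<-trans a<b b<c)
    b≢d = <⇒≢ (<-trans b<c c<d)

  isolate-Merge : Merge isolate f x (f x)
  isolate-Merge = record
    { r<x = ≤∧≢⇒< (nc .below x) fx≢x
    ; fr≡r = trans (update-≢ f x x fx≢x) (nc .idem x)
    ; fx≡x = update-≡ f x x
    ; moved = moved′
    ; kept = λ {i} p → sym (update-≢ f x x λ { refl → p (update-≡ f x x) })
    }
    where
    moved′ : ∀ {i} → g i ≡ x → f i ≡ f x
    moved′ {i} p with i ≟ x
    ... | yes refl = refl
    ... | no i≢x = contradiction p (fi≢x i)

module _ {m : ℕ} {f g : ℕ → ℕ} {x r : ℕ} (ncf : IsNC m f) (ncg : IsNC m g) (mg : Merge f g x r) where
  Merge-refines : ∀ i → g (f i) ≡ g i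
  Merge-refines i with f i ≟ x
  ... | yes p = trans (cong g p) (trans (gx≡r mg) (sym (mg .moved p)))
  ... | no  p = trans (mg .kept (p ∘ trans (sym (ncf .idem i)))) (trans (ncf .idem i) (sym (mg .kept p)))

  -- Between `f` and `g` only `x` can lose its status as a minimum, so whether `h` still fixes `x`
  -- decides which of the two `h` is.
  Merge-covers : ∀ {h} → IsNC m h → (∀ i → h (f i) ≡ h i) → (∀ i → g (h i) ≡ g i) →
                 (∀ i → h i ≡ f i) ⊎ (∀ i → h i ≡ g i)
  Merge-covers {h} nch f⊑h h⊑g with h x ≟ x
  ... | yes hx≡x = inj₁ λ i → fixed i (f i ≟ x)
    where
    fixed : ∀ i → Dec (f i ≡ x) → h i ≡ f i
    fixed i (yes p) = trans (sym (f⊑h i)) (trans (cong h p) (trans hx≡x (sym p)))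
    fixed i (no p)  = ≤-antisym (subst (_≤ f i) (f⊑h i) (nch .below (f i)))
      (subst (_≤ h i) (trans (h⊑g i) (mg .kept p)) (ncg .below (h i)))
  ... | no hx≢x = inj₂ λ i → merged i (f i ≟ x)
    where
    f-hx : f (h x) ≡ h x
    f-hx = ≤-antisym (ncf .below _)
      (subst (_≤ f (h x)) (trans (f⊑h (h x)) (nch .idem x)) (nch .below _))
    merged : ∀ i → Dec (f i ≡ x) → h i ≡ g i
    merged i (yes p) = begin
      h i       ≡⟨ f⊑h i ⟨
      h (f i)   ≡⟨ cong h p ⟩
      h x       ≡⟨ f-hx ⟨
      f (h x)   ≡⟨ mg .kept (hx≢x ∘ trans (sym f-hx)) ⟨
      g (h x)   ≡⟨ h⊑g x ⟩
      g x       ≡⟨ gx≡r mg ⟩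
      r         ≡⟨ mg .moved p ⟨
      g i       ∎
      where
      open ≡-Reasoning
    merged i (no p) = ≤-antisym (subst (h i ≤_) (sym (mg .kept p)) (subst (_≤ f i) (f⊑h i) (nch .below (f i))))
      (subst (_≤ h i) (h⊑g i) (ncg .below (h i)))

-- Labels of merges

module _ {m : ℕ} (σ : NC m) where
  ∈-block⁺ : ∀ {i j} → minOf σ (toℕ i) ≡ minOf σ (toℕ j) → j Subset.∈ NC.block σ i
  ∈-block⁺ {i} {j} p = Vec.lookup⇒[]= j (NC.block σ i) (trans (Vec.lookup∘tabulate _ j)
    (dec-true (Vec.lookup (rep σ) i Fin.≟ Vec.lookup (rep σ) j) (minOf⇒~ σ p)))

  ∈-block⁻ : ∀ {i j} → j Subset.∈ NC.block σ i → minOf σ (toℕ i) ≡ minOf σ (toℕ j)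
  ∈-block⁻ {i} {j} p with Vec.lookup (rep σ) i Fin.≟ Vec.lookup (rep σ) j
    | trans (sym (Vec.lookup∘tabulate _ j)) (Vec.[]=⇒lookup p)
  ... | yes e | _ = ~⇒minOf σ e

  ∈-blocks⁺ : ∀ {i} → minOf σ (toℕ i) ≡ toℕ i → NC.block σ i ∈ blocks σ
  ∈-blocks⁺ {i} p = ∈-map⁺ (NC.block σ) (∈-filter⁺ (λ i → Vec.lookup (rep σ) i Fin.≟ i) (∈-allFin i)
    (Fin.toℕ-injective (trans (sym (minOf-toℕ σ i)) p)))

  ∈-blocks⁻ : ∀ {B} → B ∈ blocks σ → ∃ λ i → minOf σ (toℕ i) ≡ toℕ i × B ≡ NC.block σ i
  ∈-blocks⁻ B∈ with i , i∈ , eq ← ∈-map⁻ (NC.block σ) B∈ = i ,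
    trans (minOf-toℕ σ i)
        (cong toℕ (proj₂ (∈-filter⁻ (λ i → Vec.lookup (rep σ) i Fin.≟ i) {xs = allFin m} i∈))) , eq

-- The element that gives the label: the least element of the absorbed block is `x`, so to be less
-- than that whole block is to be less than `x`.
LastBelow : (f : ℕ → ℕ) (x r p : ℕ) → Set
LastBelow f x r p = p < x × f p ≡ r × (∀ {y} → y < x → f y ≡ r → y ≤ p)

lastBelow : ∀ f x {r} → r < x → f r ≡ r → ∃ (LastBelow f x r)
lastBelow f (suc x) {r} r<x fr≡r with f x ≟ r
... | yes p = x , ≤-refl , p , λ y<x _ → s≤s⁻¹ y<x
... | no ¬p with m≤n⇒m<n∨m≡n (s≤s⁻¹ r<x)
...   | inj₂ refl = contradiction fr≡r ¬p
...   | inj₁ r<x′ with p , p<x , fp , max ← lastBelow f x r<x′ fr≡r =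
  p , <-trans p<x ≤-refl , fp , λ y<x fy → max (≤∧≢⇒< (s≤s⁻¹ y<x) λ { refl → ¬p fy }) fy

module _ {m : ℕ} {σ τ : NC m} where
  private
    f = minOf σ
    g = minOf τ

  Merge⇒HasLabel : ∀ {x r p} → Merge f g x r → LastBelow f x r p → HasLabel σ τ (suc p)
  Merge⇒HasLabel {x} {r} {p} mg (p<x , fp≡r , max) with x<m mg (minOf-isNC τ)
  ... | x<m′ with position m x | position m r | position m p
  ... | outside o | _ | _ = contradiction o (<⇒≱ x<m′)
  ... | _ | outside o | _ = contradiction o (<⇒≱ (<-trans (mg .r<x) x<m′))
  ... | _ | _ | outside o = contradiction o (<⇒≱ (<-trans p<x x<m′))
  ... | inside X | inside R | inside P =
    NC.block σ R , NC.block σ X , P , ∈-blocks⁺ σ (mg .fr≡r) , ∈-blocks⁺ σ (mg .fx≡x) ,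
    distinct , subst (_∈ blocks τ) union (∈-blocks⁺ τ (gr≡r mg)) ,
    (R , ∈-block⁺ σ refl , λ j j∈ → subst (_≤ toℕ j) (sym (gj (subst (j Subset.∈_) (sym union) j∈)))
        (minOf-≤ τ (toℕ j))) ,
    (∈-block⁺ σ (trans (mg .fr≡r) (sym fp≡r)) ,
     λ j j∈ → <-≤-trans p<x (subst (_≤ toℕ j) (trans (sym (∈-block⁻ σ j∈)) (mg .fx≡x)) (minOf-≤ σ (toℕ j)))) ,
    (λ y (y∈ , below-X) → max (below-X X (∈-block⁺ σ refl)) (trans (sym (∈-block⁻ σ y∈)) (mg .fr≡r))) ,
    refl
    where
    gj : ∀ {j} → j Subset.∈ NC.block τ R → toℕ R ≡ g (toℕ j)
    gj j∈ = trans (sym (gr≡r mg)) (∈-block⁻ τ j∈)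

    distinct : NC.block σ R ≢ NC.block σ X
    distinct e = <⇒≢ (mg .r<x) (trans (sym (mg .fr≡r))
      (trans (∈-block⁻ σ (subst (X Subset.∈_) (sym e) (∈-block⁺ σ refl))) (mg .fx≡x)))

    union : NC.block τ R ≡ NC.block σ R ∪ NC.block σ X
    union = Subset.⊆-antisym ⊆₁ ⊆₂
      where
      ⊆₁ : ∀ {j} → j Subset.∈ NC.block τ R → j Subset.∈ NC.block σ R ∪ NC.block σ X
      ⊆₁ {j} j∈ with f (toℕ j) ≟ toℕ X
      ... | yes e = Subset.x∈p∪q⁺ {p = NC.block σ R} (inj₂ (∈-block⁺ σ (trans (mg .fx≡x) (sym e))))
      ... | no ¬e = Subset.x∈p∪q⁺ {p = NC.block σ R}
          (inj₁ (∈-block⁺ σ (trans (mg .fr≡r) (trans (gj j∈) (mg .kept ¬e)))))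
      ⊆₂ : ∀ {j} → j Subset.∈ NC.block σ R ∪ NC.block σ X → j Subset.∈ NC.block τ R
      ⊆₂ {j} j∈ with Subset.x∈p∪q⁻ (NC.block σ R) (NC.block σ X) j∈
      ... | inj₁ a = ∈-block⁺ τ
          (trans (gr≡r mg) (sym
          (trans (mg .kept λ e → <⇒≢ (mg .r<x) (trans (trans (sym (mg .fr≡r)) (∈-block⁻ σ a)) e))
          (trans (sym (∈-block⁻ σ a)) (mg .fr≡r)))))
      ... | inj₂ b = ∈-block⁺ τ (trans (gr≡r mg) (sym (mg .moved (trans (sym (∈-block⁻ σ b)) (mg .fx≡x)))))

-- What the label p + 1 says about the minimum x of B₂, without assuming that
-- B₁ and B₂ are the only blocks merged.
record Drop (f g : ℕ → ℕ) (x p : ℕ) : Set where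
  field
    below-x : p < x
    wasMin  : f x ≡ x
    joins   : g x ≡ g p
    maximal : ∀ {y} → y < x → g y ≡ g x → y ≤ p

-- B₂ has no element below its minimum `x`, so the largest element of B₁ below B₂ is also the
-- largest element of the merged block below `x`; this allows `maximal` to be stated with `g` alone.
HasLabel⇒Drop : ∀ {m} {σ τ : NC m} {ℓ} → HasLabel σ τ ℓ →
                ∃₂ λ x p → x < m × ℓ ≡ suc p × Drop (minOf σ) (minOf τ) x p
HasLabel⇒Drop {m} {σ} {τ} (B₁ , B₂ , P , B₁∈ , B₂∈ , _ , B∈ , _ , (P∈ , P<) , max , ℓ≡)
  with X , fX , refl ← ∈-blocks⁻ σ B₂∈ | T , _ , union ← ∈-blocks⁻ τ B∈ =
  toℕ X , toℕ P , Fin.toℕ<n X , ℓ≡ , record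
    { below-x = P< X X∈
    ; wasMin = fX
    ; joins = trans (sym gX) (∈-block⁻ τ (in-union (inj₁ P∈)))
    ; maximal = λ {y} y<X gy≡ → max′ y (position m y) y<X gy≡
    }
  where
  X∈ = ∈-block⁺ σ {X} refl
  in-union : ∀ {j} → j Subset.∈ B₁ ⊎ j Subset.∈ NC.block σ X → j Subset.∈ NC.block τ T
  in-union {j} q = subst (j Subset.∈_) union (Subset.x∈p∪q⁺ q)
  gX : minOf τ (toℕ T) ≡ minOf τ (toℕ X)
  gX = ∈-block⁻ τ (in-union (inj₂ X∈))
  X≤ : ∀ {j} → j Subset.∈ NC.block σ X → toℕ X ≤ toℕ j
  X≤ {j} j∈ = subst (_≤ toℕ j) (trans (sym (∈-block⁻ σ j∈)) fX) (minOf-≤ σ (toℕ j))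
  max′ : ∀ y → Position m y → y < toℕ X → minOf τ y ≡ minOf τ (toℕ X) → y ≤ toℕ P
  max′ y (outside o) y<X _ = contradiction (Fin.toℕ<n X) (≤⇒≯ (≤-trans o (<⇒≤ y<X)))
  max′ _ (inside Y) Y<X gy≡ with Subset.x∈p∪q⁻ B₁ (NC.block σ X) (subst (Y Subset.∈_) (sym union)
      (∈-block⁺ τ (trans gX (sym gy≡))))
  ... | inj₁ Y∈ = max Y (Y∈ , λ j j∈ → <-≤-trans Y<X (X≤ j∈))
  ... | inj₂ Y∈ = contradiction Y<X (≤⇒≯ (X≤ Y∈))

-- Paths of merges with permitted labels

-- The elements of the poset, with K = k − 1: as elements are numbered from 0,
-- k and k + 1 have the indices K and suc K.
record Good (K : ℕ) (f : ℕ → ℕ) : Set where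
  field
    tail : ∀ {x} → K < x → f (suc x) ≡ suc x ⊎ f (suc x) ≡ f x
    head : (f (suc K) ≡ suc K × f K ≢ 0) ⊎ f (suc K) < K

open Good

Good-cong : ∀ {K f g} → (∀ i → f i ≡ g i) → Good K f → Good K g
Good-cong {K} p gd .tail {x} K<x = Sum.map (trans (sym (p (suc x))))
  (λ e → trans (sym (p (suc x))) (trans e (p x))) (gd .tail K<x)
Good-cong {K} p gd .head = Sum.map
  (λ (e , ne) → trans (sym (p (suc K))) e , λ e′ → ne (trans (p K) e′))
  (subst (_< K) (p (suc K))) (gd .head)

-- The merge does not have label k = K + 1.
Avoids : (K : ℕ) (f : ℕ → ℕ) (x r : ℕ) → Set
Avoids K f x r = x ≡ suc K → f K ≢ r

record Step (K : ℕ) {m : ℕ} (σ τ : NC m) : Set where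
  field
    {x r}  : ℕ
    merge  : Merge (minOf σ) (minOf τ) x r
    avoids : Avoids K (minOf σ) x r
    good-σ : Good K (minOf σ)
    good-τ : Good K (minOf τ)

-- Otherwise the block of 0, reaching `K`, would cross the block of `suc K`, whose minimum lies
-- before `K`.
enclosed⇒fK≢0 : ∀ {m K f} → IsNC m f → f (suc K) < K → f K ≢ f (suc K) → f K ≢ 0
enclosed⇒fK≢0 {K = K} {f} nc q<K ne fK≡0 with f (suc K) | nc .idem (suc K) | nc .uncrossed {0} {f
    (suc K)} {K} {suc K}
... | zero  | _    | _  = ne fK≡0
... | suc q | fq≡q | uc = 0≢1+n (trans (sym (f0≡0 nc))
  (trans (uc z<s q<K ≤-refl (trans (f0≡0 nc) (sym fK≡0)) fq≡q) fq≡q))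

module _ {m K : ℕ} (0<K : 0 < K) where
  -- Since everything above `b` is a minimum already, `tail` survives. The delicate case is
  -- `b ≡ suc K`: as a singleton, `suc K` requires `K` to be outside the block of 0, which
  -- `enclosed⇒fK≢0` supplies once `K` and `suc K` are in different blocks.
  isolate-below : ∀ {b} {σ : NC m} → Good K (minOf σ) → (∀ {i} → b < i → minOf σ i ≡ i) →
                  minOf σ b ≢ b → (b ≡ suc K → minOf σ K ≢ minOf σ (suc K)) →
                  ∃ λ σ′ → Step K σ′ σ × (∀ {i} → b ≤ i → minOf σ′ i ≡ i)
  isolate-below {b} {σ} gd fix fb≢b ne = σ′ , step , fix′
    where
    f = minOf σ
    nc = minOf-isNC σ
    g = isolate nc fb≢b
    σ′ = toNC (isolate-isNC nc fb≢b)
    g≗ = minOf-toNC (isolate-isNC nc fb≢b)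

    g-kept : ∀ {i} → i ≢ b → g i ≡ f i
    g-kept = update-≢ f b b

    good-g : Good K g
    good-g .tail {x} K<x with <-cmp (suc x) b
    ... | tri< sx<b _ _ = subst₂ (λ u v → u ≡ suc x ⊎ u ≡ v)
      (sym (g-kept (<⇒≢ sx<b))) (sym (g-kept (<⇒≢ (<-trans ≤-refl sx<b)))) (gd .tail K<x)
    ... | tri≈ _ refl _ = inj₁ (update-≡ f b b)
    ... | tri> _ _ b<sx = inj₁ (trans (g-kept (>⇒≢ b<sx)) (fix b<sx))
    good-g .head with <-cmp b (suc K)
    ... | tri≈ _ refl _ = inj₁ (update-≡ f b b , fK≢0 ∘ trans (sym (g-kept (<⇒≢ ≤-refl))))
      where
      fk<K : f (suc K) < K
      fk<K = Sum.[ (λ (e , _) → contradiction e fb≢b) , id ]′ (gd .head)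
      fK≢0 = enclosed⇒fK≢0 nc fk<K (ne refl)
    ... | tri> _ _ k<b = subst₂ (λ u v → (u ≡ suc K × v ≢ 0) ⊎ u < K)
      (sym (g-kept (<⇒≢ k<b))) (sym (g-kept (<⇒≢ (<-trans ≤-refl k<b)))) (gd .head)
    ... | tri< b<k _ _ with gd .head
    ...   | inj₂ fk<K = contradiction (≤-trans (≤-reflexive (sym (fix b<k))) (<⇒≤ fk<K)) (<⇒≱ ≤-refl)
    ...   | inj₁ (fk≡k , fK≢0) = inj₁ (trans (g-kept (>⇒≢ b<k)) fk≡k , gK≢0 (K ≟ b))
      where
      gK≢0 : Dec (K ≡ b) → g K ≢ 0
      gK≢0 (yes refl) e = >⇒≢ 0<K (trans (sym (update-≡ f b b)) e)
      gK≢0 (no K≢b)   e = fK≢0 (trans (sym (g-kept K≢b)) e)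

    fix′ : ∀ {i} → b ≤ i → minOf σ′ i ≡ i
    fix′ {i} b≤i with m≤n⇒m<n∨m≡n b≤i
    ... | inj₁ b<i = trans (g≗ i) (trans (g-kept (>⇒≢ b<i)) (fix b<i))
    ... | inj₂ refl = trans (g≗ i) (update-≡ f b b)

    step : Step K σ′ σ
    step = record
      { merge = Merge-cong (sym ∘ g≗) (λ _ → refl) (isolate-Merge nc fb≢b)
      ; avoids = λ { refl e → ne refl (trans (sym (g-kept (<⇒≢ ≤-refl))) (trans (sym (g≗ K)) e)) }
      ; good-σ = Good-cong (sym ∘ g≗) good-g ; good-τ = gd }

  isolate-K : {σ : NC m} → Good K (minOf σ) → minOf σ (suc K) < K → minOf σ K ≡ minOf σ (suc K) →
              ∃ λ σ′ → Step K σ′ σ × minOf σ′ K ≡ K × (∀ {i} → K < i → minOf σ′ i ≡ minOf σ i)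
  isolate-K {σ} gd fk<K fK≡fk = σ′ ,
    record { merge = Merge-cong (sym ∘ g≗) (λ _ → refl) (isolate-Merge nc fK≢K)
           ; avoids = λ K≡k → contradiction K≡k (<⇒≢ ≤-refl)
           ; good-σ = good′ ; good-τ = gd } ,
    trans (g≗ K) (update-≡ f K K) , kept′
    where
    f = minOf σ
    nc = minOf-isNC σ
    fK≢K : f K ≢ K
    fK≢K e = <⇒≢ fk<K (trans (sym fK≡fk) e)
    σ′ = toNC (isolate-isNC nc fK≢K)
    g≗ = minOf-toNC (isolate-isNC nc fK≢K)
    kept′ : ∀ {i} → K < i → minOf σ′ i ≡ f i
    kept′ {i} K<i = trans (g≗ i) (update-≢ f K K (>⇒≢ K<i))
    good′ : Good K (minOf σ′)
    good′ .tail {x} K<x = subst₂ (λ u v → u ≡ suc x ⊎ u ≡ v)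
      (sym (kept′ (<-trans K<x ≤-refl))) (sym (kept′ K<x)) (gd .tail K<x)
    good′ .head = inj₂ (subst (_< K) (sym (kept′ ≤-refl)) fk<K)

  -- Splitting off k + 1 while it shares its block with k would use the label k,
  -- so k is split off first.
  descend : ∀ b {σ : NC m} → Good K (minOf σ) → (∀ {i} → b < i → minOf σ i ≡ i) → minOf σ b ≢ b →
            ∃ λ σ′ → Good K (minOf σ′) × (∀ {i} → b ≤ i → minOf σ′ i ≡ i) × Star (Step K) σ′ σ
  descend b {σ} gd fix fb≢b with b ≟ suc K
  ... | no b≢k with σ′ , step , fix′ ← isolate-below gd fix fb≢b (λ e → contradiction e b≢k) =
    σ′ , step .Step.good-σ , fix′ , step ◅ ε
  ... | yes refl with minOf σ K ≟ minOf σ (suc K)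
  ...   | no ne with σ′ , step , fix′ ← isolate-below gd fix fb≢b (λ _ → ne) =
    σ′ , step .Step.good-σ , fix′ , step ◅ ε
  ...   | yes fK≡fk
    with fk<K ← Sum.[ (λ (e , _) → contradiction e fb≢b) , id ]′ (gd .head)
    with σ₁ , step₁ , f₁K , f₁≗ ← isolate-K gd fk<K fK≡fk
    with σ₂ , step₂ , fix₂ ← isolate-below (step₁ .Step.good-σ)
           (λ k<i → trans (f₁≗ (<-trans ≤-refl k<i)) (fix k<i))
           (fb≢b ∘ trans (sym (f₁≗ ≤-refl)))
           (λ _ e → <⇒≢ fk<K (trans (sym (f₁≗ ≤-refl)) (trans (sym e) f₁K))) =
    σ₂ , step₂ .Step.good-σ , fix₂ , step₂ ◅ step₁ ◅ ε

  ToBottom : NC m → Set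
  ToBottom σ = ∃ λ β → (∀ i → minOf β i ≡ i) × Star (Step K) β σ

  toBottom : ∀ b (σ : NC m) → Good K (minOf σ) → (∀ {i} → b ≤ i → minOf σ i ≡ i) → ToBottom σ
  toBottom zero σ gd fix = σ , (λ i → fix z≤n) , ε
  toBottom (suc b) σ gd fix with minOf σ b ≟ b
  ... | yes p = toBottom b σ gd λ b≤i → Sum.[ fix , (λ { refl → p }) ]′ (m≤n⇒m<n∨m≡n b≤i)
  ... | no fb≢b with σ′ , gd′ , fix′ , path ← descend b gd fix fb≢b =
    map₂ (map₂ (_◅◅ path)) (toBottom b σ′ gd′ fix′)

  ToTop : NC m → Set
  ToTop σ = ∃ λ τ → (∀ {i} → i < m → minOf τ i ≡ 0) × Star (Step K) σ τ

  merge₀-Step : ∀ {σ : NC m} {x} → Good K (minOf σ) → minOf σ x ≡ x → 0 < x → x < m →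
                (∀ {c d} → c < x → x ≤ d → minOf σ c ≡ minOf σ d → minOf σ c ≡ 0) →
                Avoids K (minOf σ) x 0 →
                (∀ {g} → Merge (minOf σ) g x 0 → Good K g) →
                ∃ λ τ → Step K σ τ × Merge (minOf σ) (minOf τ) x 0
  merge₀-Step {σ} {x} gd fx≡x 0<x x<m visible av good-g = toNC isNC , record
    { merge = mg ; avoids = av ; good-σ = gd ; good-τ = good-g mg } , mg
    where
    nc = minOf-isNC σ
    isNC = merge₀-isNC nc fx≡x 0<x x<m visible
    mg = Merge-cong (λ _ → refl) (sym ∘ minOf-toNC isNC) (merge₀-Merge nc fx≡x 0<x)

  -- Once all points before `b` lie in the block of 0, a point `b` outside it is a minimum that no
  -- other block encloses, so it can be merged into that block. Since `suc K` is not a minimum, it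
  -- is never the absorbed point, and label k does not occur.
  toTop-joined : ∀ d b (σ : NC m) → b + d ≡ m → Good K (minOf σ) → minOf σ (suc K) < K →
                 (∀ {i} → i < b → minOf σ i ≡ 0) → ToTop σ
  toTop-joined zero b σ b+d≡m gd fk<K zeros =
    σ , (λ i<m → zeros (subst (_ <_) (trans (sym b+d≡m) (+-identityʳ b)) i<m)) , ε
  toTop-joined (suc d) b σ b+d≡m gd fk<K zeros with minOf σ b ≟ 0
  ... | yes p = toTop-joined d (suc b) σ (trans (sym (+-suc b d)) b+d≡m) gd fk<K
    λ i<sb → Sum.[ zeros , (λ { refl → p }) ]′ (m≤n⇒m<n∨m≡n (s≤s⁻¹ i<sb))
  ... | no fb≢0 = continue (merge₀-Step gd fb≡b (n≢0⇒n>0 λ { refl → fb≢0 (f0≡0 nc) })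
                    (subst (b <_) b+d≡m (m<m+n b z<s))
                    (λ c<b _ _ → zeros c<b)
                    (λ b≡k → contradiction b≡k b≢k) good-g)
    where
    f = minOf σ
    nc = minOf-isNC σ
    fb≡b : f b ≡ b
    fb≡b with m≤n⇒m<n∨m≡n (nc .below b)
    ... | inj₁ fb<b = contradiction (trans (sym (nc .idem b)) (zeros fb<b)) fb≢0
    ... | inj₂ e = e
    b≢k : b ≢ suc K
    b≢k refl = <⇒≱ fk<K (≤-trans (n≤1+n K) (≤-reflexive (sym fb≡b)))
    gk<K : ∀ {g} → Merge f g b 0 → g (suc K) < K
    gk<K mg with f (suc K) ≟ b
    ... | yes p = subst (_< K) (sym (mg .moved p)) 0<K
    ... | no p  = subst (_< K) (sym (mg .kept p)) fk<K
    good-g : ∀ {g} → Merge f g b 0 → Good K g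
    good-g mg .head = inj₂ (gk<K mg)
    good-g {g} mg .tail {x} K<x with suc x ≟ b
    ... | yes refl = inj₂ (trans (mg .moved fb≡b) (sym (trans
      (mg .kept λ e → <⇒≢ z<s (trans (sym (zeros ≤-refl)) e)) (zeros ≤-refl))))
    ... | no sx≢b with gd .tail K<x
    ...   | inj₁ e = inj₁ (trans (mg .kept λ e′ → sx≢b (trans (sym e) e′)) e)
    ...   | inj₂ e with f x ≟ b
    ...     | yes p = inj₂ (trans (mg .moved (trans e p)) (sym (mg .moved p)))
    ...     | no p  = inj₂ (trans (mg .kept (p ∘ trans (sym e))) (trans e (sym (mg .kept p))))
    continue : ∃ (λ τ → Step K σ τ × Merge (minOf σ) (minOf τ) b 0) → ToTop σ
    continue (τ , step , mg) =
      map₂ (map₂ (step ◅_)) (toTop-joined d (suc b) τ (trans (sym (+-suc b d)) b+d≡m)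
        (step .Step.good-τ) (gk<K mg) zeros′)
      where
      zeros′ : ∀ {i} → i < suc b → minOf τ i ≡ 0
      zeros′ i<sb with m≤n⇒m<n∨m≡n (s≤s⁻¹ i<sb)
      ... | inj₂ refl = gx≡r mg
      ... | inj₁ i<b  = trans (mg .kept λ e → fb≢0 (trans fb≡b (trans (sym e) (zeros i<b)))) (zeros i<b)

  -- If `suc K` is a minimum, it is absorbed into the block of 0 at once, while `K` is still outside
  -- that block and the label is not k.
  toTop : suc K < m → (σ : NC m) → Good K (minOf σ) → ToTop σ
  toTop k<m σ gd with gd .head
  ... | inj₂ fk<K = toTop-joined m 0 σ refl gd fk<K λ ()
  ... | inj₁ (fk≡k , fK≢0) = continue (merge₀-Step gd fk≡k z<s k<m
          (λ c<k k≤d e → contradiction e (separate c<k k≤d)) (λ _ → fK≢0) good-g)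
    where
    f = minOf σ
    nc = minOf-isNC σ
    -- Past the minimum `suc K` every point is a minimum or follows its predecessor, so no block
    -- straddles the gap between `K` and `suc K`, and none encloses `suc K`.
    separate : ∀ {c d} → c < suc K → suc K ≤ d → f c ≢ f d
    separate {c} {suc d} c<k k≤sd e with m≤n⇒m<n∨m≡n k≤sd
    ... | inj₂ refl = <⇒≱ c<k (subst (_≤ c) (trans e fk≡k) (nc .below c))
    ... | inj₁ k<sd with gd .tail (s≤s⁻¹ k<sd)
    ...   | inj₁ e′ = <⇒≱ (<-trans c<k k<sd) (subst (_≤ c) (trans e e′) (nc .below c))
    ...   | inj₂ e′ = separate c<k (s≤s⁻¹ k<sd) (trans e e′)
    good-g : ∀ {g} → Merge f g (suc K) 0 → Good K g
    good-g mg .head = inj₂ (subst (_< K) (sym (gx≡r mg)) 0<K)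
    good-g mg .tail {x} K<x with gd .tail K<x
    ... | inj₁ e = inj₁ (trans (mg .kept λ e′ → <⇒≢ K<x (suc-injective (trans (sym e′) e))) e)
    ... | inj₂ e with f x ≟ suc K
    ...   | yes p = inj₂ (trans (mg .moved (trans e p)) (sym (mg .moved p)))
    ...   | no p  = inj₂ (trans (mg .kept (p ∘ trans (sym e))) (trans e (sym (mg .kept p))))
    continue : ∃ (λ τ → Step K σ τ × Merge (minOf σ) (minOf τ) (suc K) 0) → ToTop σ
    continue (τ , step , mg) =
      map₂ (map₂ (step ◅_)) (toTop-joined m 0 τ refl (step .Step.good-τ)
        (subst (_< K) (sym (gx≡r mg)) 0<K) λ ())

-- Vertices of paths

module _ {A : Set} {R : A → A → Set} where
  later : ∀ {x y} → Star R x y → List A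
  later ε = []
  later (_◅_ {j = y} _ p) = y ∷ later p

  vertices : ∀ {x y} → Star R x y → List A
  vertices {x} p = x ∷ later p

  vertices-◅◅ : ∀ {x y z} (p : Star R x y) (q : Star R y z) → ∃ λ xs → vertices (p ◅◅ q) ≡ xs ++ vertices q
  vertices-◅◅ ε q = [] , refl
  vertices-◅◅ {x} (r ◅ p) q with xs , e ← vertices-◅◅ p q = x ∷ xs , cong (x ∷_) e

  vertices-Linked : ∀ {S : A → A → Set} → (∀ {x y} → R x y → S x y) → ∀ {x y} (p : Star R x y) → Linked S
      (vertices p)
  vertices-Linked f ε = [-]
  vertices-Linked f (r ◅ p) = f r ∷ vertices-Linked f p

-- Parking functions from paths

-- When `x` moves past `y`, then `y < x ≤ u`, and `x ≤ u ≤ v` lets `x` go on to the bound `v`.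
insert-≤ : ∀ {x u xs us} → x ≤ u → Pointwise _≤_ xs us → Linked _≤_ (u ∷ us) → Pointwise _≤_ (insert x xs)
    (u ∷ us)
insert-≤ x≤u [] _ = x≤u ∷ []
insert-≤ {x} {xs = y ∷ ys} x≤u (y≤v ∷ ps) (u≤v ∷ vs) with x ≤ᵇ y | ≤⇒≤ᵇ {x} {y}
... | true  | _   = x≤u ∷ y≤v ∷ ps
... | false | x≰y = ≤-trans (<⇒≤ (≰⇒> x≰y)) x≤u ∷ insert-≤ (≤-trans x≤u u≤v) ps vs

-- The source of the parking condition: labels listed by absorbed element are bounded by 1, ..., n,
-- and sorting them keeps this bound.
sort-≤ : ∀ {xs us} → Pointwise _≤_ xs us → Linked _≤_ us → Pointwise _≤_ (sort xs) us
sort-≤ [] _ = []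
sort-≤ (x≤u ∷ ps) us = insert-≤ x≤u (sort-≤ ps (Linked.tail us)) us

toVec-≤ : ∀ g n {xs} → Pointwise _≤_ xs (applyUpTo g n) →
          Σ[ b ∈ Vec ℕ n ] Vec.toList b ≡ xs × (∀ i → lookup b i ≤ g (toℕ i))
toVec-≤ g zero [] = [] , refl , λ ()
toVec-≤ g (suc n) (x≤ ∷ ps) with b , e , b≤ ← toVec-≤ (g ∘ suc) n ps =
  _ ∷ b , cong (_ ∷_) e , λ { zero → x≤ ; (suc i) → b≤ i }

positions : ℕ → List ℕ
positions = applyUpTo suc

-- A pair (x , ℓ) stands for a merge with label ℓ that absorbs the block with
-- minimum x.
record Label (K n : ℕ) (xℓ : ℕ × ℕ) : Set where
  field
    x∈  : proj₁ xℓ ∈ positions n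
    1≤ℓ : 1 ≤ proj₂ xℓ
    ℓ≤x : proj₂ xℓ ≤ proj₁ xℓ
    ℓ≢k : proj₂ xℓ ≢ suc K
    tight : suc K < proj₁ xℓ → proj₂ xℓ ≡ proj₁ xℓ

open Label

module _ {n K : ℕ} {zs : List (ℕ × ℕ)} (labels : All (Label K n) zs)
         (unique : Unique (List.map proj₁ zs)) (all : ∀ {x} → x ∈ positions n → x ∈ List.map proj₁ zs) where
  private
    ↭-positions : List.map proj₁ zs ↭ positions n
    ↭-positions = ∼bag⇒↭ (unique∧set⇒bag unique (Unique.applyUpTo⁺₁ suc n λ i<j _ e → <⇒≢ i<j (suc-injective e))
      (mk⇔ (λ x∈ → All.lookup (All.map⁺ (All.map x∈positions labels)) x∈) all))
      where
      x∈positions : ∀ {xℓ} → Label K n xℓ → proj₁ xℓ ∈ positions n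
      x∈positions l = l .x∈

    ordered : ∃ λ ls → Pointwise _≤_ ls (positions n) × ls ↭ List.map proj₂ zs
    ordered with zs′ , e , π ← ↭-map-inv proj₁ ↭-positions =
      List.map proj₂ zs′ , subst (Pointwise _≤_ _) (sym e) (go (All-resp-↭ π labels)) , map⁺ proj₂ (↭-sym π)
      where
      go : ∀ {zs} → All (Label K n) zs → Pointwise _≤_ (List.map proj₂ zs) (List.map proj₁ zs)
      go [] = []
      go (l ∷ ls) = l .ℓ≤x ∷ go ls

  labels-length : length (List.map proj₂ zs) ≡ n
  labels-length = trans (↭-length (↭-sym (proj₂ (proj₂ ordered))))
    (trans (Pointwise-length (proj₁ (proj₂ ordered))) (length-applyUpTo suc n))

  -- Label k is excluded merge by merge; a number j > k is attained because `j` itself is absorbed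
  -- at some point and `tight` makes that label `j`.
  labels-InPF : {a : Vec ℕ n} → Vec.toList a ≡ List.map proj₂ zs → InPF n (suc K) a
  labels-InPF {a} e with ls , ls≤ , ls↭ ← ordered
    with b , b≡ , b≤ ← toVec-≤ suc n (sort-≤ ls≤ (Linked.applyUpTo⁺₂ suc n (λ i → n≤1+n (suc i)))) =
    (VecAll.toList⁻ (subst (All (1 ≤_)) (sym e) (All.map⁺ (All.map (λ l → l .1≤ℓ) labels))) ,
     b , subst₂ _↭_ (sym b≡) (sym e) (↭-trans (sort-↭ ls) ls↭) ,
     subst (Linked _≤_) (sym b≡) (sort-↗ ls) , b≤) ,
    (λ k∈ → All.lookup (All.map⁺ (All.map (λ l → l .ℓ≢k) labels))
        (subst (suc K ∈_) e (Vec.∈-toList⁺ k∈)) refl) ,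
    λ j k<j j≤n → Vec.∈-toList⁻ (subst (j ∈_) (sym e) (attained j k<j j≤n))
    where
    attained : ∀ j → suc K < j → j ≤ n → j ∈ List.map proj₂ zs
    attained (suc j) k<j j<n with (x , ℓ) , z∈ , refl ← ∈-map⁻ proj₁ (all (∈-applyUpTo⁺ suc j<n)) =
      subst (_∈ List.map proj₂ zs) (All.lookup labels z∈ .tight k<j) (∈-map⁺ proj₂ z∈)

module _ {n K : ℕ} (0<K : 0 < K) where
  private
    NCₙ = NC (suc n)

  module _ {σ τ : NCₙ} (s : Step K σ τ) where
    open Step s
    private
      f = minOf σ
      g = minOf τ

    Step-≼ : σ ≼ τ
    Step-≼ = minOf⇒≼ (Merge-refines (minOf-isNC σ) (minOf-isNC τ) merge)

    Step-≢ : σ ≢ τ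
    Step-≢ refl = gx≢x merge (merge .fx≡x)

    Step-covers : ∀ {υ} → σ ≼ υ → υ ≼ τ → υ ≡ σ ⊎ υ ≡ τ
    Step-covers {υ} σ≼υ υ≼τ = Sum.map minOf-injective minOf-injective
      (Merge-covers (minOf-isNC σ) (minOf-isNC τ) merge (minOf-isNC υ)
        (≼⇒minOf σ≼υ) (≼⇒minOf υ≼τ))

    Step-last : ∃ (LastBelow f x r)
    Step-last = lastBelow f x (merge .r<x) (merge .fr≡r)

    step-label : ℕ × ℕ
    step-label = x , suc (proj₁ Step-last)

    Step-HasLabel : HasLabel σ τ (proj₂ step-label)
    Step-HasLabel = Merge⇒HasLabel merge (proj₂ Step-last)

    -- For `x` > `suc K`, `tail` after the merge puts the predecessor of `x` into the absorbing
    -- block, so the label is `x`. For `x` ≤ `K` the label is at most `x` and hence below k. Only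
    -- `x ≡ suc K` is left to `avoids`.
    Step-Label : Label K n step-label
    Step-Label with p , p<x , fp≡r , max ← Step-last = record
      { x∈ = x∈′ (merge .r<x) (x<m merge (minOf-isNC τ))
      ; 1≤ℓ = z<s
      ; ℓ≤x = p<x
      ; ℓ≢k = λ ℓ≡k → p≢K (suc-injective ℓ≡k)
      ; tight = λ k<x → tight′ k<x refl
      }
      where
      x∈′ : ∀ {x} → r < x → x < suc n → x ∈ positions n
      x∈′ {suc x} _ x<m = ∈-applyUpTo⁺ suc (s≤s⁻¹ x<m)
      tight′ : ∀ {x′} → suc K < x′ → x′ ≡ x → suc p ≡ x′
      tight′ {suc x′} k<x refl with good-τ .tail (s≤s⁻¹ k<x)
      ... | inj₁ e = contradiction e (gx≢x merge)
      ... | inj₂ e = cong suc (≤-antisym (s≤s⁻¹ p<x) (max ≤-refl fx′≡r))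
        where
        fx′≡r : f x′ ≡ r
        fx′≡r = trans (sym (merge .kept {x′} λ e′ → <⇒≱ ≤-refl (subst (_≤ x′) e′ (minOf-≤ σ x′))))
          (trans (sym e) (gx≡r merge))
      p≢K : p ≢ K
      p≢K refl with m≤n⇒m<n∨m≡n p<x
      ... | inj₂ k≡x = avoids (sym k≡x) fp≡r
      ... | inj₁ k<x = <⇒≢ k<x (tight′ k<x refl)

    fixed-below : ∀ {y} → g y ≡ y → f y ≡ y
    fixed-below {y} gy≡y with f y ≟ x
    ... | yes p = contradiction (subst (_≤ y) p (minOf-≤ σ y))
      (<⇒≱ (subst (_< x) (trans (sym (merge .moved {y} p)) gy≡y) (merge .r<x)))
    ... | no ¬p = trans (sym (merge .kept {y} ¬p)) gy≡y

  labels : ∀ {σ τ : NCₙ} → Star (Step K) σ τ → List (ℕ × ℕ)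
  labels ε = []
  labels (s ◅ p) = step-label s ∷ labels p

  absorbed : ∀ {σ τ : NCₙ} → Star (Step K) σ τ → List ℕ
  absorbed p = List.map proj₁ (labels p)

  labels-Label : ∀ {σ τ : NCₙ} (p : Star (Step K) σ τ) → All (Label K n) (labels p)
  labels-Label ε = []
  labels-Label (s ◅ p) = Step-Label s ∷ labels-Label p

  labels-HasLabels : ∀ {σ τ : NCₙ} (p : Star (Step K) σ τ) → HasLabels (vertices p)
      (Vec.fromList (List.map proj₂ (labels p)))
  labels-HasLabels ε = [-]
  labels-HasLabels (s ◅ p) = Step-HasLabel s ∷ labels-HasLabels p

  absorbed-fixed : ∀ {σ τ : NCₙ} (p : Star (Step K) σ τ) {x : ℕ} → x ∈ absorbed p → minOf σ x ≡ x
  absorbed-fixed (s ◅ p) (here refl) = s .Step.merge .fx≡x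
  absorbed-fixed (s ◅ p) (there x∈) = fixed-below s (absorbed-fixed p x∈)

  -- Minima only disappear along a path: whatever is absorbed later is still a minimum after the
  -- first merge, unlike the element absorbed there.
  absorbed-unique : ∀ {σ τ : NCₙ} (p : Star (Step K) σ τ) → Unique (absorbed p)
  absorbed-unique ε = []
  absorbed-unique (s ◅ p) = All.¬Any⇒All¬ _ (λ x∈ → gx≢x (s .Step.merge) (absorbed-fixed p x∈))
      ∷ absorbed-unique p

  absorbed-all : ∀ {σ τ : NCₙ} (p : Star (Step K) σ τ) {x : ℕ} → minOf σ x ≡ x → minOf τ x ≢ x → x ∈ absorbed p
  absorbed-all ε fx gx = contradiction fx gx
  absorbed-all {σ} (s ◅ p) {x} fx gx with minOf σ x ≟ s .Step.x
  ... | yes e = here (trans (sym fx) e)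
  ... | no ¬e = there (absorbed-all p (trans (s .Step.merge .kept {x} ¬e) fx) gx)

  -- Climb while the next vertex lies below `υ`; at the first one above `υ`, the covering relation
  -- leaves only its two ends.
  vertices-maximal : ∀ {σ τ : NCₙ} (p : Star (Step K) σ τ) {υ} → σ ≼ υ → υ ≼ τ →
                     All (λ x → x ≼ υ ⊎ υ ≼ x) (vertices p) → υ ∈ vertices p
  vertices-maximal ε σ≼υ υ≼τ _ = here (≼-antisym υ≼τ σ≼υ)
  vertices-maximal (s ◅ p) σ≼υ υ≼τ (_ ∷ inj₁ ρ≼υ ∷ cs) = there (vertices-maximal p ρ≼υ υ≼τ (inj₁ ρ≼υ ∷ cs))
  vertices-maximal (s ◅ p) {υ} σ≼υ υ≼τ (_ ∷ inj₂ υ≼ρ ∷ cs) = Sum.[ here , (λ e → there (here e)) ]′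
      (Step-covers s {υ} σ≼υ υ≼ρ)

  module _ {β τ : NCₙ} (bot : ∀ i → minOf β i ≡ i) (top : ∀ {i} → i < suc n → minOf τ i ≡ 0)
      (p : Star (Step K) β τ) where
    private
      β≼ : ∀ υ → β ≼ υ
      β≼ υ = minOf⇒≼ λ i → cong (minOf υ) (bot i)

      ≼τ : ∀ υ → υ ≼ τ
      ≼τ υ = minOf⇒≼ λ i → go i (i <? suc n)
        where
        go : ∀ i → Dec (i < suc n) → minOf τ (minOf υ i) ≡ minOf τ i
        go i (yes i<m) = trans (top (≤-<-trans (minOf-≤ υ i) i<m)) (sym (top i<m))
        go i (no i≮m) = cong (minOf τ) (minOf-beyond υ (≮⇒≥ i≮m))

      all : ∀ {x} → x ∈ positions n → x ∈ absorbed p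
      all x∈ with i , i<n , refl ← ∈-applyUpTo⁻ suc x∈ =
        absorbed-all p (bot _) λ e → 0≢1+n (trans (sym (top (s≤s i<n))) e)

      withLength : ∀ {c : List NCₙ} xs → length xs ≡ n → HasLabels c (Vec.fromList xs) →
                   ∃ λ (a : Vec ℕ n) → HasLabels c a × Vec.toList a ≡ xs
      withLength xs refl h = Vec.fromList xs , h , Vec.toList∘fromList xs

    path-IsPFChain : IsPFChain n (suc K) (vertices p)
    path-IsPFChain with a , h , e ← withLength (List.map proj₂ (labels p))
        (labels-length (labels-Label p) (absorbed-unique p) all) (labels-HasLabels p) =
      (vertices-Linked (λ s → Step-≼ s , Step-≢ s) p , λ υ cs → vertices-maximal p {υ} (β≼ υ) (≼τ υ) cs) ,
      a , h , labels-InPF (labels-Label p) (absorbed-unique p) all e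

  module _ (k≤n : suc K ≤ n) where
    private
      below-σ : ∀ {σ : NCₙ} → Good K (minOf σ) → ToBottom 0<K σ
      below-σ {σ} gd = toBottom 0<K (suc n) σ gd (minOf-beyond σ)

      above-σ : ∀ {σ : NCₙ} → Good K (minOf σ) → ToTop 0<K σ
      above-σ {σ} gd = toTop 0<K (s≤s k≤n) σ gd

    -- The lower end is joined to the bottom and the upper end to the top, so every step, not only
    -- those constructed above, lies on a maximal chain with a permitted label sequence.
    Step⇒Edge : ∀ {σ τ : NCₙ} → Step K σ τ → Edge n (suc K) σ τ
    Step⇒Edge s with β , bot , p ← below-σ (s .Step.good-σ) | τ , top , q ← above-σ (s .Step.good-τ)
      with xs , e ← vertices-◅◅ p (s ◅ q) =
      vertices (p ◅◅ s ◅ q) , path-IsPFChain bot top (p ◅◅ s ◅ q) , xs , later q , e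

    Good⇒Element : ∀ {σ : NCₙ} → Good K (minOf σ) → ∃ λ c → IsPFChain n (suc K) c × σ ∈ c
    Good⇒Element gd with β , bot , p ← below-σ gd | τ , top , q ← above-σ gd
      with xs , e ← vertices-◅◅ p q =
      vertices (p ◅◅ q) , path-IsPFChain bot top (p ◅◅ q) , subst (_ ∈_) (sym e) (∈-++⁺ʳ xs (here refl))

-- Partitions on maximal chains

open Drop

module _ {A : Set} where
  unique-length-≤ : ∀ {xs ys : List A} → Unique xs → (∀ {x} → x ∈ xs → x ∈ ys) → length xs ≤ length ys
  unique-length-≤ [] _ = z≤n
  unique-length-≤ {x ∷ xs} (x∉xs ∷ u) xs⊆ys with as , bs , refl ← ∈-∃++ (xs⊆ys (here refl)) =
    subst (suc (length xs) ≤_) (trans (cong suc (length-++ as)) (sym (trans (length-++ as) (+-suc _ _))))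
      (s≤s (unique-length-≤ u λ y∈xs → without as (xs⊆ys (there y∈xs)) λ { refl → All.lookup x∉xs y∈xs refl }))
    where
    without : ∀ as {bs x y} → y ∈ as ++ x ∷ bs → y ≢ x → y ∈ as ++ bs
    without as y∈ y≢x with ∈-++⁻ as y∈
    ... | inj₁ y∈as = ∈-++⁺ˡ y∈as
    ... | inj₂ (here y≡x) = contradiction y≡x y≢x
    ... | inj₂ (there y∈bs) = ∈-++⁺ʳ as y∈bs

unique-⊇ : ∀ {xs ys : List ℕ} → Unique xs → (∀ {x} → x ∈ xs → x ∈ ys) → length xs ≡ length ys →
           ∀ {y} → y ∈ ys → y ∈ xs
unique-⊇ {xs} u xs⊆ys len {y} y∈ys with DecMembership._∈?_ _≟_ y xs
... | yes y∈xs = y∈xs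
... | no  y∉xs = contradiction (≤-reflexive (sym len)) (<⇒≱ (unique-length-≤ (All.¬Any⇒All¬ xs y∉xs ∷ u)
  λ { (here refl) → y∈ys ; (there x∈) → xs⊆ys x∈ }))

module _ {A B : Set} where
  unique-proj₁ : ∀ {zs : List (A × B)} {x a b} → Unique (List.map proj₁ zs) → (x , a) ∈ zs → (x , b) ∈ zs →
      a ≡ b
  unique-proj₁ _ (here refl) (here refl) = refl
  unique-proj₁ (x∉ ∷ _) (here refl) (there q) = contradiction refl (All.lookup x∉ (∈-map⁺ proj₁ q))
  unique-proj₁ (x∉ ∷ _) (there p) (here refl) = contradiction refl (All.lookup x∉ (∈-map⁺ proj₁ p))
  unique-proj₁ (_ ∷ u) (there p) (there q) = unique-proj₁ u p q

≼-fixed : ∀ {m} {σ τ : NC m} → σ ≼ τ → ∀ {x} → minOf τ x ≡ x → minOf σ x ≡ x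
≼-fixed {σ = σ} {τ} σ≼τ {x} e = ≤-antisym (minOf-≤ σ x)
  (subst (_≤ minOf σ x) (trans (≼⇒minOf σ≼τ x) e) (minOf-≤ τ (minOf σ x)))

Drop-≢ : ∀ {m} {σ τ : NC m} {x p} → Drop (minOf σ) (minOf τ) x p → minOf τ x ≢ x
Drop-≢ {τ = τ} {p = p} d e = <⇒≱ (d .below-x) (subst (_≤ p) (trans (sym (d .joins)) e) (minOf-≤ τ p))

-- What is kept of a label: the merge it comes from, and that each member of the chain lies on one
-- side of this merge.
record DropIn {m : ℕ} (c : List (NC m)) (xℓ : ℕ × ℕ) : Set where
  field
    {lower upper} : NC m
    {joined} : ℕ
    lower∈c : lower ∈ c
    x-bound : proj₁ xℓ < m
    ℓ≡      : proj₂ xℓ ≡ suc joined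
    isDrop  : Drop (minOf lower) (minOf upper) (proj₁ xℓ) joined
    lower≼upper : lower ≼ upper
    split   : ∀ {υ} → υ ∈ c → υ ≼ lower ⊎ upper ≼ υ

open DropIn

module _ {m : ℕ} where
  drops : ∀ {j} {c : List (NC m)} {a : Vec ℕ j} → Linked _≼_ c → HasLabels c a →
          ∃ λ zs → List.map proj₂ zs ≡ Vec.toList a × All (DropIn c) zs × Unique (List.map proj₁ zs)
  drops _ [-] = [] , refl , [] , []
  drops {c = σ ∷ τ ∷ c} (σ≼τ ∷ linked) (h ∷ hs)
    with zs , e , ds , u ← drops linked hs | x , p , x<m′ , refl , d ← HasLabel⇒Drop {σ = σ} {τ} h =
    (x , suc p) ∷ zs , cong (suc p ∷_) e ,
    record { lower∈c = here refl ; x-bound = x<m′ ; ℓ≡ = refl ; isDrop = d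
           ; lower≼upper = σ≼τ ; split = split′ } ∷ All.map weaken ds ,
    All.¬Any⇒All¬ _ fresh ∷ u
    where
    ≼-tr : ∀ {ρ υ φ : NC m} → ρ ≼ υ → υ ≼ φ → ρ ≼ φ
    ≼-tr {ρ} {υ} {φ} = ≼-trans {σ = ρ} {υ} {φ}

    σ≼ : All (σ ≼_) (τ ∷ c)
    σ≼ = Linked.Linked⇒All (λ {ρ} {υ} {φ} → ≼-tr {ρ} {υ} {φ}) {v = σ} σ≼τ linked

    τ≼ : ∀ {υ} → υ ∈ τ ∷ c → τ ≼ υ
    τ≼ υ∈ = All.lookup (Linked.Linked⇒All (λ {ρ} {υ} {φ} → ≼-tr {ρ} {υ} {φ}) {v = τ}
        (≼-reflexive {σ = τ} refl) linked) υ∈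

    split′ : ∀ {υ} → υ ∈ σ ∷ τ ∷ c → υ ≼ σ ⊎ τ ≼ υ
    split′ (here refl) = inj₁ (≼-reflexive {σ = σ} refl)
    split′ (there υ∈)  = inj₂ (τ≼ υ∈)

    weaken : ∀ {z} → DropIn (τ ∷ c) z → DropIn (σ ∷ τ ∷ c) z
    weaken d = record { DropIn d ; lower∈c = there (d .lower∈c) ; split = λ
      { (here refl) → inj₁ (All.lookup σ≼ (d .lower∈c)) ; (there υ∈) → d .split υ∈ } }

    -- A later drop at `x` would have `x` as a minimum in some member above `τ`, hence in `τ` as
    -- well, where `x` has just stopped being one.
    fresh : x ∉ List.map proj₁ zs
    fresh x∈ with z , z∈ , refl ← ∈-map⁻ proj₁ x∈ =
      Drop-≢ {σ = σ} {τ} d (≼-fixed (τ≼ (dz .lower∈c)) (dz .isDrop .wasMin))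
      where dz = All.lookup ds z∈

module _ {n K : ℕ} (k≤n : suc K ≤ n) {c : List (NC (suc n))} (pf : IsPFChain n (suc K) c) where
  private
    a = proj₁ (proj₂ pf)
    inPF = proj₂ (proj₂ (proj₂ pf))

    info = drops (Linked.map proj₁ (proj₁ (proj₁ pf))) (proj₁ (proj₂ (proj₂ pf)))
    zs = proj₁ info
    zs-labels = proj₁ (proj₂ info)
    zs-drops = proj₁ (proj₂ (proj₂ info))
    zs-unique = proj₂ (proj₂ (proj₂ info))

    dropAt : ∀ {z} → z ∈ zs → DropIn c z
    dropAt = All.lookup zs-drops

    label-≤ : ∀ {x ℓ} → (x , ℓ) ∈ zs → ℓ ≤ x
    label-≤ z∈ = subst (_≤ _) (sym (dropAt z∈ .ℓ≡)) (dropAt z∈ .isDrop .below-x)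

    in-positions : ∀ {x} → x ∈ List.map proj₁ zs → x ∈ positions n
    in-positions x∈ with ∈-map⁻ proj₁ x∈
    ... | (suc x , ℓ) , z∈ , refl = ∈-applyUpTo⁺ suc (s≤s⁻¹ (dropAt z∈ .x-bound))
    ... | (zero , ℓ) , z∈ , refl = contradiction (dropAt z∈ .isDrop .below-x) λ ()

    length-positions : length (List.map proj₁ zs) ≡ length (positions n)
    length-positions = begin
      length (List.map proj₁ zs) ≡⟨ length-map proj₁ zs ⟩
      length zs                  ≡⟨ length-map proj₂ zs ⟨
      length (List.map proj₂ zs) ≡⟨ cong length zs-labels ⟩
      length (Vec.toList a)      ≡⟨ Vec.length-toList a ⟩
      n                          ≡⟨ length-applyUpTo suc n ⟨
      length (positions n)       ∎
      where
      open ≡-Reasoning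

    -- The n labels belong to distinct elements of 1, ..., n, so no element is left out.
    occurs : ∀ {x} → x < n → ∃ λ ℓ → (suc x , ℓ) ∈ zs
    occurs x<n with (x , ℓ) , z∈ , refl ← ∈-map⁻ proj₁
      (unique-⊇ zs-unique in-positions length-positions (∈-applyUpTo⁺ suc x<n)) = ℓ , z∈

    label-≢k : ∀ {x ℓ} → (x , ℓ) ∈ zs → ℓ ≢ suc K
    label-≢k z∈ refl = proj₁ (proj₂ inPF) (Vec.∈-toList⁻ (subst (suc K ∈_) zs-labels (∈-map⁺ proj₂ z∈)))

    p<K : ∀ {ℓ} (z∈ : (suc K , ℓ) ∈ zs) → dropAt z∈ .joined < K
    p<K z∈ = ≤∧≢⇒< (s≤s⁻¹ (dropAt z∈ .isDrop .below-x)) λ e → label-≢k z∈ (trans (dropAt z∈ .ℓ≡) (cong suc e))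

    -- The label j only occurs at some x ≥ j, and larger x carry the label x.
    own-label : ∀ d j → n < j + d → suc K < j → j ≤ n → (j , j) ∈ zs
    own-label zero j n<j _ j≤n = contradiction j≤n (<⇒≱ (subst (n <_) (+-identityʳ j) n<j))
    own-label (suc d) j n<j k<j j≤n
      with (x , _) , z∈ , refl ← ∈-map⁻ proj₂ (subst (j ∈_) (sym zs-labels)
          (Vec.∈-toList⁺ (proj₂ (proj₂ inPF) j k<j j≤n)))
      with m≤n⇒m<n∨m≡n (label-≤ z∈)
    ... | inj₂ refl = z∈
    ... | inj₁ j<x = contradiction (unique-proj₁ zs-unique z∈
      (own-label d x (≤-trans (subst (n <_) (+-suc j d) n<j) (+-monoˡ-≤ d j<x)) (<-trans k<j j<x)
          (s≤s⁻¹ (dropAt z∈ .x-bound)))) (<⇒≢ j<x)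

  module _ {υ : NC (suc n)} (υ∈c : υ ∈ c) where
    private
      f = minOf υ

      before : ∀ {x ℓ} (z∈ : (x , ℓ) ∈ zs) → f x ≢ x → f x ≡ f (dropAt z∈ .joined)
      before {x} z∈ fx≢x with dropAt z∈ .split υ∈c
      ... | inj₁ υ≼σ = contradiction (≼-fixed υ≼σ (dropAt z∈ .isDrop .wasMin)) fx≢x
      ... | inj₂ τ≼υ = trans (sym (≼⇒minOf τ≼υ x))
        (trans (cong f (dropAt z∈ .isDrop .joins)) (≼⇒minOf {σ = dropAt z∈ .upper} {υ} τ≼υ _))

      after : ∀ {x ℓ} (z∈ : (x , ℓ) ∈ zs) → f x ≡ x → υ ≼ dropAt z∈ .upper
      after z∈ fx≡x with dropAt z∈ .split υ∈c
      ... | inj₁ υ≼σ = ≼-trans {σ = υ} {dropAt z∈ .lower} {dropAt z∈ .upper} υ≼σ (dropAt z∈ .lower≼upper)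
      ... | inj₂ τ≼υ = contradiction (≼-fixed τ≼υ fx≡x) (Drop-≢ {σ = dropAt z∈ .lower} {dropAt z∈ .upper}
          (dropAt z∈ .isDrop))

    chain-Good : Good K f
    chain-Good .tail {x} K<x with f (suc x) ≟ suc x
    ... | yes e = inj₁ e
    ... | no ne with x <? n
    ...   | no x≮n = contradiction (minOf-beyond υ (s≤s (≮⇒≥ x≮n))) ne
    ...   | yes x<n = inj₂ (trans (before z∈ ne) (cong f (suc-injective (sym (dropAt z∈ .ℓ≡)))))
      where z∈ = own-label n (suc x) (s≤s (m≤n+m n x)) (s≤s K<x) x<n
    chain-Good .head with ℓ , z∈ ← occurs k≤n with f (suc K) ≟ suc K
    ... | no ne = inj₂ (subst (_< K) (sym (before z∈ ne)) (≤-<-trans (minOf-≤ υ _) (p<K z∈)))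
    -- When `suc K` is absorbed later, the block it then lies in has a member below `K` but does not
    -- contain `K`, so `K` is outside the block of 0 at that stage. The finer `υ` inherits this.
    ... | yes e = inj₁ (e , λ fK≡0 → enclosed⇒fK≢0 (minOf-isNC τ′) gk<K gK≢gk
      (trans (sym (≼⇒minOf υ≼τ′ K)) (trans (cong (minOf τ′) fK≡0) (f0≡0 (minOf-isNC τ′)))))
      where
      τ′ = dropAt z∈ .upper
      υ≼τ′ : υ ≼ τ′
      υ≼τ′ = after z∈ e
      gk<K : minOf τ′ (suc K) < K
      gk<K = subst (_< K) (sym (dropAt z∈ .isDrop .joins)) (≤-<-trans (minOf-≤ τ′ _) (p<K z∈))
      gK≢gk : minOf τ′ K ≢ minOf τ′ (suc K)
      gK≢gk e = <⇒≱ (p<K z∈) (dropAt z∈ .isDrop .maximal ≤-refl e)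

-- Symmetric chain decompositions

Chain : {A : Set} → (A → A → Set) → Set
Chain R = ∃₂ (Star R)

chain : {A : Set} {R : A → A → Set} {x y : A} → Star R x y → Chain R
chain {x = x} {y} p = x , y , p

chainVertices : {A : Set} {R : A → A → Set} → Chain R → List A
chainVertices (_ , _ , p) = vertices p

-- The predicate `P` cuts out the part being decomposed, so that disjoint parts of one carrier with
-- the same `N` can be united.
record SCD {A : Set} (R : A → A → Set) (ρ : A → ℕ) (N : ℕ) (P : A → Set) : Set where
  field
    chains    : List (Chain R)
    symmetric : All (λ (x , y , _) → ρ x + ρ y ≡ N) chains
    unique    : Unique (concatMap chainVertices chains)
    sound     : ∀ {x} → x ∈ concatMap chainVertices chains → P x
    complete  : ∀ {x} → P x → x ∈ concatMap chainVertices chains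

open SCD

-- Products of chain decompositions

module _ {A : Set} {R : A → A → Set} where
  later-◅◅ : ∀ {x y z} (p : Star R x y) (q : Star R y z) → later (p ◅◅ q) ≡ later p ++ later q
  later-◅◅ ε q = refl
  later-◅◅ (_◅_ {j = y} r p) q = cong (y ∷_) (later-◅◅ p q)

  later-gmap : ∀ {B : Set} {S : B → B → Set} (f : A → B) (g : ∀ {x y} → R x y → S (f x) (f y)) →
               ∀ {x y} (p : Star R x y) → later (gmap {U = S} f g p) ≡ map f (later p)
  later-gmap f g ε = refl
  later-gmap f g (_◅_ {j = y} r p) = cong (f y ∷_) (later-gmap f g p)

  reversed : ∀ {x y} → Star R x y → Star (flip R) y x
  reversed ε = ε
  reversed (r ◅ p) = reversed p ◅◅ r ◅ ε

module _ {A : Set} {R : A → A → Set} where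
  vertices-reversed : ∀ {x y} (p : Star R x y) → vertices (reversed p) ↭ vertices p
  vertices-reversed ε = ↭-refl
  vertices-reversed {x} {y} (r ◅ p) = begin
    y ∷ later (reversed p ◅◅ r ◅ ε)      ≡⟨ cong (y ∷_) (later-◅◅ (reversed p) (r ◅ ε)) ⟩
    vertices (reversed p) ++ x ∷ []      ↭⟨ ++-comm (vertices (reversed p)) (x ∷ []) ⟩
    x ∷ vertices (reversed p)            ↭⟨ prep x (vertices-reversed p) ⟩
    x ∷ vertices p                       ∎
    where
    open PermutationReasoning

module _ {A B : Set} where
  cartesianProduct-∷ʳ : ∀ (xs : List A) (y : B) ys →
    cartesianProduct xs (y ∷ ys) ↭ map (_, y) xs ++ cartesianProduct xs ys
  cartesianProduct-∷ʳ [] y ys = ↭-refl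
  cartesianProduct-∷ʳ (x ∷ xs) y ys = prep (x , y) (↭-trans (++⁺ˡ (map (x ,_) ys) (cartesianProduct-∷ʳ xs y ys))
    (shifts (map (x ,_) ys) (map (_, y) xs)))

  cartesianProduct-++ʳ : ∀ (xs : List A) (ys zs : List B) →
    cartesianProduct xs (ys ++ zs) ↭ cartesianProduct xs ys ++ cartesianProduct xs zs
  cartesianProduct-++ʳ xs [] zs = ↭-reflexive (cong (_++ cartesianProduct xs zs)
      (sym (cartesianProductWith-zeroʳ _,_ xs)))
  cartesianProduct-++ʳ xs (y ∷ ys) zs = begin
    cartesianProduct xs (y ∷ ys ++ zs)                                      ↭⟨ cartesianProduct-∷ʳ xs y
        (ys ++ zs) ⟩
    map (_, y) xs ++ cartesianProduct xs (ys ++ zs)                         ↭⟨ ++⁺ˡ (map (_, y) xs)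
        (cartesianProduct-++ʳ xs ys zs) ⟩
    map (_, y) xs ++ cartesianProduct xs ys ++ cartesianProduct xs zs       ≡⟨ ++-assoc (map (_, y) xs) _ _ ⟨
    (map (_, y) xs ++ cartesianProduct xs ys) ++ cartesianProduct xs zs     ↭⟨ ++⁺ʳ _
        (cartesianProduct-∷ʳ xs y ys) ⟨
    cartesianProduct xs (y ∷ ys) ++ cartesianProduct xs zs                  ∎
    where
    open PermutationReasoning

data _⊗_ {A B : Set} (R : A → A → Set) (S : B → B → Set) : A × B → A × B → Set where
  left  : ∀ {x x′ y} → R x x′ → (R ⊗ S) (x , y) (x′ , y)
  right : ∀ {x y y′} → S y y′ → (R ⊗ S) (x , y) (x , y′)

module _ {A B : Set} {R : A → A → Set} {S : B → B → Set} where
  private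
    leftwards : ∀ {x x′} → Star (flip R) x′ x → ∀ y → Star (R ⊗ S) (x , y) (x′ , y)
    leftwards p y = gmap (_, y) left (reversed p)

    rightwards : ∀ x {y y′} → Star S y y′ → Star (R ⊗ S) (x , y) (x , y′)
    rightwards x q = gmap (x ,_) right q

    vertices-leftwards : ∀ {x x′} (p : Star (flip R) x′ x) y → vertices (leftwards p y) ↭ map (_, y)
        (vertices p)
    vertices-leftwards {x} p y = ↭-trans (↭-reflexive (cong ((x , y) ∷_) (later-gmap (_, y) left (reversed p))))
      (map⁺ (_, y) (vertices-reversed p))

    vertices-rightwards : ∀ x {y y′} (q : Star S y y′) → vertices (rightwards x q) ≡ map (x ,_) (vertices q)
    vertices-rightwards x {y} q = cong ((x , y) ∷_) (later-gmap (x ,_) right q)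

  -- A product of two chains is peeled into the chain running along two sides of
  -- the rectangle and the product of the chains without the top of the first and
  -- the bottom of the second; the first chain is therefore listed downwards.
  grid : ∀ {x x′ y y′} → Star (flip R) x′ x → Star S y y′ → List (Chain (R ⊗ S))
  grid {y = y} p ε = chain (leftwards p y) ∷ []
  grid {x} ε q@(_ ◅ _) = chain (rightwards x q) ∷ []
  grid {x′ = x′} {y} p@(_ ◅ p′) q@(_ ◅ q′) = chain (leftwards p y ◅◅ rightwards x′ q) ∷ grid p′ q′

  -- A permutation is enough, because uniqueness and membership are invariant under it.
  vertices-grid : ∀ {x x′ y y′} (p : Star (flip R) x′ x) (q : Star S y y′) →
                  concatMap chainVertices (grid p q) ↭ cartesianProduct (vertices p) (vertices q)
  vertices-grid {y = y} p ε = ++⁺ʳ [] (vertices-leftwards p y)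
    ∙ ↭-sym (↭-trans (cartesianProduct-∷ʳ (vertices p) y []) (++⁺ˡ (map (_, y) (vertices p))
        (↭-reflexive (cartesianProductWith-zeroʳ _,_ (vertices p)))))
    where
    _∙_ = ↭-trans
  vertices-grid {x} {y = y} ε q@(_ ◅ _) = ↭-reflexive (cong (_++ []) (vertices-rightwards x {y} q))
  vertices-grid {x} {x′} {y} p@(_ ◅ p′) q@(_ ◅ q′) = begin
    vertices (leftwards p y ◅◅ rightwards x′ q) ++ concatMap chainVertices (grid p′ q′)
      ≡⟨ cong (λ l → ((x , y) ∷ l) ++ _) (later-◅◅ (leftwards p y) (rightwards x′ q)) ⟩
    (vertices (leftwards p y) ++ later (rightwards x′ q)) ++ concatMap chainVertices (grid p′ q′)
      ↭⟨ ++⁺ (++⁺ (vertices-leftwards p y) (↭-reflexive (later-gmap (x′ ,_) right q))) (vertices-grid p′ q′) ⟩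
    (map (_, y) (vertices p) ++ map (x′ ,_) (later q)) ++ cartesianProduct (vertices p′) (vertices q′)
      ≡⟨ ++-assoc (map (_, y) (vertices p)) (map (x′ ,_) (later q)) _ ⟩
    (x′ , y) ∷ (map (_, y) (vertices p′) ++ map (x′ ,_) (later q) ++ cartesianProduct (vertices p′)
        (vertices q′))
      ↭⟨ prep (x′ , y) (shifts (map (_, y) (vertices p′)) (map (x′ ,_) (later q))) ⟩
    (x′ , y) ∷ (map (x′ ,_) (later q) ++ map (_, y) (vertices p′) ++ cartesianProduct (vertices p′)
        (vertices q′))
      ↭⟨ prep (x′ , y) (++⁺ˡ (map (x′ ,_) (later q)) (cartesianProduct-∷ʳ (vertices p′) y (vertices q′))) ⟨
    cartesianProduct (vertices p) (vertices q) ∎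
    where
    open PermutationReasoning

  grid-all : List (Chain R) → List (Chain S) → List (Chain (R ⊗ S))
  grid-all cs ds = concatMap (λ (_ , _ , p) → concatMap (λ (_ , _ , q) → grid (reversed p) q) ds) cs

  vertices-grid-all : ∀ cs ds → concatMap chainVertices (grid-all cs ds) ↭
                      cartesianProduct (concatMap chainVertices cs) (concatMap chainVertices ds)
  vertices-grid-all [] ds = ↭-refl
  vertices-grid-all ((_ , _ , p) ∷ cs) ds = begin
    concatMap chainVertices (concatMap row ds ++ grid-all cs ds)
      ≡⟨ concatMap-++ chainVertices (concatMap row ds) (grid-all cs ds) ⟩
    concatMap chainVertices (concatMap row ds) ++ concatMap chainVertices (grid-all cs ds)
      ↭⟨ ++⁺ (rows ds) (vertices-grid-all cs ds) ⟩
    cartesianProduct (vertices p) (concatMap chainVertices ds) ++ cartesianProduct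
        (concatMap chainVertices cs) (concatMap chainVertices ds)
      ≡⟨ cartesianProductWith-distribʳ-++ _,_ (vertices p) (concatMap chainVertices cs) _ ⟨
    cartesianProduct (vertices p ++ concatMap chainVertices cs) (concatMap chainVertices ds) ∎
    where
    open PermutationReasoning
    row : Chain S → List (Chain (R ⊗ S))
    row (_ , _ , q) = grid (reversed p) q
    rows : ∀ ds → concatMap chainVertices (concatMap row ds) ↭ cartesianProduct (vertices p)
        (concatMap chainVertices ds)
    rows [] = ↭-reflexive (sym (cartesianProductWith-zeroʳ _,_ (vertices p)))
    rows (d@(_ , _ , q) ∷ ds) = begin
      concatMap chainVertices (row d ++ concatMap row ds)
        ≡⟨ concatMap-++ chainVertices (row d) (concatMap row ds) ⟩
      concatMap chainVertices (row d) ++ concatMap chainVertices (concatMap row ds)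
        ↭⟨ ++⁺ (vertices-grid (reversed p) q) (rows ds) ⟩
      cartesianProduct (vertices (reversed p)) (vertices q) ++ cartesianProduct (vertices p)
          (concatMap chainVertices ds)
        ↭⟨ ++⁺ʳ _ (cartesianProduct-↭ˡ (vertices-reversed p) (vertices q)) ⟩
      cartesianProduct (vertices p) (vertices q) ++ cartesianProduct (vertices p) (concatMap chainVertices ds)
        ↭⟨ cartesianProduct-++ʳ (vertices p) (vertices q) _ ⟨
      cartesianProduct (vertices p) (concatMap chainVertices (d ∷ ds)) ∎
      where
      cartesianProduct-↭ˡ : ∀ {xs xs′ : List A} → xs ↭ xs′ → (ys : List B) →
          cartesianProduct xs ys ↭ cartesianProduct xs′ ys
      cartesianProduct-↭ˡ {xs} {xs′} π [] = ↭-reflexive (trans (cartesianProductWith-zeroʳ _,_ xs)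
          (sym (cartesianProductWith-zeroʳ _,_ xs′)))
      cartesianProduct-↭ˡ {xs} {xs′} π (y ∷ ys) = ↭-trans (cartesianProduct-∷ʳ xs y ys)
        (↭-trans (++⁺ (map⁺ (_, y) π) (cartesianProduct-↭ˡ π ys)) (↭-sym (cartesianProduct-∷ʳ xs′ y ys)))

  module _ {ρ : A → ℕ} {π : B → ℕ} (gradedR : ∀ {x x′} → R x x′ → ρ x ≡ suc (ρ x′))
           (gradedS : ∀ {y y′} → S y y′ → π y ≡ suc (π y′)) where
    private
      weight : A × B → ℕ
      weight (x , y) = ρ x + π y

      Symmetric : ∀ {C : Set} {T : C → C → Set} → (C → ℕ) → ℕ → Chain T → Set
      Symmetric ω N (x , y , _) = ω x + ω y ≡ N

    grid-symmetric : ∀ {x x′ y y′ N M} (p : Star (flip R) x′ x) (q : Star S y y′) → ρ x + ρ x′ ≡ N →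
        π y + π y′ ≡ M →
                     All (Symmetric weight (N + M)) (grid p q)
    grid-symmetric {x} {x′} {y} p ε refl refl = interchange (ρ x) (π y) (ρ x′) (π y) ∷ []
    grid-symmetric {x} {y = y} {y′} ε (_ ◅ _) refl refl = interchange (ρ x) (π y) (ρ x) (π y′) ∷ []
    grid-symmetric {x} {x′} {y} {y′} (_◅_ {j = x″} r p) (_◅_ {j = y″} s q) refl refl =
      interchange (ρ x) (π y) (ρ x′) (π y′) ∷
      subst (λ N → All (Symmetric weight N) (grid p q)) shifted (grid-symmetric p q refl refl)
      where
      -- Lowering the top of the first chain adds one to its sum of end weights, and raising the
      -- bottom of the second takes one away, so all hooks share the same total.
      shifted : ρ x + ρ x″ + (π y″ + π y′) ≡ ρ x + ρ x′ + (π y + π y′)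
      shifted = begin
        ρ x + ρ x″ + (π y″ + π y′)           ≡⟨ cong (λ a → ρ x + a + (π y″ + π y′)) (gradedR r) ⟩
        ρ x + suc (ρ x′) + (π y″ + π y′)     ≡⟨ cong (_+ (π y″ + π y′)) (+-suc (ρ x) (ρ x′)) ⟩
        suc (ρ x + ρ x′ + (π y″ + π y′))     ≡⟨ +-suc (ρ x + ρ x′) _ ⟨
        ρ x + ρ x′ + suc (π y″ + π y′)       ≡⟨ cong (λ a → ρ x + ρ x′ + (a + π y′)) (gradedS s) ⟨
        ρ x + ρ x′ + (π y + π y′)            ∎
        where
        open ≡-Reasoning

    SCD-× : ∀ {N M P Q} → SCD R ρ N P → SCD S π M Q → SCD (R ⊗ S) weight (N + M) (λ (x , y) → P x × Q y)
    SCD-× {N} {M} sP sQ = record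
      { chains    = grid-all (chains sP) (chains sQ)
      ; symmetric = All.concat⁺ (All.map⁺ (All.map (λ { {_ , _ , p} eP → All.concat⁺ (All.map⁺ (All.map
          (λ { {_ , _ , q} eQ → grid-symmetric (reversed p) q eP eQ }) (symmetric sQ))) }) (symmetric sP)))
      ; unique    = Permutationₛ.Unique-resp-↭ (setoid (A × B)) (↭⇒↭ₛ (↭-sym π′))
          (Unique.cartesianProduct⁺ (unique sP) (unique sQ))
      ; sound     = λ z∈ → let x∈ , y∈ = ∈-cartesianProduct⁻ _ _ (∈-resp-↭ π′ z∈) in sound sP x∈ , sound sQ y∈
      ; complete  = λ (px , qy) → ∈-resp-↭ (↭-sym π′) (∈-cartesianProduct⁺ (complete sP px) (complete sQ qy))
      }
      where
      π′ = vertices-grid-all (chains sP) (chains sQ)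

-- Unions and images of chain decompositions

module _ {A : Set} {R : A → A → Set} {ρ : A → ℕ} {N : ℕ} where
  SCD-⇔ : ∀ {P Q} → (∀ {x} → P x → Q x) → (∀ {x} → Q x → P x) → SCD R ρ N P → SCD R ρ N Q
  SCD-⇔ to from s = record { SCD s ; sound = to ∘ sound s ; complete = complete s ∘ from }

  SCD-∅ : ∀ {P} → (∀ {x} → ¬ P x) → SCD R ρ N P
  SCD-∅ ¬P = record { chains = [] ; symmetric = [] ; unique = [] ; sound = λ () ; complete = λ p →
      contradiction p ¬P }

  SCD-∪ : ∀ {P Q} → (∀ {x} → P x → ¬ Q x) → SCD R ρ N P → SCD R ρ N Q → SCD R ρ N (λ x → P x ⊎ Q x)
  SCD-∪ {P} {Q} disjoint sP sQ = record
    { chains    = chains sP ++ chains sQ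
    ; symmetric = All.++⁺ (symmetric sP) (symmetric sQ)
    ; unique    = subst Unique (sym ++-eq) (Unique.++⁺ (unique sP) (unique sQ) λ (p , q) → disjoint
        (sound sP p) (sound sQ q))
    ; sound     = λ x∈ → [ inj₁ ∘ sound sP , inj₂ ∘ sound sQ ]′
        (∈-++⁻ (concatMap chainVertices (chains sP)) (subst (_ ∈_) ++-eq x∈))
    ; complete  = λ pq → subst (_ ∈_) (sym ++-eq)
        ([ ∈-++⁺ˡ ∘ complete sP , ∈-++⁺ʳ (concatMap chainVertices (chains sP)) ∘ complete sQ ]′ pq)
    }
    where
    ++-eq = concatMap-++ chainVertices (chains sP) (chains sQ)

  SCD-range : ∀ {P : A → Set} (F : A → ℕ) lo hi → (∀ i → lo ≤ i → i < hi → SCD R ρ N (λ x → P x × F x ≡ i)) →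
              SCD R ρ N (λ x → P x × lo ≤ F x × F x < hi)
  SCD-range {P} F lo zero s = SCD-∅ {P = λ x → P x × lo ≤ F x × F x < 0} λ { (_ , _ , ()) }
  SCD-range {P} F lo (suc hi) s with lo ≤? hi
  ... | no lo≰hi = SCD-∅ {P = λ x → P x × lo ≤ F x × F x < suc hi} λ (_ , lo≤ , <hi) → lo≰hi
      (≤-trans lo≤ (s≤s⁻¹ <hi))
  ... | yes lo≤hi = SCD-⇔
    [ (λ (p , lo≤ , <hi) → p , lo≤ , m<n⇒m<1+n <hi) , (λ { (p , refl) → p , lo≤hi , ≤-refl }) ]′
    (λ (p , lo≤ , <hi) → [ (λ <hi → inj₁ (p , lo≤ , <hi)) , (λ ≡hi → inj₂ (p , ≡hi)) ]′
        (m≤n⇒m<n∨m≡n (s≤s⁻¹ <hi)))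
    (SCD-∪ {λ x → P x × lo ≤ F x × F x < hi} {λ x → P x × F x ≡ hi}
        (λ { (_ , _ , <hi) (_ , ≡hi) → <⇒≢ <hi ≡hi })
      (SCD-range {P} F lo hi λ i lo≤ i<hi → s i lo≤ (m<n⇒m<1+n i<hi)) (s hi lo≤hi ≤-refl))

  module _ {B : Set} {S : B → B → Set} {π : B → ℕ} {P : A → Set} (f : A → B)
      (injective : ∀ {x y} → f x ≡ f y → x ≡ y)
           (preserves : ∀ {x y} → P x → P y → R x y → S (f x) (f y)) (π∘f : ∀ x → π (f x) ≡ ρ x) where
    private
      mapPath : ∀ {x y} (p : Star R x y) → (∀ {z} → z ∈ vertices p → P z) → Star S (f x) (f y)
      mapPath ε _ = ε
      mapPath (r ◅ p) allP = preserves (allP (here refl)) (allP (there (here refl))) r ◅ mapPath p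
          (allP ∘ there)

      later-mapPath : ∀ {x y} (p : Star R x y) (allP : ∀ {z} → z ∈ vertices p → P z) → later
          (mapPath p allP) ≡ map f (later p)
      later-mapPath ε _ = refl
      later-mapPath (_◅_ {j = y} r p) allP = cong (f y ∷_) (later-mapPath p (allP ∘ there))

      mapChains : (cs : List (Chain R)) → (∀ {z} → z ∈ concatMap chainVertices cs → P z) → List (Chain S)
      mapChains [] _ = []
      mapChains ((_ , _ , p) ∷ cs) allP = chain (mapPath p (allP ∘ ∈-++⁺ˡ)) ∷ mapChains cs
          (allP ∘ ∈-++⁺ʳ (vertices p))

      vertices-mapChains : ∀ cs (allP : ∀ {z} → z ∈ concatMap chainVertices cs → P z) →
                           concatMap chainVertices (mapChains cs allP) ≡ map f (concatMap chainVertices cs)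
      vertices-mapChains [] _ = refl
      vertices-mapChains ((x , _ , p) ∷ cs) allP = trans
        (cong₂ _++_ (cong (f x ∷_) (later-mapPath p (allP ∘ ∈-++⁺ˡ)))
            (vertices-mapChains cs (allP ∘ ∈-++⁺ʳ (vertices p))))
        (sym (map-++ f (vertices p) (concatMap chainVertices cs)))

      mapChains-symmetric : ∀ cs (allP : ∀ {z} → z ∈ concatMap chainVertices cs → P z) →
                            All (λ (x , y , _) → ρ x + ρ y ≡ N) cs → All (λ (x , y , _) → π x + π y ≡ N)
                                (mapChains cs allP)
      mapChains-symmetric [] _ [] = []
      mapChains-symmetric ((x , y , p) ∷ cs) allP (e ∷ es) =
        trans (cong₂ _+_ (π∘f x) (π∘f y)) e ∷ mapChains-symmetric cs (allP ∘ ∈-++⁺ʳ (vertices p)) es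

    -- Relations are carried over only between members of `P`: in `SCD-extend` it is membership that
    -- rules out label k.
    SCD-map : ∀ {Q} → (∀ {x} → P x → Q (f x)) → (∀ {y} → Q y → ∃ λ x → P x × f x ≡ y) → SCD R ρ N P →
        SCD S π N Q
    SCD-map {Q} into onto s = record
      { chains    = mapChains (chains s) (sound s)
      ; symmetric = mapChains-symmetric (chains s) (sound s) (symmetric s)
      ; unique    = subst Unique (sym vertices-eq) (Unique.map⁺ injective (unique s))
      ; sound     = λ y∈ → let x , x∈ , e = ∈-map⁻ f (subst (_ ∈_) vertices-eq y∈) in subst Q (sym e) (into (sound s x∈))
      ; complete  = λ q → let x , p , e = onto q in
          subst₂ _∈_ e (sym vertices-eq) (∈-map⁺ f (complete s p))
      }
      where
      vertices-eq = vertices-mapChains (chains s) (sound s)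

data _↑_ {j : ℕ} (i i′ : Fin j) : Set where
  up : toℕ i′ ≡ suc (toℕ i) → i ↑ i′

-- Digit 0 stands for one additional block and digit 1 for none, so the weight decreases upwards
-- like the number of blocks.
SCD-2 : SCD {Fin 2} _↑_ (λ i → 1 ∸ toℕ i) 1 (λ _ → ⊤)
SCD-2 = record
  { chains = (zero , suc zero , up refl ◅ ε) ∷ [] ; symmetric = refl ∷ []
  ; unique = ((λ ()) ∷ []) ∷ [] ∷ [] ; sound = λ _ → tt
  ; complete = λ { {zero} _ → here refl ; {suc zero} _ → there (here refl) } }

SCD-3 : SCD {Fin 3} _↑_ (λ i → 2 ∸ toℕ i) 2 (λ _ → ⊤)
SCD-3 = record
  { chains = (zero , suc (suc zero) , up refl ◅ up {i′ = suc (suc zero)} refl ◅ ε) ∷ [] ; symmetric = refl ∷ []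
  ; unique = ((λ ()) ∷ (λ ()) ∷ []) ∷ ((λ ()) ∷ []) ∷ [] ∷ [] ; sound = λ _ → tt
  ; complete = λ { {zero} _ → here refl ; {suc zero} _ → there (here refl) ; {suc (suc zero)} _ → there
      (there (here refl)) } }

-- Counting blocks

sumTo : ℕ → (ℕ → ℕ) → ℕ
sumTo zero    w = 0
sumTo (suc m) w = sumTo m w + w m

sumTo-cong : ∀ m {w w′} → (∀ {i} → i < m → w i ≡ w′ i) → sumTo m w ≡ sumTo m w′
sumTo-cong zero p = refl
sumTo-cong (suc m) p = cong₂ _+_ (sumTo-cong m (λ i<m → p (m<n⇒m<1+n i<m))) (p ≤-refl)

sumTo-+ : ∀ a b {w} → sumTo (a + b) w ≡ sumTo a w + sumTo b (w ∘ (a +_))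
sumTo-+ a zero {w} = trans (cong (λ m → sumTo m w) (+-identityʳ a)) (sym (+-identityʳ _))
sumTo-+ a (suc b) {w} = begin
  sumTo (a + suc b) w                               ≡⟨ cong (λ m → sumTo m w) (+-suc a b) ⟩
  sumTo (a + b) w + w (a + b)                       ≡⟨ cong (_+ w (a + b)) (sumTo-+ a b) ⟩
  sumTo a w + sumTo b (w ∘ (a +_)) + w (a + b)      ≡⟨ +-assoc (sumTo a w) _ _ ⟩
  sumTo a w + sumTo (suc b) (w ∘ (a +_))            ∎
  where
  open ≡-Reasoning

indicator : ∀ {P : Set} → Dec P → ℕ
indicator P? = if does P? then 1 else 0

indicator-yes : ∀ {P : Set} (P? : Dec P) → P → indicator P? ≡ 1
indicator-yes (yes _) _ = refl
indicator-yes (no ¬p) p = contradiction p ¬p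

indicator-no : ∀ {P : Set} (P? : Dec P) → ¬ P → indicator P? ≡ 0
indicator-no (yes p) ¬p = contradiction p ¬p
indicator-no (no _) _ = refl

indicator-⇔ : ∀ {P Q : Set} (P? : Dec P) (Q? : Dec Q) → (P → Q) → (Q → P) → indicator P? ≡ indicator Q?
indicator-⇔ P? (yes q) _ from = indicator-yes P? (from q)
indicator-⇔ P? (no ¬q) to _ = indicator-no P? (¬q ∘ to)

length-filter-tabulate : ∀ {A : Set} {P : A → Set} (P? : Decidable P) m (g : Fin m → A) {w : ℕ → ℕ} →
  (∀ i → indicator (P? (g i)) ≡ w (toℕ i)) → length (filter P? (List.tabulate g)) ≡ sumTo m w
length-filter-tabulate P? zero g e = refl
length-filter-tabulate P? (suc m) g {w} e = begin
  length (filter P? (g zero List.∷ List.tabulate (g ∘ suc)))         ≡⟨ first ⟩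
  indicator (P? (g zero)) + length (filter P? (List.tabulate (g ∘ suc))) ≡⟨ cong₂ _+_ (e zero)
      (length-filter-tabulate P? m (g ∘ suc) (e ∘ suc)) ⟩
  w 0 + sumTo m (w ∘ suc)                                       ≡⟨ sumTo-+ 1 m ⟨
  sumTo (suc m) w                                               ∎
  where
  open ≡-Reasoning
  first : length (filter P? (g zero List.∷ List.tabulate (g ∘ suc))) ≡ indicator (P? (g zero)) + length
      (filter P? (List.tabulate (g ∘ suc)))
  first with does (P? (g zero))
  ... | true  = refl
  ... | false = refl

fixed : (ℕ → ℕ) → ℕ → ℕ
fixed f i = indicator (f i ≟ i)

numBlocks : ∀ {m} → NC m → ℕ
numBlocks σ = length (blocks σ)

numBlocks-sumTo : ∀ {m} (σ : NC m) → numBlocks σ ≡ sumTo m (fixed (minOf σ))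
numBlocks-sumTo {m} σ = trans
  (length-map (NC.block σ) (filter (λ i → lookup (rep σ) i Fin.≟ i) (List.allFin m)))
  (length-filter-tabulate (λ i → lookup (rep σ) i Fin.≟ i) m id
  λ i → indicator-⇔ (lookup (rep σ) i Fin.≟ i) (minOf σ (toℕ i) ≟ toℕ i)
    (λ e → trans (minOf-toℕ σ i) (cong toℕ e)) (λ e → Fin.toℕ-injective (trans (sym (minOf-toℕ σ i)) e)))

numBlocks-toNC : ∀ {m f} (nc : IsNC m f) → numBlocks (toNC nc) ≡ sumTo m (fixed f)
numBlocks-toNC {m} {f} nc = trans (numBlocks-sumTo (toNC nc)) (sumTo-cong m λ {i} _ →
  indicator-⇔ (minOf (toNC nc) i ≟ i) (f i ≟ i) (trans (sym (minOf-toNC nc i))) (trans (minOf-toNC nc i)))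

-- Numbers of blocks replace ranks, so weights decrease along chains.
record Cover (K : ℕ) {m : ℕ} (σ τ : NC m) : Set where
  field
    {x r}   : ℕ
    merge   : Merge (minOf σ) (minOf τ) x r
    avoids  : Avoids K (minOf σ) x r
    numBlocks-suc : numBlocks σ ≡ suc (numBlocks τ)

open Cover using (merge; avoids; numBlocks-suc)

-- Decompositions of noncrossing partitions

truncate : ℕ → (ℕ → ℕ) → ℕ → ℕ
truncate a f i with i <? a
... | yes _ = f i
... | no  _ = i

truncate-< : ∀ {a f i} → i < a → truncate a f i ≡ f i
truncate-< {a} {i = i} i<a with i <? a
... | yes _ = refl
... | no i≮a = contradiction i<a i≮a

truncate-≥ : ∀ {a f i} → a ≤ i → truncate a f i ≡ i
truncate-≥ {a} {i = i} a≤i with i <? a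
... | yes i<a = contradiction a≤i (<⇒≱ i<a)
... | no _ = refl

truncate-≤ : ∀ a {f} → (∀ i → f i ≤ i) → ∀ i → truncate a f i ≤ i
truncate-≤ a f≤ i with i <? a
... | yes _ = f≤ i
... | no _ = ≤-refl

truncate-isNC : ∀ {m a f} → IsNC m f → IsNC a (truncate a f)
truncate-isNC {a = a} nc .below = truncate-≤ a (nc .below)
truncate-isNC {a = a} nc .idem i with i <? a
... | yes i<a = trans (truncate-< (≤-<-trans (nc .below i) i<a)) (nc .idem i)
... | no i≮a = truncate-≥ (≮⇒≥ i≮a)
truncate-isNC nc .beyond = truncate-≥
truncate-isNC {a = a} {f} nc .uncrossed {p} {q} {r} {s} p<q q<r r<s p~r q~s with s <? a
... | no s≮a = contradiction (subst (_≤ q) q~s (truncate-≤ a (nc .below) q)) (<⇒≱ (<-trans q<r r<s))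
... | yes s<a = trans (truncate-< p<a) (trans
    (nc .uncrossed p<q q<r r<s (trans (sym (truncate-< p<a)) (trans p~r (truncate-< r<a)))
        (trans (sym (truncate-< q<a)) q~s))
    (sym (truncate-< q<a)))
  where
  r<a = <-trans r<s s<a
  q<a = <-trans q<r r<a
  p<a = <-trans p<q q<a

truncate-self : ∀ {m f} → (∀ {i} → m ≤ i → f i ≡ i) → ∀ i → truncate m f i ≡ f i
truncate-self {m} fix i with i <? m
... | yes _ = refl
... | no i≮m = sym (fix (≮⇒≥ i≮m))

widen-isNC : ∀ {m f} → IsNC m f → IsNC (suc m) f
widen-isNC nc = record { IsNC nc ; beyond = λ m<i → nc .beyond (≤-trans (n≤1+n _) m<i) }

-- Adding a last element

module _ {m : ℕ} {f : ℕ → ℕ} (nc : IsNC m f) {r : ℕ} (r<m : r < m) (fr≡r : f r ≡ r)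
         (visible : ∀ {a b c} → a < b → b < c → c < m → f a ≡ f c → f b ≡ r → f a ≡ r) where
  private
    g = f [ m ↦ r ]

    g-kept : ∀ {i} → i ≢ m → g i ≡ f i
    g-kept = update-≢ f m r

  -- A new crossing must have `m` as its right end, and so consists of a pair `a`, `c` around an
  -- element `b` of the block of `r`; `visible` excludes it.
  close-isNC : IsNC (suc m) g
  close-isNC .below i with i ≟ m
  ... | yes refl = <⇒≤ r<m
  ... | no _ = nc .below i
  close-isNC .idem i with i ≟ m
  ... | yes refl = trans (g-kept (<⇒≢ r<m)) fr≡r
  ... | no i≢m = trans (g-kept fi≢m) (nc .idem i)
    where
    fi≢m : f i ≢ m
    fi≢m e with m≤n⇒m<n∨m≡n (subst (_≤ i) e (nc .below i))
    ... | inj₁ m<i = i≢m (trans (sym (nc .beyond (<⇒≤ m<i))) e)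
    ... | inj₂ m≡i = i≢m (sym m≡i)
  close-isNC .beyond m<i = trans (g-kept (>⇒≢ m<i)) (nc .beyond (<⇒≤ m<i))
  close-isNC .uncrossed {a} {b} {c} {d} a<b b<c c<d a~c b~d with <-cmp d m
  ... | tri> _ _ m<d = contradiction (subst (_≤ b) (trans b~d (close-isNC .beyond m<d)) (close-isNC .below b))
        (<⇒≱ (<-trans b<c c<d))
  ... | tri< d<m _ _ = trans (g-kept (<⇒≢ a<m))
        (trans (nc .uncrossed a<b b<c c<d (trans (sym (g-kept (<⇒≢ a<m))) (trans a~c (g-kept (<⇒≢ c<m))))
          (trans (sym (g-kept (<⇒≢ b<m))) (trans b~d (g-kept (<⇒≢ d<m))))) (sym (g-kept (<⇒≢ b<m))))
    where
    c<m = <-trans c<d d<m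
    b<m = <-trans b<c c<m
    a<m = <-trans a<b b<m
  ... | tri≈ _ refl _ = trans (g-kept (<⇒≢ a<m)) (trans
        (visible a<b b<c c<d (trans (sym (g-kept (<⇒≢ a<m))) (trans a~c (g-kept (<⇒≢ c<d)))) fb≡r)
        (sym (trans (g-kept (<⇒≢ b<m)) fb≡r)))
    where
    b<m = <-trans b<c c<d
    a<m = <-trans a<b b<m
    fb≡r : f b ≡ r
    fb≡r = trans (sym (g-kept (<⇒≢ b<m))) (trans b~d (update-≡ f m r))

  close-Merge : Merge f g m r
  close-Merge = record
    { r<x = r<m ; fr≡r = fr≡r ; fx≡x = nc .beyond ≤-refl ; moved = moved′
    ; kept = λ fi≢m → g-kept λ { refl → fi≢m (nc .beyond ≤-refl) } }
    where
    moved′ : ∀ {i} → f i ≡ m → g i ≡ r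
    moved′ {i} e with i ≟ m
    ... | yes _ = refl
    ... | no i≢m with m≤n⇒m<n∨m≡n (subst (_≤ i) e (nc .below i))
    ...   | inj₁ m<i = contradiction (trans (sym (nc .beyond (<⇒≤ m<i))) e) i≢m
    ...   | inj₂ m≡i = contradiction (sym m≡i) i≢m

-- The added point copies the value at `j`, before and after the merge, so it moves along whenever
-- the block of `j` is absorbed.
Merge-close : ∀ {m f f′ x r} j → Merge f f′ x r → Merge (f [ m ↦ f j ]) (f′ [ m ↦ f′ j ]) x r ⊎ m ≤ x
Merge-close {m} {f} {f′} {x} {r} j mg with <-≤-connex x m
... | inj₂ m≤x = inj₂ m≤x
... | inj₁ x<m = inj₁ record
  { r<x = mg .r<x
  ; fr≡r = trans (update-≢ f m _ (<⇒≢ (<-trans (mg .r<x) x<m))) (mg .fr≡r)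
  ; fx≡x = trans (update-≢ f m _ (<⇒≢ x<m)) (mg .fx≡x)
  ; moved = λ {i} → moved′ {i} ; kept = λ {i} → kept′ {i} }
  where
  moved′ : ∀ {i} → (f [ m ↦ f j ]) i ≡ x → (f′ [ m ↦ f′ j ]) i ≡ r
  moved′ {i} e with i ≟ m
  ... | yes _ = mg .moved e
  ... | no _  = mg .moved e
  kept′ : ∀ {i} → (f [ m ↦ f j ]) i ≢ x → (f′ [ m ↦ f′ j ]) i ≡ (f [ m ↦ f j ]) i
  kept′ {i} e with i ≟ m
  ... | yes _ = mg .kept e
  ... | no _  = mg .kept e

-- The bit tells whether the new last point `m` is a singleton or joins the block of `j`. Later `j`
-- is the first or the last of the old points: by `visible-first` and `visible-last` their blocks
-- are never enclosed by another one.
module Extend {m j : ℕ} (j<m : j < m) (visible : ∀ (σ : NC m) {a b c} → a < b → b < c → c < m →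
  minOf σ a ≡ minOf σ c → minOf σ b ≡ minOf σ j → minOf σ a ≡ minOf σ j) where

  private
    fj<m : ∀ (σ : NC m) → minOf σ j < m
    fj<m σ = ≤-<-trans (minOf-≤ σ j) j<m

    fj-fixed : ∀ (σ : NC m) → minOf σ (minOf σ j) ≡ minOf σ j
    fj-fixed σ = minOf-isNC σ .idem j

    closed : (σ : NC m) → IsNC (suc m) (minOf σ [ m ↦ minOf σ j ])
    closed σ = close-isNC (minOf-isNC σ) (fj<m σ) (fj-fixed σ) (visible σ)

  extend : NC m × Fin 2 → NC (suc m)
  extend (σ , zero)     = toNC (widen-isNC (minOf-isNC σ))
  extend (σ , suc zero) = toNC (closed σ)

  minOf-extend₀ : ∀ σ i → minOf (extend (σ , zero)) i ≡ minOf σ i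
  minOf-extend₀ σ = minOf-toNC (widen-isNC (minOf-isNC σ))

  minOf-extend₁ : ∀ σ i → minOf (extend (σ , suc zero)) i ≡ (minOf σ [ m ↦ minOf σ j ]) i
  minOf-extend₁ σ = minOf-toNC (closed σ)

  minOf-extend₁-m : ∀ σ → minOf (extend (σ , suc zero)) m ≡ minOf σ j
  minOf-extend₁-m σ = trans (minOf-extend₁ σ m) (update-≡ (minOf σ) m (minOf σ j))

  minOf-extend₀-m : ∀ σ → minOf (extend (σ , zero)) m ≡ m
  minOf-extend₀-m σ = trans (minOf-extend₀ σ m) (minOf-beyond σ ≤-refl)

  minOf-extend-≢ : ∀ σ e {i} → i ≢ m → minOf (extend (σ , e)) i ≡ minOf σ i
  minOf-extend-≢ σ zero {i} _ = minOf-extend₀ σ i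
  minOf-extend-≢ σ (suc zero) {i} i≢m = trans (minOf-extend₁ σ i) (update-≢ (minOf σ) m _ i≢m)

  extendWeight : NC m × Fin 2 → ℕ
  extendWeight (σ , e) = numBlocks σ + (1 ∸ toℕ e)

  numBlocks-extend : ∀ σe → numBlocks (extend σe) ≡ extendWeight σe
  numBlocks-extend (σ , e) = trans (numBlocks-sumTo (extend (σ , e))) (cong₂ _+_
    (trans (sumTo-cong m λ {i} i<m → indicator-⇔ (minOf (extend (σ , e)) i ≟ i) (minOf σ i ≟ i)
        (trans (sym (minOf-extend-≢ σ e (<⇒≢ i<m)))) (trans (minOf-extend-≢ σ e (<⇒≢ i<m))))
      (sym (numBlocks-sumTo σ)))
    (at-m e))
    where
    at-m : ∀ e → fixed (minOf (extend (σ , e))) m ≡ 1 ∸ toℕ e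
    at-m zero = indicator-yes (minOf (extend (σ , zero)) m ≟ m) (minOf-extend₀-m σ)
    at-m (suc zero) = indicator-no (minOf (extend (σ , suc zero)) m ≟ m)
      λ e → <⇒≢ (fj<m σ) (trans (sym (minOf-extend₁-m σ)) e)

  extend-injective : ∀ {σe τe} → extend σe ≡ extend τe → σe ≡ τe
  extend-injective {σ , d} {τ , e} eq = cong₂ _,_ (minOf-injective same) (bits d e (cong (λ υ → minOf υ m) eq))
    where
    same : ∀ i → minOf σ i ≡ minOf τ i
    same i with i ≟ m
    ... | yes refl = trans (minOf-beyond σ ≤-refl) (sym (minOf-beyond τ ≤-refl))
    ... | no i≢m = trans (sym (minOf-extend-≢ σ d i≢m)) (trans (cong (λ υ → minOf υ i) eq)
        (minOf-extend-≢ τ e i≢m))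
    bits : ∀ d e → minOf (extend (σ , d)) m ≡ minOf (extend (τ , e)) m → d ≡ e
    bits zero zero _ = refl
    bits (suc zero) (suc zero) _ = refl
    bits zero (suc zero) p = contradiction (trans (sym (minOf-extend₁-m τ))
        (trans (sym p) (minOf-extend₀-m σ))) (<⇒≢ (fj<m τ))
    bits (suc zero) zero p = contradiction (trans (sym (minOf-extend₁-m σ)) (trans p (minOf-extend₀-m τ)))
        (<⇒≢ (fj<m σ))

  extend-onto : ∀ υ → minOf υ m ≡ m ⊎ minOf υ m ≡ minOf υ j →
                ∃ λ σe → extend σe ≡ υ × (∀ {i} → i < m → minOf (proj₁ σe) i ≡ minOf υ i)
  extend-onto υ last = go last
    where
    tr = truncate-isNC {a = m} (minOf-isNC υ)
    σ = toNC tr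
    σ≗ : ∀ {i} → i < m → minOf σ i ≡ minOf υ i
    σ≗ {i} i<m = trans (minOf-toNC tr i) (truncate-< i<m)
    ext : ∀ e → minOf (extend (σ , e)) m ≡ minOf υ m → extend (σ , e) ≡ υ
    ext e at-m = minOf-injective λ i → eq i (<-cmp i m)
      where
      eq : ∀ i → _ → minOf (extend (σ , e)) i ≡ minOf υ i
      eq i (tri< i<m i≢m _) = trans (minOf-extend-≢ σ e i≢m) (σ≗ i<m)
      eq i (tri≈ _ refl _) = at-m
      eq i (tri> _ _ m<i) = trans (minOf-beyond (extend (σ , e)) m<i) (sym (minOf-beyond υ m<i))
    go : minOf υ m ≡ m ⊎ minOf υ m ≡ minOf υ j →
         ∃ λ σe → extend σe ≡ υ × (∀ {i} → i < m → minOf (proj₁ σe) i ≡ minOf υ i)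
    go (inj₁ p) = (σ , zero) , ext zero (trans (minOf-extend₀-m σ) (sym p)) , σ≗
    go (inj₂ p) = (σ , suc zero) , ext (suc zero) (trans (minOf-extend₁-m σ) (trans (σ≗ j<m) (sym p))) , σ≗

  module _ {K : ℕ} where
    extend-Coverˡ : ∀ {σ τ} e → Cover K σ τ → Cover K (extend (σ , e)) (extend (τ , e))
    extend-Coverˡ {σ} {τ} e c = record
      { merge = merge′ e
      ; avoids = λ x≡k p → c .avoids x≡k (trans (sym (minOf-extend-≢ σ e (K≢m x≡k))) p)
      ; numBlocks-suc = trans (numBlocks-extend (σ , e)) (trans (cong (_+ (1 ∸ toℕ e)) (c .numBlocks-suc))
          (cong suc (sym (numBlocks-extend (τ , e))))) }
      where
      x<m′ : c .Cover.x < m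
      x<m′ = x<m (c .merge) (minOf-isNC τ)
      K≢m : c .Cover.x ≡ suc K → K ≢ m
      K≢m refl = <⇒≢ (<-trans ≤-refl x<m′)
      merge′ : ∀ e → Merge (minOf (extend (σ , e))) (minOf (extend (τ , e))) (c .Cover.x) (c .Cover.r)
      merge′ zero = Merge-cong (sym ∘ minOf-extend₀ σ) (sym ∘ minOf-extend₀ τ) (c .merge)
      merge′ (suc zero) with Merge-close {m} j (c .merge)
      ... | inj₁ mg = Merge-cong (sym ∘ minOf-extend₁ σ) (sym ∘ minOf-extend₁ τ) mg
      ... | inj₂ m≤x = contradiction m≤x (<⇒≱ x<m′)

    extend-Coverʳ : ∀ {σ} → Avoids K (minOf σ) m (minOf σ j) → ∀ {d e} → d ↑ e → Cover K (extend (σ , d))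
        (extend (σ , e))
    extend-Coverʳ {σ} av {zero} {suc zero} (up _) = record
      { merge = Merge-cong (sym ∘ minOf-extend₀ σ) (sym ∘ minOf-extend₁ σ) (close-Merge (minOf-isNC σ)
          (fj<m σ) (fj-fixed σ) (visible σ))
      ; avoids = λ m≡k p → av m≡k (trans (sym (minOf-extend₀ σ K)) p)
      ; numBlocks-suc = trans (numBlocks-extend (σ , zero)) (trans (+-comm (numBlocks σ) 1)
          (cong suc (sym (trans (numBlocks-extend (σ , suc zero)) (+-identityʳ _))))) }
    extend-Coverʳ _ {zero} {zero} (up ())
    extend-Coverʳ _ {suc zero} {zero} (up ())
    extend-Coverʳ _ {suc zero} {suc zero} (up ())

visible-first : ∀ {m} (σ : NC m) {a b c} → a < b → b < c → c < m → minOf σ a ≡ minOf σ c →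
                minOf σ b ≡ minOf σ 0 → minOf σ a ≡ minOf σ 0
visible-first σ {zero} _ _ _ _ _ = refl
visible-first σ {suc a} a<b b<c _ a~c b~0 = sym (minOf-isNC σ .uncrossed z<s a<b b<c (sym b~0) a~c)

visible-last : ∀ {n} (σ : NC (suc n)) {a b c} → a < b → b < c → c < suc n → minOf σ a ≡ minOf σ c →
               minOf σ b ≡ minOf σ n → minOf σ a ≡ minOf σ n
visible-last {n} σ a<b b<c c<m a~c b~n with m≤n⇒m<n∨m≡n (s≤s⁻¹ c<m)
... | inj₁ c<n = trans (minOf-isNC σ .uncrossed a<b b<c c<n a~c b~n) b~n
... | inj₂ refl = a~c

-- Two partitions side by side

data Side (a : ℕ) : ℕ → Set where
  low  : ∀ {i} → i < a → Side a i
  high : ∀ j → Side a (a + j)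

side : ∀ a i → Side a i
side a i with i <? a
... | yes i<a = low i<a
... | no i≮a = subst (Side a) (m+[n∸m]≡n (≮⇒≥ i≮a)) (high (i ∸ a))

opaque
  glue : ℕ → (ℕ → ℕ) → (ℕ → ℕ) → ℕ → ℕ
  glue a f g i with i <? a
  ... | yes _ = f i
  ... | no  _ = a + g (i ∸ a)

  glue-low : ∀ {a f g i} → i < a → glue a f g i ≡ f i
  glue-low {a} {i = i} i<a with i <? a
  ... | yes _ = refl
  ... | no i≮a = contradiction i<a i≮a

  glue-high : ∀ {a f g} j → glue a f g (a + j) ≡ a + g j
  glue-high {a} {g = g} j with a + j <? a
  ... | yes a+j<a = contradiction (m≤m+n a j) (<⇒≱ a+j<a)
  ... | no _ = cong (λ i → a + g i) (m+n∸m≡n a j)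

module _ {a : ℕ} {f g : ℕ → ℕ} where
  module _ {c : ℕ} (ncf : IsNC a f) (ncg : IsNC c g) where
    private
      h = glue a f g

      low-value : ∀ {i} → i < a → h i < a
      low-value i<a = subst (_< a) (sym (glue-low i<a)) (≤-<-trans (ncf .below _) i<a)

      low-≢-high : ∀ {i j} → i < a → h i ≢ h (a + j)
      low-≢-high {i} {j} i<a e = <⇒≱ (low-value i<a) (subst (a ≤_) (trans (sym (glue-high j)) (sym e))
          (m≤m+n a (g j)))

    glue-isNC : IsNC (a + c) (glue a f g)
    glue-isNC .below i with side a i
    ... | low i<a = subst (_≤ i) (sym (glue-low i<a)) (ncf .below i)
    ... | high j = subst (_≤ a + j) (sym (glue-high j)) (+-monoʳ-≤ a (ncg .below j))
    glue-isNC .idem i with side a i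
    ... | low i<a = trans (glue-low (low-value i<a)) (trans (cong f (glue-low i<a))
        (trans (ncf .idem i) (sym (glue-low i<a))))
    ... | high j = trans (cong h (glue-high j)) (trans (glue-high (g j))
        (trans (cong (a +_) (ncg .idem j)) (sym (glue-high j))))
    glue-isNC .beyond {i} a+c≤i with side a i
    ... | low i<a = contradiction (≤-trans (m≤m+n a c) a+c≤i) (<⇒≱ i<a)
    ... | high j = trans (glue-high j) (cong (a +_) (ncg .beyond (+-cancelˡ-≤ a _ _ a+c≤i)))
    glue-isNC .uncrossed {p} {q} {r} {s} p<q q<r r<s p~r q~s with side a p | side a q | side a r | side a s
    ... | low p< | low q< | low r< | low s< = trans (glue-low p<) (trans
          (ncf .uncrossed p<q q<r r<s (trans (sym (glue-low p<)) (trans p~r (glue-low r<)))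
            (trans (sym (glue-low q<)) (trans q~s (glue-low s<)))) (sym (glue-low q<)))
    ... | low p< | _ | high r | _ = contradiction p~r (low-≢-high p<)
    ... | low p< | low q< | low r< | high s = contradiction q~s (low-≢-high q<)
    ... | low p< | high q | low r< | _ = contradiction (m≤m+n a q) (<⇒≱ (<-trans q<r r<))
    ... | high p | low q< | _ | _ = contradiction (m≤m+n a p) (<⇒≱ (<-trans p<q q<))
    ... | high p | high q | low r< | _ = contradiction (m≤m+n a q) (<⇒≱ (<-trans q<r r<))
    ... | high p | high q | high r | low s< = contradiction (m≤m+n a r) (<⇒≱ (<-trans r<s s<))
    ... | high p | high q | high r | high s = trans (glue-high p) (trans (cong (a +_)
          (ncg .uncrossed (+-cancelˡ-< a _ _ p<q) (+-cancelˡ-< a _ _ q<r) (+-cancelˡ-< a _ _ r<s)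
            (shift p~r) (shift q~s))) (sym (glue-high q)))
      where
      shift : ∀ {i j} → h (a + i) ≡ h (a + j) → g i ≡ g j
      shift {i} {j} e = +-cancelˡ-≡ a _ _ (trans (sym (glue-high i)) (trans e (glue-high j)))

module _ {a : ℕ} {f f′ g : ℕ → ℕ} {x r : ℕ} where
  glue-Mergeˡ : x < a → Merge f f′ x r → Merge (glue a f g) (glue a f′ g) x r
  glue-Mergeˡ x<a mg = record
    { r<x = mg .r<x
    ; fr≡r = trans (glue-low (<-trans (mg .r<x) x<a)) (mg .fr≡r)
    ; fx≡x = trans (glue-low x<a) (mg .fx≡x)
    ; moved = λ {i} → moved′ i ; kept = λ {i} → kept′ i }
    where
    moved′ : ∀ i → glue a f g i ≡ x → glue a f′ g i ≡ r
    moved′ i e with side a i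
    ... | low i<a = trans (glue-low i<a) (mg .moved (trans (sym (glue-low i<a)) e))
    ... | high j = contradiction (subst (a ≤_) (trans (sym (glue-high j)) e) (m≤m+n a (g j))) (<⇒≱ x<a)
    kept′ : ∀ i → glue a f g i ≢ x → glue a f′ g i ≡ glue a f g i
    kept′ i ne with side a i
    ... | low i<a = trans (glue-low i<a) (trans (mg .kept λ e → ne (trans (glue-low i<a) e))
        (sym (glue-low i<a)))
    ... | high j = trans (glue-high j) (sym (glue-high j))

module _ {a : ℕ} {f g g′ : ℕ → ℕ} {x r : ℕ} (f≤ : ∀ i → f i ≤ i) where
  glue-Mergeʳ : Merge g g′ x r → Merge (glue a f g) (glue a f g′) (a + x) (a + r)
  glue-Mergeʳ mg = record
    { r<x = +-monoʳ-< a (mg .r<x)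
    ; fr≡r = trans (glue-high r) (cong (a +_) (mg .fr≡r))
    ; fx≡x = trans (glue-high x) (cong (a +_) (mg .fx≡x))
    ; moved = λ {i} → moved′ i ; kept = λ {i} → kept′ i }
    where
    moved′ : ∀ i → glue a f g i ≡ a + x → glue a f g′ i ≡ a + r
    moved′ i e with side a i
    ... | low i<a = contradiction
        (≤-trans (m≤m+n a x) (≤-trans (≤-reflexive (trans (sym e) (glue-low i<a))) (f≤ i))) (<⇒≱ i<a)
    ... | high j = trans (glue-high j)
        (cong (a +_) (mg .moved (+-cancelˡ-≡ a _ _ (trans (sym (glue-high j)) e))))
    kept′ : ∀ i → glue a f g i ≢ a + x → glue a f g′ i ≡ glue a f g i
    kept′ i ne with side a i
    ... | low i<a = trans (glue-low i<a) (sym (glue-low i<a))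
    ... | high j = trans (glue-high j)
        (trans (cong (a +_) (mg .kept λ e → ne (trans (glue-high j) (cong (a +_) e)))) (sym (glue-high j)))

module _ {a c m : ℕ} (a+c≡m : a + c ≡ m) where
  private
    glued : (σ : NC a) (τ : NC c) → IsNC m (glue a (minOf σ) (minOf τ))
    glued σ τ = subst (λ m → IsNC m (glue a (minOf σ) (minOf τ))) a+c≡m (glue-isNC (minOf-isNC σ)
        (minOf-isNC τ))

  -- The size is tied to `a + c` by an equation only, so that parts of sizes `a` and `suc b` give a
  -- partition of `suc (a + b)` points directly.
  glueNC : NC a → NC c → NC m
  glueNC σ τ = toNC (glued σ τ)

  minOf-glueNC : ∀ σ τ i → minOf (glueNC σ τ) i ≡ glue a (minOf σ) (minOf τ) i
  minOf-glueNC σ τ = minOf-toNC (glued σ τ)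

  minOf-glueNC-high : ∀ σ τ j → minOf (glueNC σ τ) (a + j) ≡ a + minOf τ j
  minOf-glueNC-high σ τ j = trans (minOf-glueNC σ τ (a + j)) (glue-high j)

  numBlocks-glueNC : ∀ σ τ → numBlocks (glueNC σ τ) ≡ numBlocks σ + numBlocks τ
  numBlocks-glueNC σ τ = begin
    numBlocks (glueNC σ τ)                                         ≡⟨ numBlocks-sumTo (glueNC σ τ) ⟩
    sumTo m (fixed h)                                              ≡⟨ cong (λ m → sumTo m (fixed h)) a+c≡m ⟨
    sumTo (a + c) (fixed h)                                        ≡⟨ sumTo-+ a c ⟩
    sumTo a (fixed h) + sumTo c (fixed h ∘ (a +_))                 ≡⟨ cong₂ _+_ (sumTo-cong a lows)
        (sumTo-cong c highs) ⟩
    sumTo a (fixed (minOf σ)) + sumTo c (fixed (minOf τ))          ≡⟨ cong₂ _+_ (numBlocks-sumTo σ)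
        (numBlocks-sumTo τ) ⟨
    numBlocks σ + numBlocks τ                                      ∎
    where
    open ≡-Reasoning
    h = minOf (glueNC σ τ)
    lows : ∀ {i} → i < a → fixed h i ≡ fixed (minOf σ) i
    lows {i} i<a = indicator-⇔ (h i ≟ i) (minOf σ i ≟ i) (trans (sym e)) (trans e)
      where e = trans (minOf-glueNC σ τ i) (glue-low i<a)
    highs : ∀ {j} → j < c → fixed h (a + j) ≡ fixed (minOf τ) j
    highs {j} _ = indicator-⇔ (h (a + j) ≟ a + j) (minOf τ j ≟ j)
      (λ p → +-cancelˡ-≡ a _ _ (trans (sym (minOf-glueNC-high σ τ j)) p))
      (λ p → trans (minOf-glueNC-high σ τ j) (cong (a +_) p))

  glueNC-injective : ∀ {σ τ σ′ τ′} → glueNC σ τ ≡ glueNC σ′ τ′ → σ ≡ σ′ × τ ≡ τ′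
  glueNC-injective {σ} {τ} {σ′} {τ′} e = minOf-injective lows , minOf-injective λ j → +-cancelˡ-≡ a _ _
      (trans (sym (minOf-glueNC-high σ τ j)) (trans (cong (λ υ → minOf υ (a + j)) e)
          (minOf-glueNC-high σ′ τ′ j)))
    where
    lows : ∀ i → minOf σ i ≡ minOf σ′ i
    lows i with side a i
    ... | low i<a = trans (sym (trans (minOf-glueNC σ τ i) (glue-low i<a)))
          (trans (cong (λ υ → minOf υ i) e) (trans (minOf-glueNC σ′ τ′ i) (glue-low i<a)))
    ... | high j = trans (minOf-beyond σ (m≤m+n a j)) (sym (minOf-beyond σ′ (m≤m+n a j)))

  glueNC-onto : ∀ υ → (∀ j → a ≤ minOf υ (a + j)) → ∃₂ λ σ τ → glueNC σ τ ≡ υ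
  glueNC-onto υ closed = σ , τ , minOf-injective λ i → trans (minOf-glueNC σ τ i) (same i)
    where
    f = minOf υ
    nc = minOf-isNC υ
    g : ℕ → ℕ
    g j = f (a + j) ∸ a
    a+g : ∀ j → a + g j ≡ f (a + j)
    a+g j = m+[n∸m]≡n (closed j)
    ncg : IsNC c g
    ncg .below j = +-cancelˡ-≤ a _ _ (subst (_≤ a + j) (sym (a+g j)) (nc .below (a + j)))
    ncg .idem j = +-cancelˡ-≡ a _ _
        (trans (a+g (g j)) (trans (cong f (a+g j)) (trans (nc .idem (a + j)) (sym (a+g j)))))
    ncg .beyond {j} c≤j = +-cancelˡ-≡ a _ _
        (trans (a+g j) (nc .beyond (subst (_≤ a + j) a+c≡m (+-monoʳ-≤ a c≤j))))
    ncg .uncrossed {p} {q} {r} {s} p<q q<r r<s p~r q~s = cong (_∸ a)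
      (nc .uncrossed (+-monoʳ-< a p<q) (+-monoʳ-< a q<r) (+-monoʳ-< a r<s) (lift p~r) (lift q~s))
      where
      lift : ∀ {i j} → g i ≡ g j → f (a + i) ≡ f (a + j)
      lift {i} {j} e = trans (sym (a+g i)) (trans (cong (a +_) e) (a+g j))
    ncσ = truncate-isNC {a = a} nc
    σ = toNC ncσ
    τ = toNC ncg
    same : ∀ i → glue a (minOf σ) (minOf τ) i ≡ f i
    same i with side a i
    ... | low i<a = trans (glue-low i<a) (trans (minOf-toNC ncσ i) (truncate-< i<a))
    ... | high j = trans (glue-high j) (trans (cong (a +_) (minOf-toNC ncg j)) (a+g j))

-- Decomposition of NC_m by the block of the last element

module _ {K : ℕ} where
  Avoids-< : ∀ f {x r} → x < suc K → Avoids K f x r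
  Avoids-< f x<k refl = contradiction x<k (<⇒≱ ≤-refl)

  gradedCover : ∀ {m} {σ τ : NC m} → Cover K σ τ → numBlocks σ ≡ suc (numBlocks τ)
  gradedCover = numBlocks-suc

  graded↑ : ∀ {i j : Fin 2} → i ↑ j → 1 ∸ toℕ i ≡ suc (1 ∸ toℕ j)
  graded↑ {zero} {suc zero} _ = refl
  graded↑ {zero} {zero} (up ())
  graded↑ {suc zero} {zero} (up ())
  graded↑ {suc zero} {suc zero} (up ())

  SCDₖ : ∀ {m} → ℕ → (NC m → Set) → Set
  SCDₖ = SCD (Cover K) numBlocks

  module Node {a b : ℕ} (0<a : 0 < a) (0<b : 0 < b) (a+b≤k : a + b ≤ suc K) where
    private
      module E = Extend 0<b visible-first

    -- These are the partitions whose last point has block minimum `a`. That block keeps the points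
    -- before `a` apart from the others, and the last point merely follows `a`, so nothing remains
    -- but a partition of `a` points and one of `b` points. As `a + b ≤ suc K`, no merge here
    -- absorbs `suc K`.
    node : NC a × NC b → NC (suc (a + b))
    node (σ , τ) = glueNC (+-suc a b) σ (E.extend (τ , suc zero))

    nodeWeight : NC a × NC b → ℕ
    nodeWeight (σ , τ) = numBlocks σ + numBlocks τ

    numBlocks-node : ∀ στ → numBlocks (node στ) ≡ nodeWeight στ
    numBlocks-node (σ , τ) = trans (numBlocks-glueNC (+-suc a b) σ (E.extend (τ , suc zero)))
      (cong (numBlocks σ +_) (trans (E.numBlocks-extend (τ , suc zero)) (+-identityʳ (numBlocks τ))))

    node-injective : ∀ {x y} → node x ≡ node y → x ≡ y
    node-injective {σ , τ} {σ′ , τ′} e with refl , p ← glueNC-injective (+-suc a b) {σ} {E.extend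
        (τ , suc zero)} {σ′} {E.extend (τ′ , suc zero)} e
      with refl ← E.extend-injective {τ , suc zero} {τ′ , suc zero} p = refl

    minOf-node-last : ∀ x → minOf (node x) (a + b) ≡ a
    minOf-node-last (σ , τ) = trans (minOf-glueNC-high (+-suc a b) σ (E.extend (τ , suc zero)) b)
      (trans (cong (a +_) (trans (E.minOf-extend₁-m τ) (f0≡0 (minOf-isNC τ)))) (+-identityʳ a))

    node-onto : ∀ {υ} → minOf υ (a + b) ≡ a → ∃ λ x → node x ≡ υ
    node-onto {υ} last = finish (glueNC-onto (+-suc a b) υ closed)
      where
      f = minOf υ
      nc = minOf-isNC υ
      fa≡a : f a ≡ a
      fa≡a = trans (cong f (sym last)) (trans (nc .idem (a + b)) last)
      closed : ∀ j → a ≤ f (a + j)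
      closed zero = ≤-reflexive (sym (trans (cong f (+-identityʳ a)) fa≡a))
      closed (suc j) with <-cmp (suc j) b
      ... | tri≈ _ refl _ = ≤-reflexive (sym last)
      ... | tri> _ _ b<j = subst (a ≤_)
          (sym (nc .beyond (subst (_≤ a + suc j) (+-suc a b) (+-monoʳ-≤ a b<j)))) (m≤m+n a (suc j))
      -- A block through `i` that begins before `a` would cross the block containing `a` and
      -- `a + b`.
      ... | tri< j<b _ _ = ≮⇒≥ λ fi<a → <⇒≢ fi<a
            (trans (sym (nc .idem i)) (trans (nc .uncrossed fi<a (m<m+n a z<s) (+-monoʳ-< a j<b)
                (nc .idem i) (trans fa≡a (sym last))) fa≡a))
        where i = a + suc j
      finish : ∃₂ (λ σ τ → glueNC (+-suc a b) σ τ ≡ υ) → ∃ λ x → node x ≡ υ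
      finish (σ , τ , refl) with τb ← +-cancelˡ-≡ a _ _
          (trans (trans (sym (minOf-glueNC-high (+-suc a b) σ τ b)) last) (sym (+-identityʳ a)))
        with E.extend-onto τ (inj₂ (trans τb (sym (f0≡0 (minOf-isNC τ)))))
      ... | (τ′ , suc zero) , refl , _ = (σ , τ′) , refl
      ... | (τ′ , zero) , refl , _ = contradiction (trans (sym τb) (E.minOf-extend₀-m τ′)) (<⇒≢ 0<b)

    node-Cover : ∀ {x y} → (Cover K ⊗ Cover K) x y → Cover K (node x) (node y)
    node-Cover (left {σ} {σ′} {τ} c) = record
      { merge = Merge-cong (sym ∘ minOf-glueNC (+-suc a b) σ τ⁺) (sym ∘ minOf-glueNC (+-suc a b) σ′ τ⁺)
          (glue-Mergeˡ x<a (c .merge))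
      ; avoids = Avoids-< (minOf (node (σ , τ))) (<-≤-trans x<a (≤-trans (m≤m+n a b) a+b≤k))
      ; numBlocks-suc = trans (numBlocks-node (σ , τ)) (trans (cong (_+ numBlocks τ) (c .numBlocks-suc))
          (cong suc (sym (numBlocks-node (σ′ , τ)))))
      }
      where
      τ⁺ = E.extend (τ , suc zero)
      x<a = x<m (c .merge) (minOf-isNC σ′)
    node-Cover (right {σ} {τ} {τ′} c) = record
      { merge = Merge-cong (sym ∘ minOf-glueNC (+-suc a b) σ (E.extend (τ , suc zero)))
          (sym ∘ minOf-glueNC (+-suc a b) σ (E.extend (τ′ , suc zero)))
          (glue-Mergeʳ (minOf-≤ σ) (c⁺ .merge))
      ; avoids = Avoids-< (minOf (node (σ , τ))) (<-≤-trans (+-monoʳ-< a x<b) a+b≤k)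
      ; numBlocks-suc = trans (numBlocks-node (σ , τ)) (trans (cong (numBlocks σ +_) (c .numBlocks-suc))
          (trans (+-suc (numBlocks σ) _) (cong suc (sym (numBlocks-node (σ , τ′))))))
      }
      where
      c⁺ = E.extend-Coverˡ (suc zero) c
      x<b : c .Cover.x < b
      x<b = x<m (c .merge) (minOf-isNC τ′)

  -- The last point contributes no block, so the sums `suc a` and `suc b` of the factors add up to
  -- exactly the sum required on `suc (a + b)` points.
  SCD-node : ∀ {a b} → 0 < a → 0 < b → a + b ≤ suc K → SCDₖ {a} (suc a) (λ _ → ⊤) → SCDₖ {b} (suc b) (λ _ → ⊤) →
             SCDₖ {suc (a + b)} (suc (suc (a + b))) (λ υ → minOf υ (a + b) ≡ a)
  SCD-node {a} {b} 0<a 0<b a+b≤k sa sb = subst (λ N → SCDₖ {suc (a + b)} N (λ υ → minOf υ (a + b) ≡ a))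
      (cong suc (+-suc a b))
    (SCD-map node node-injective (λ _ _ → node-Cover) numBlocks-node (λ {x} _ → minOf-node-last x)
      (λ last → map₂ (λ e → (tt , tt) , e) (node-onto last)) (SCD-× gradedCover gradedCover sa sb))
    where
    open Node 0<a 0<b a+b≤k

  SCD-inner : ∀ {M} → M ≤ suc K → (∀ m → 0 < m → m < M → SCDₖ {m} (suc m) (λ _ → ⊤)) → ∀ {lo hi} → 0 < lo →
      hi ≤ M →
              SCDₖ {suc M} (suc (suc M)) (λ υ → ⊤ × lo ≤ minOf υ M × minOf υ M < hi)
  SCD-inner {M} M≤k s {lo} {hi} 0<lo hi≤M = SCD-range (λ υ → minOf υ M) lo hi λ i lo≤i i<hi →
    part i (M ∸ i) (m+[n∸m]≡n (<⇒≤ (<-≤-trans i<hi hi≤M))) (≤-trans 0<lo lo≤i) (m<n⇒0<n∸m (<-≤-trans i<hi hi≤M))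
    where
    part : ∀ a b → a + b ≡ M → 0 < a → 0 < b → SCDₖ {suc M} (suc (suc M)) (λ υ → ⊤ × minOf υ M ≡ a)
    part a b refl 0<a 0<b = SCD-⇔ (tt ,_) proj₂ (SCD-node 0<a 0<b M≤k (s a 0<a (m<m+n a 0<b))
        (s b 0<b (m<n+m b 0<a)))

  module _ {m j : ℕ} (j<m : j < m) (visible : ∀ (σ : NC m) {a b c} → a < b → b < c → c < m →
           minOf σ a ≡ minOf σ c → minOf σ b ≡ minOf σ j → minOf σ a ≡ minOf σ j) where
    private
      module E = Extend j<m visible

    SCD-extend : ∀ {N} {P : (ℕ → ℕ) → Set} → (∀ {σ : NC m} → P (minOf σ) → Avoids K (minOf σ) m (minOf σ j)) →
                 (∀ {f g} → (∀ {i} → i < m → f i ≡ g i) → P f → P g) → SCDₖ {m} N (P ∘ minOf) →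
                 SCDₖ {suc m} (N + 1) (λ υ → (minOf υ m ≡ m ⊎ minOf υ m ≡ minOf υ j) × P (minOf υ))
    SCD-extend {N} {P} av resp s = SCD-map E.extend E.extend-injective preserves E.numBlocks-extend
      (λ {σe} → into σe) onto (SCD-× gradedCover graded↑ s SCD-2)
      where
      preserves : ∀ {x y} → P (minOf (proj₁ x)) × ⊤ → P (minOf (proj₁ y)) × ⊤ → (Cover K ⊗ _↑_) x y →
          Cover K (E.extend x) (E.extend y)
      preserves _ _ (left {y = e} c) = E.extend-Coverˡ e c
      preserves (p , _) _ (right u) = E.extend-Coverʳ (av p) u
      into : ∀ σe → P (minOf (proj₁ σe)) × ⊤ →
             (minOf (E.extend σe) m ≡ m ⊎ minOf (E.extend σe) m ≡ minOf (E.extend σe) j) × P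
                 (minOf (E.extend σe))
      into (σ , e) (p , _) = last e , resp (λ i<m → sym (E.minOf-extend-≢ σ e (<⇒≢ i<m))) p
        where
        last : ∀ e → minOf (E.extend (σ , e)) m ≡ m ⊎ minOf (E.extend (σ , e)) m ≡ minOf (E.extend (σ , e)) j
        last zero = inj₁ (E.minOf-extend₀-m σ)
        last (suc zero) = inj₂ (trans (E.minOf-extend₁-m σ) (sym (E.minOf-extend-≢ σ (suc zero) (<⇒≢ j<m))))
      onto : ∀ {υ} → (minOf υ m ≡ m ⊎ minOf υ m ≡ minOf υ j) × P (minOf υ) → ∃ λ σe →
          (P (minOf (proj₁ σe)) × ⊤) × E.extend σe ≡ υ
      onto {υ} (last , p) with σe , e , same ← E.extend-onto υ last = σe , (resp (sym ∘ same) p , tt) , e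

  -- The last point as a singleton or in the block of 0 gives NC_M × C₂; the minima strictly in
  -- between give the nodes. Both factors of a node are smaller, hence the strong induction on
  -- `fuel`. The bound `m ≤ suc K` keeps the absorbed points below `suc K`, so that all labels are
  -- permitted.
  SCD-NC : ∀ fuel m → m ≤ fuel → 0 < m → m ≤ suc K → SCDₖ {m} (suc m) (λ _ → ⊤)
  SCD-NC (suc fuel) (suc zero) _ _ _ = record
    { chains = (ι , ι , ε) ∷ [] ; symmetric = cong₂ _+_ numBlocks-ι numBlocks-ι ∷ [] ; unique = [] ∷ []
    ; sound = λ _ → tt ; complete = λ {σ} _ → here (minOf-injective λ i → trans (fix σ i) (sym (fix ι i))) }
    where
    isNC-id : IsNC 1 id
    isNC-id = record { below = λ _ → ≤-refl ; idem = λ _ → refl ; beyond = λ _ → refl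
      ; uncrossed = λ a<b b<c _ a≡c _ → contradiction a≡c (<⇒≢ (<-trans a<b b<c)) }
    ι : NC 1
    ι = toNC isNC-id
    numBlocks-ι : numBlocks ι ≡ 1
    numBlocks-ι = numBlocks-toNC isNC-id
    fix : ∀ (σ : NC 1) i → minOf σ i ≡ i
    fix σ zero = f0≡0 (minOf-isNC σ)
    fix σ (suc i) = minOf-beyond σ (s≤s z≤n)
  SCD-NC (suc fuel) (suc M@(suc _)) m≤fuel _ m≤k = SCD-⇔ (λ _ → tt) (λ {υ} _ → classify υ)
    (SCD-∪ disjoint
      (subst (λ N → SCDₖ N Extremal) (+-comm (suc M) 1)
        (SCD-extend z<s visible-first {P = λ _ → ⊤} (λ {σ} _ → Avoids-< (minOf σ) m≤k) (λ _ _ → tt)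
            (SCD-NC fuel M (s≤s⁻¹ m≤fuel) z<s M≤k)))
      (SCD-inner M≤k (λ m 0<m m<M → SCD-NC fuel m (≤-trans (<⇒≤ m<M) (s≤s⁻¹ m≤fuel)) 0<m
          (≤-trans (<⇒≤ m<M) M≤k)) z<s ≤-refl))
    where
    M≤k = <⇒≤ m≤k
    Extremal Inner : NC (suc M) → Set
    Extremal υ = (minOf υ M ≡ M ⊎ minOf υ M ≡ minOf υ 0) × ⊤
    Inner υ = ⊤ × 1 ≤ minOf υ M × minOf υ M < M
    disjoint : ∀ {υ} → Extremal υ → ¬ Inner υ
    disjoint (inj₁ e , _) (_ , _ , <M) = <⇒≢ <M e
    disjoint {υ} (inj₂ e , _) (_ , 1≤ , _) = >⇒≢ 1≤ (trans e (f0≡0 (minOf-isNC υ)))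
    classify : ∀ υ → Extremal υ ⊎ Inner υ
    classify υ with minOf υ M ≟ 0 | m≤n⇒m<n∨m≡n (minOf-≤ υ M)
    ... | yes e | _ = inj₁ (inj₂ (trans e (sym (f0≡0 (minOf-isNC υ)))) , tt)
    ... | no _ | inj₂ e = inj₁ (inj₁ e , tt)
    ... | no ne | inj₁ <M = inj₂ (tt , n≢0⇒n>0 ne , <M)

-- The case n = k

module Base {K : ℕ} (0<K : 0 < K) where
  private
    k = suc K
    module E₁ = Extend 0<K visible-first
    module E₂ = Extend {k} z<s visible-first

  -- The bits record whether `K` and `suc K` join the block of 0. The pair (1, 0) is what `head`
  -- forbids, a minimum `suc K` with `K` in the block of 0; the other three pairs form a chain in
  -- which `suc K` joins first.
  bits : Fin 3 → Fin 2 × Fin 2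
  bits zero             = zero , zero
  bits (suc zero)       = zero , suc zero
  bits (suc (suc zero)) = suc zero , suc zero

  bits-injective : ∀ {d e} → bits d ≡ bits e → d ≡ e
  bits-injective {zero} {zero} _ = refl
  bits-injective {suc zero} {suc zero} _ = refl
  bits-injective {suc (suc zero)} {suc (suc zero)} _ = refl
  bits-injective {zero} {suc zero} ()
  bits-injective {zero} {suc (suc zero)} ()
  bits-injective {suc zero} {suc (suc zero)} ()

  triple : NC K × Fin 3 → NC (suc k)
  triple (σ , e) = E₂.extend (E₁.extend (σ , proj₁ (bits e)) , proj₂ (bits e))

  tripleWeight : NC K × Fin 3 → ℕ
  tripleWeight (σ , e) = numBlocks σ + (2 ∸ toℕ e)

  private
    numBlocks-double : ∀ σ d e → numBlocks (E₂.extend (E₁.extend (σ , d) , e)) ≡ numBlocks σ +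
        ((1 ∸ toℕ d) + (1 ∸ toℕ e))
    numBlocks-double σ d e = trans (E₂.numBlocks-extend (E₁.extend (σ , d) , e))
      (trans (cong (_+ (1 ∸ toℕ e)) (E₁.numBlocks-extend (σ , d))) (+-assoc (numBlocks σ) _ _))

  numBlocks-triple : ∀ x → numBlocks (triple x) ≡ tripleWeight x
  numBlocks-triple (σ , zero)           = numBlocks-double σ zero zero
  numBlocks-triple (σ , suc zero)       = numBlocks-double σ zero (suc zero)
  numBlocks-triple (σ , suc (suc zero)) = numBlocks-double σ (suc zero) (suc zero)

  triple-injective : ∀ {x y} → triple x ≡ triple y → x ≡ y
  triple-injective {σ , d} {τ , e} p
    with eq₂ ← E₂.extend-injective {_ , proj₂ (bits d)} {_ , proj₂ (bits e)} p
    with eq₁ ← E₁.extend-injective {σ , proj₁ (bits d)} {τ , proj₁ (bits e)} (cong proj₁ eq₂) =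
    cong₂ _,_ (cong proj₁ eq₁) (bits-injective (cong₂ _,_ (cong proj₂ eq₁) (cong proj₂ eq₂)))

  triple-Cover : ∀ {x y} → (Cover K ⊗ _↑_) x y → Cover K (triple x) (triple y)
  triple-Cover (left {y = zero} c)           = E₂.extend-Coverˡ zero (E₁.extend-Coverˡ zero c)
  triple-Cover (left {y = suc zero} c)       = E₂.extend-Coverˡ (suc zero) (E₁.extend-Coverˡ zero c)
  triple-Cover (left {y = suc (suc zero)} c) = E₂.extend-Coverˡ (suc zero) (E₁.extend-Coverˡ (suc zero) c)
  -- `K` is still a singleton when `suc K` joins the block of 0, so the label is not k.
  triple-Cover (right {σ} {zero} {suc zero} _) = E₂.extend-Coverʳ
    (λ _ e → >⇒≢ 0<K (trans (sym (E₁.minOf-extend₀-m σ))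
        (trans e (f0≡0 (minOf-isNC (E₁.extend (σ , zero))))))) {zero} {suc zero} (up refl)
  triple-Cover (right {σ} {suc zero} {suc (suc zero)} _) = E₂.extend-Coverˡ (suc zero)
    (E₁.extend-Coverʳ (Avoids-< (minOf σ) ≤-refl) {zero} {suc zero} (up refl))
  triple-Cover (right {_} {zero} {zero} (up ()))
  triple-Cover (right {_} {zero} {suc (suc zero)} (up ()))
  triple-Cover (right {_} {suc zero} {zero} (up ()))
  triple-Cover (right {_} {suc zero} {suc zero} (up ()))
  triple-Cover (right {_} {suc (suc zero)} {zero} (up ()))
  triple-Cover (right {_} {suc (suc zero)} {suc zero} (up ()))
  triple-Cover (right {_} {suc (suc zero)} {suc (suc zero)} (up ()))

  -- Cases for the minima a of the block of k + 1 and c of that of k: Outer is a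
  -- copy of NC_K × C₃, Middle is NC_c × NC_{K−c} × C₂ summed over 0 < c < K, and
  -- Inner is NC_a × NC_{k−a} summed over 0 < a < K (minima counted from 0).
  Outer Middle Inner : NC (suc k) → Set
  Outer υ  = (minOf υ k ≡ k × minOf υ K ≡ K) ⊎ (minOf υ k ≡ 0 × (minOf υ K ≡ K ⊎ minOf υ K ≡ 0))
  Middle υ = (minOf υ k ≡ k ⊎ minOf υ k ≡ minOf υ 0) × 1 ≤ minOf υ K × minOf υ K < K
  Inner υ  = ⊤ × 1 ≤ minOf υ k × minOf υ k < K

  private
    0≡f0 : ∀ {m} (υ : NC m) {i} → minOf υ i ≡ 0 → minOf υ i ≡ minOf υ 0
    0≡f0 υ e = trans e (sym (f0≡0 (minOf-isNC υ)))

    ≡0 : ∀ {m} (υ : NC m) {i} → minOf υ i ≡ minOf υ 0 → minOf υ i ≡ 0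
    ≡0 υ e = trans e (f0≡0 (minOf-isNC υ))

    K≢k : K ≢ k
    K≢k = <⇒≢ ≤-refl

  triple-Outer : ∀ x → Outer (triple x)
  triple-Outer (σ , zero) = inj₁ (E₂.minOf-extend₀-m ρ ,
    trans (E₂.minOf-extend-≢ ρ zero K≢k) (E₁.minOf-extend₀-m σ))
    where ρ = E₁.extend (σ , zero)
  triple-Outer (σ , suc zero) = inj₂ (trans (E₂.minOf-extend₁-m ρ) (f0≡0 (minOf-isNC ρ)) ,
    inj₁ (trans (E₂.minOf-extend-≢ ρ (suc zero) K≢k) (E₁.minOf-extend₀-m σ)))
    where ρ = E₁.extend (σ , zero)
  triple-Outer (σ , suc (suc zero)) = inj₂ (trans (E₂.minOf-extend₁-m ρ) (f0≡0 (minOf-isNC ρ)) ,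
    inj₂ (trans (E₂.minOf-extend-≢ ρ (suc zero) K≢k) (trans (E₁.minOf-extend₁-m σ) (f0≡0 (minOf-isNC σ)))))
    where ρ = E₁.extend (σ , suc zero)

  triple-onto : ∀ {υ} → Outer υ → ∃ λ x → (⊤ × ⊤) × triple x ≡ υ
  triple-onto {υ} o with E₂.extend-onto υ ([ (λ (e , _) → inj₁ e) , (λ (e , _) → inj₂ (0≡f0 υ e)) ]′ o)
  ... | (ρ , d) , refl , same with E₁.extend-onto ρ (atK o)
    where
    atK : Outer υ → minOf ρ K ≡ K ⊎ minOf ρ K ≡ minOf ρ 0
    atK (inj₁ (_ , e))      = inj₁ (trans (same ≤-refl) e)
    atK (inj₂ (_ , inj₁ e)) = inj₁ (trans (same ≤-refl) e)
    atK (inj₂ (_ , inj₂ e)) = inj₂ (0≡f0 ρ (trans (same ≤-refl) e))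
  ... | (σ , zero) , refl , _ = combine d
    where
    combine : ∀ d → ∃ λ x → (⊤ × ⊤) × triple x ≡ E₂.extend (E₁.extend (σ , zero) , d)
    combine zero       = (σ , zero) , _ , refl
    combine (suc zero) = (σ , suc zero) , _ , refl
  ... | (σ , suc zero) , refl , _ = combine d o
    where
    ρ′ = E₁.extend (σ , suc zero)
    combine : ∀ d → Outer (E₂.extend (ρ′ , d)) → ∃ λ x → (⊤ × ⊤) × triple x ≡ E₂.extend (ρ′ , d)
    combine (suc zero) _ = (σ , suc (suc zero)) , _ , refl
    combine zero (inj₁ (_ , e)) = contradiction (trans (sym (trans (E₂.minOf-extend-≢ ρ′ zero K≢k)
      (trans (E₁.minOf-extend₁-m σ) (f0≡0 (minOf-isNC σ))))) e) (<⇒≢ 0<K)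
    combine zero (inj₂ (e , _)) = contradiction (trans (sym (E₂.minOf-extend₀-m ρ′)) e) λ ()

  Good⇒parts : ∀ {υ} → Good K (minOf υ) → Outer υ ⊎ Middle υ ⊎ Inner υ
  Good⇒parts {υ} gd with gd .head | m≤n⇒m<n∨m≡n (minOf-≤ υ K)
  ... | inj₁ (fk≡k , fK≢0) | inj₂ fK≡K = inj₁ (inj₁ (fk≡k , fK≡K))
  ... | inj₁ (fk≡k , fK≢0) | inj₁ fK<K = inj₂ (inj₁ (inj₁ fk≡k , n≢0⇒n>0 fK≢0 , fK<K))
  ... | inj₂ fk<K | fK with minOf υ k ≟ 0 | minOf υ K ≟ 0 | fK
  ...   | no fk≢0  | _        | _         = inj₂ (inj₂ (tt , n≢0⇒n>0 fk≢0 , fk<K))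
  ...   | yes fk≡0 | yes fK≡0 | _         = inj₁ (inj₂ (fk≡0 , inj₂ fK≡0))
  ...   | yes fk≡0 | no _     | inj₂ fK≡K = inj₁ (inj₂ (fk≡0 , inj₁ fK≡K))
  ...   | yes fk≡0 | no fK≢0  | inj₁ fK<K = inj₂ (inj₁ (inj₂ (0≡f0 υ fk≡0) , n≢0⇒n>0 fK≢0 , fK<K))

  parts⇒Good : ∀ {υ} → Outer υ ⊎ Middle υ ⊎ Inner υ → Good K (minOf υ)
  parts⇒Good {υ} _ .tail K<x = inj₁ (minOf-beyond υ (s≤s K<x))
  parts⇒Good {υ} p .head with p
  ... | inj₁ (inj₁ (fk≡k , fK≡K)) = inj₁ (fk≡k , λ fK≡0 → >⇒≢ 0<K (trans (sym fK≡K) fK≡0))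
  ... | inj₁ (inj₂ (fk≡0 , _)) = inj₂ (subst (_< K) (sym fk≡0) 0<K)
  ... | inj₂ (inj₁ (inj₁ fk≡k , 0<fK , _)) = inj₁ (fk≡k , >⇒≢ 0<fK)
  ... | inj₂ (inj₁ (inj₂ fk≡f0 , _)) = inj₂ (subst (_< K) (sym (≡0 υ fk≡f0)) 0<K)
  ... | inj₂ (inj₂ (_ , _ , fk<K)) = inj₂ fk<K

  SCD-base : SCDₖ {K} {suc k} (suc (suc k)) (λ υ → Good K (minOf υ))
  SCD-base = SCD-⇔ (λ {υ} → parts⇒Good {υ}) (λ {υ} → Good⇒parts {υ})
      (SCD-∪ {P = Outer} {Q = λ υ → Middle υ ⊎ Inner υ} outer-disjoint outer
    (SCD-∪ {P = Middle} {Q = Inner} middle-disjoint middle inner))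
    where
    nc : ∀ m → 0 < m → m < k → SCDₖ {K} {m} (suc m) (λ _ → ⊤)
    nc m 0<m m<k = SCD-NC m m ≤-refl 0<m (<⇒≤ m<k)
    graded₃ : ∀ {i j : Fin 3} → i ↑ j → 2 ∸ toℕ i ≡ suc (2 ∸ toℕ j)
    graded₃ {zero} {suc zero} _ = refl
    graded₃ {suc zero} {suc (suc zero)} _ = refl
    graded₃ {zero} {zero} (up ())
    graded₃ {zero} {suc (suc zero)} (up ())
    graded₃ {suc zero} {zero} (up ())
    graded₃ {suc zero} {suc zero} (up ())
    graded₃ {suc (suc zero)} {zero} (up ())
    graded₃ {suc (suc zero)} {suc zero} (up ())
    graded₃ {suc (suc zero)} {suc (suc zero)} (up ())
    outer : SCDₖ {K} {suc k} (suc (suc k)) Outer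
    outer = subst (λ N → SCDₖ {K} {suc k} N Outer) (+-comm k 2)
      (SCD-map triple triple-injective (λ _ _ → triple-Cover) numBlocks-triple
          (λ {x} _ → triple-Outer x) triple-onto
        (SCD-× gradedCover graded₃ (nc K 0<K ≤-refl) SCD-3))
    middle : SCDₖ {K} {suc k} (suc (suc k)) Middle
    middle = subst (λ N → SCDₖ {K} {suc k} N Middle) (+-comm (suc k) 1)
      -- With `K` outside the block of 0, `suc K` may join that block without label k.
      (SCD-extend z<s visible-first {P = λ f → 1 ≤ f K × f K < K}
        (λ {σ} (0<fK , _) _ e → >⇒≢ 0<fK (≡0 σ e))
        (λ same (0<fK , fK<K) → subst (1 ≤_) (same ≤-refl) 0<fK , subst (_< K) (same ≤-refl) fK<K)
        (SCD-⇔ proj₂ (tt ,_) (SCD-inner (n≤1+n K) (λ m 0<m m<K → nc m 0<m (m<n⇒m<1+n m<K)) z<s ≤-refl)))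
    inner : SCDₖ {K} {suc k} (suc (suc k)) Inner
    -- The bound `K` leaves out the minimum `K` for the block of `suc K`, the one value between the
    -- extremes that `head` forbids.
    inner = SCD-inner ≤-refl nc z<s (n≤1+n K)
    outer-disjoint : ∀ {υ} → Outer υ → ¬ (Middle υ ⊎ Inner υ)
    outer-disjoint (inj₁ (_ , fK≡K)) (inj₁ (_ , _ , fK<K)) = <⇒≢ fK<K fK≡K
    outer-disjoint (inj₂ (_ , inj₁ fK≡K)) (inj₁ (_ , _ , fK<K)) = <⇒≢ fK<K fK≡K
    outer-disjoint (inj₂ (_ , inj₂ fK≡0)) (inj₁ (_ , 0<fK , _)) = >⇒≢ 0<fK fK≡0
    outer-disjoint (inj₁ (fk≡k , _)) (inj₂ (_ , _ , fk<K)) = <⇒≢ (m<n⇒m<1+n fk<K) fk≡k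
    outer-disjoint (inj₂ (fk≡0 , _)) (inj₂ (_ , 0<fk , _)) = >⇒≢ 0<fk fk≡0
    middle-disjoint : ∀ {υ} → Middle υ → ¬ Inner υ
    middle-disjoint (inj₁ fk≡k , _) (_ , _ , fk<K) = <⇒≢ (m<n⇒m<1+n fk<K) fk≡k
    middle-disjoint {υ} (inj₂ fk≡f0 , _) (_ , 0<fk , _) = >⇒≢ 0<fk (≡0 υ fk≡f0)

open Base using (SCD-base)

-- From n to n + 1

module _ {K : ℕ} (0<K : 0 < K) where
  Good-truncate : ∀ {m n} {υ : NC m} → suc K ≤ n →
                  (minOf υ (suc n) ≡ suc n ⊎ minOf υ (suc n) ≡ minOf υ n) × Good K
                      (truncate (suc n) (minOf υ)) →
                  m ≤ suc (suc n) → Good K (minOf υ)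
  Good-truncate {n = n} {υ} k≤n (last , gd) m≤ .tail {x} K<x with <-cmp x n
  ... | tri< x<n _ _ = Sum.map (trans (sym (truncate-< (s≤s x<n))))
        (λ e → trans (sym (truncate-< (s≤s x<n))) (trans e (truncate-< (m<n⇒m<1+n x<n)))) (gd .tail K<x)
  ... | tri≈ _ refl _ = last
  ... | tri> _ _ n<x = inj₁ (minOf-beyond υ (≤-trans m≤ (s≤s n<x)))
  Good-truncate k≤n (last , gd) m≤ .head = Sum.map
    (λ (e , ne) → trans (sym (truncate-< (s≤s k≤n))) e , λ e′ → ne (trans (truncate-< (m<n⇒m<1+n k≤n)) e′))
    (subst (_< K) (truncate-< (s≤s k≤n))) (gd .head)

  truncate-Good : ∀ {n f} → suc K ≤ n → Good K f → Good K (truncate (suc n) f)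
  truncate-Good {n} {f} k≤n gd .tail {x} K<x with <-≤-connex (suc x) (suc n)
  ... | inj₁ sx<m = subst₂ (λ u v → u ≡ suc x ⊎ u ≡ v) (sym (truncate-< {f = f} sx<m))
      (sym (truncate-< {f = f} (<-trans ≤-refl sx<m))) (gd .tail K<x)
  ... | inj₂ m≤sx = inj₁ (truncate-≥ m≤sx)
  truncate-Good k≤n gd .head = Sum.map
    (λ (e , ne) → trans (truncate-< (s≤s k≤n)) e , λ e′ → ne (trans (sym (truncate-< (m<n⇒m<1+n k≤n))) e′))
    (subst (_< K) (sym (truncate-< (s≤s k≤n)))) (gd .head)

  -- By `tail` the new point is a minimum or follows its predecessor, which is one free bit.
  -- Absorbing it never produces label k, as it lies beyond `suc K`.
  SCD-Good : ∀ d n → suc K + d ≡ n → SCDₖ {K} {suc n} (suc (suc n)) (λ υ → Good K (minOf υ))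
  SCD-Good zero n k+d≡n rewrite sym k+d≡n | +-identityʳ K = SCD-base 0<K
  SCD-Good (suc d) (suc n) k+d≡n = SCD-⇔ (λ {υ} p → Good-truncate {υ = υ} k≤n p ≤-refl)
    (λ gd → gd .tail k≤n , truncate-Good k≤n gd)
    (subst (λ N → SCDₖ {K} {suc (suc n)} N Extended) (+-comm (suc (suc n)) 1)
      -- `Good` speaks of all indices, whereas `SCD-extend` wants a property that depends only on
      -- the values at the old points; truncation provides this.
      (SCD-extend ≤-refl visible-last {P = λ f → Good K (truncate (suc n) f)}
        (λ _ n≡k → contradiction (suc-injective n≡k) (>⇒≢ k≤n))
        (λ {f} {g} same → Good-cong (agree f g same))
        (SCD-⇔ (λ {σ} → truncate-Good k≤n) (λ {σ} → Good-cong (truncate-self (minOf-beyond σ)))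
            (SCD-Good d n k+d≡n′))))
    where
    k+d≡n′ : suc K + d ≡ n
    k+d≡n′ = suc-injective (trans (sym (+-suc (suc K) d)) k+d≡n)
    k≤n : suc K ≤ n
    k≤n = subst (suc K ≤_) k+d≡n′ (m≤m+n (suc K) d)
    Extended : NC (suc (suc n)) → Set
    Extended υ = (minOf υ (suc n) ≡ suc n ⊎ minOf υ (suc n) ≡ minOf υ n) × Good K (truncate (suc n) (minOf υ))
    agree : ∀ f g → (∀ {i} → i < suc n → f i ≡ g i) → ∀ i → truncate (suc n) f i ≡ truncate (suc n) g i
    agree f g same i with i <? suc n
    ... | yes i<m = same i<m
    ... | no _ = refl

-- Decomposition of the poset

numBlocks-≤ : ∀ {m} (σ : NC m) → numBlocks σ ≤ m
numBlocks-≤ {m} σ = begin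
  numBlocks σ                                                              ≡⟨ length-map (NC.block σ) minima ⟩
  List.length minima                                                       ≤⟨ length-filter
      (λ i → lookup (rep σ) i Fin.≟ i) (List.allFin m) ⟩
  List.length (List.allFin m)                                              ≡⟨ length-tabulate id ⟩
  m                                                                        ∎
  where
  open ≤-Reasoning
  minima = List.filter (λ i → lookup (rep σ) i Fin.≟ i) (List.allFin m)

module _ {A : Set} where
  last-∷ : ∀ (x : A) (ys : List⁺ A) → List⁺.last (x ∷ toList ys) ≡ List⁺.last ys
  last-∷ x (y ∷ ys) with List.initLast ys
  ... | [] = refl
  ... | _ List.∷ʳ′ _ = refl

module _ {n K : ℕ} (0<K : 0 < K) (k≤n : suc K ≤ n) where
  private
    P = PosetPF n (suc K)
    El = Element n (suc K)
    module C = Chains P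

    element : ∀ {σ} → Good K (minOf σ) → El
    element {σ} gd = σ , Good⇒Element 0<K k≤n gd

    -- The order of the poset is contained in refinement, so anything strictly between the two would
    -- also lie between them in NC_{n+1}, where a merge is a covering relation.
    cover : ∀ {σ τ} → Cover K σ τ → (gσ : Good K (minOf σ)) (gτ : Good K (minOf τ)) → element gσ C.⋖ element gτ
    cover {σ} {τ} c gσ gτ = (Step⇒Edge 0<K k≤n step ◅ ε , Step-≢ 0<K step) , λ
      (υ , _) (σ≤υ , σ≢υ) (υ≤τ , υ≢τ) → [ (λ e → σ≢υ (sym e)) , υ≢τ ]′ (Step-covers 0<K step {υ}
          (Star⇒≼ σ≤υ) (Star⇒≼ υ≤τ))
      where
      step : Step K σ τ
      step = record { merge = c .merge ; avoids = c .avoids ; good-σ = gσ ; good-τ = gτ }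

    AllGood : List (NC (suc n)) → Set
    AllGood σs = ∀ {σ} → σ ∈ σs → Good K (minOf σ)

    elements : ∀ {σ τ} (p : Star (Cover K) σ τ) → AllGood (vertices p) → List⁺ El
    elements ε gd = element (gd (here refl)) ∷ []
    elements (c ◅ p) gd = element (gd (here refl)) ∷ toList (elements p (gd ∘ there))

    map-elements : ∀ {σ τ} (p : Star (Cover K) σ τ) (gd : AllGood (vertices p)) →
                   List.map proj₁ (toList (elements p gd)) ≡ vertices p
    map-elements ε gd = refl
    map-elements {σ} (c ◅ p) gd = cong (σ ∷_) (map-elements p (gd ∘ there))

    elements-Linked : ∀ {σ τ} (p : Star (Cover K) σ τ) (gd : AllGood (vertices p)) → Linked C._⋖_
        (toList (elements p gd))
    elements-Linked ε gd = [-]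
    elements-Linked (c ◅ ε) gd = cover c (gd (here refl)) (gd (there (here refl))) ∷ [-]
    elements-Linked (c ◅ p@(_ ◅ _)) gd = cover c (gd (here refl)) (gd (there (here refl)))
        ∷ elements-Linked p (gd ∘ there)

    head-elements : ∀ {σ τ} (p : Star (Cover K) σ τ) (gd : AllGood (vertices p)) → proj₁
        (List⁺.head (elements p gd)) ≡ σ
    head-elements ε gd = refl
    head-elements (c ◅ p) gd = refl

    last-elements : ∀ {σ τ} (p : Star (Cover K) σ τ) (gd : AllGood (vertices p)) → proj₁
        (List⁺.last (elements p gd)) ≡ τ
    last-elements ε gd = refl
    last-elements (c ◅ p) gd = trans
        (cong proj₁ (last-∷ (element (gd (here refl))) (elements p (gd ∘ there))))
        (last-elements p (gd ∘ there))

    -- Rank and block count add up to n + 1, so ends with n + 2 blocks in total have total rank 2(n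
    -- + 1) - (n + 2) = n.
    rank-+ : ∀ {h l} → h ≤ suc n → l ≤ suc n → h + l ≡ suc (suc n) → (suc n ∸ h) + (suc n ∸ l) ≡ n
    rank-+ {h} {l} h≤ l≤ e = +-cancelˡ-≡ (suc (suc n)) _ _ (begin
      suc (suc n) + ((suc n ∸ h) + (suc n ∸ l))     ≡⟨ cong (_+ ((suc n ∸ h) + (suc n ∸ l))) e ⟨
      (h + l) + ((suc n ∸ h) + (suc n ∸ l))         ≡⟨ interchange h l _ _ ⟩
      (h + (suc n ∸ h)) + (l + (suc n ∸ l))         ≡⟨ cong₂ _+_ (m+[n∸m]≡n h≤) (m+[n∸m]≡n l≤) ⟩
      suc n + suc n                                 ≡⟨ +-suc (suc n) n ⟩
      suc (suc n) + n                               ∎)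
      where
      open ≡-Reasoning

    elementChains : (cs : List (Chain (Cover K))) → AllGood (concatMap chainVertices cs) → List (List⁺ El)
    elementChains [] gd = []
    elementChains ((_ , _ , p) ∷ cs) gd = elements p (gd ∘ ∈-++⁺ˡ) ∷ elementChains cs (gd ∘ ∈-++⁺ʳ (vertices p))

    map-elementChains : ∀ cs (gd : AllGood (concatMap chainVertices cs)) →
                        List.map proj₁ (concatMap toList (elementChains cs gd)) ≡ concatMap chainVertices cs
    map-elementChains [] gd = refl
    map-elementChains ((_ , _ , p) ∷ cs) gd = trans (map-++ proj₁ (toList (elements p (gd ∘ ∈-++⁺ˡ))) _)
      (cong₂ _++_ (map-elements p (gd ∘ ∈-++⁺ˡ)) (map-elementChains cs (gd ∘ ∈-++⁺ʳ (vertices p))))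

    elementChains-symmetric : ∀ cs (gd : AllGood (concatMap chainVertices cs)) →
      All (λ (σ , τ , _) → numBlocks σ + numBlocks τ ≡ suc (suc n)) cs →
      All (C.IsSymmetricChain (rank {n} {suc K}) n) (elementChains cs gd)
    elementChains-symmetric [] gd [] = []
    elementChains-symmetric ((σ , τ , p) ∷ cs) gd (e ∷ es) =
      (elements-Linked p (gd ∘ ∈-++⁺ˡ) ,
       trans (cong₂ (λ σ τ → (suc n ∸ numBlocks σ) + (suc n ∸ numBlocks τ))
           (head-elements p (gd ∘ ∈-++⁺ˡ)) (last-elements p (gd ∘ ∈-++⁺ˡ)))
         (rank-+ (numBlocks-≤ σ) (numBlocks-≤ τ) e)) ∷
      elementChains-symmetric cs (gd ∘ ∈-++⁺ʳ (vertices p)) es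

  decomposition : HasSymmetricChainDecomposition (PosetPF n (suc K)) (rank {n} {suc K}) n
  decomposition = elementChains (chains s) (sound s) , elementChains-symmetric (chains s) (sound s)
      (symmetric s) ,
    -- Elements of the poset are compared by their partitions alone, so uniqueness and membership
    -- are read off from the list of first components.
    AllPairs.map⁻ (subst Unique (sym vertices-eq) (unique s)) ,
    λ (σ , c , pf , σ∈c) → Any.map⁻ (subst (σ ∈_) (sym vertices-eq) (complete s (chain-Good k≤n pf {σ} σ∈c)))
    where
    s = SCD-Good 0<K (n ∸ suc K) n (m+[n∸m]≡n k≤n)
    vertices-eq = map-elementChains (chains s) (sound s)

theorem2p12 : (n k : ℕ) → 1 < k → k ≤ n →
    HasSymmetricChainDecomposition (PosetPF n k) (rank {n} {k}) n
theorem2p12 n (suc K) (s≤s 0<K) k≤n = decomposition 0<K k≤n
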